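{- Let $F_2$ be the graph with vertex set $\{1,2,3,4,5\}$ and edge set $\{12,15,23,24,34,35,45\}$ (the graph obtained from $K_4$ by subdividing one edge once). The problem $F_2$-Induced Minor is solvable in polynomial time.
   Context: All graphs are finite and simple. A graph $G$ contains $H$ as an induced minor if $H$ can be obtained from $G$ by vertex deletions and edge contractions. The problem $H$-Induced Minor takes a graph $G$ as input and asks whether $G$ contains $H$ as an induced minor. -}

module Defs where

open import Data.Nat using (ℕ; zero; suc; _+_; _*_; _^_)
open import Data.Fin using (Fin; zero; suc; punchIn; toℕ; _≟_)
open import Data.Bool using (Bool; true; false; _∨_; _∧_; if_then_else_)
open import Data.List using (List; []; _∷_; concatMap; map; allFin; length)
open import Data.Maybe using (Maybe; just; nothing)
open import Data.Product using (Σ; _×_; _,_)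
open import Data.Sum using (_⊎_; inj₁; inj₂)
open import Relation.Binary.PropositionalEquality using (_≡_)
open import Relation.Nullary using (does)
open import Function.Bundles using (_↔_; Inverse)

Graph : ℕ → Set
Graph n = Fin n → Fin n → Bool

IsSimple : ∀ {n} → Graph n → Set
IsSimple {n} G = ((i j : Fin n) → G i j ≡ G j i) × ((i : Fin n) → G i i ≡ false)

_≅_ : ∀ {m n} → Graph m → Graph n → Set
_≅_ {m} {n} H G =
  Σ (Fin m ↔ Fin n) λ f → (i j : Fin m) → H i j ≡ G (Inverse.to f i) (Inverse.to f j)

deleteV : ∀ {n} → Fin (suc n) → Graph (suc n) → Graph n
deleteV v G i j = G (punchIn v i) (punchIn v j)

-- contracting the edge between u = punchIn v u' and v: v is merged into u
-- (v is removed, u becomes adjacent to the union of both neighbourhoods)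
contractE : ∀ {n} → Fin (suc n) → Fin n → Graph (suc n) → Graph n
contractE v u' G i j =
  if does (i ≟ j) then false
  else (G (punchIn v i) (punchIn v j)
        ∨ (does (i ≟ u') ∧ G v (punchIn v j))
        ∨ (does (j ≟ u') ∧ G (punchIn v i) v))

data _≼_ {m : ℕ} (H : Graph m) : {n : ℕ} → Graph n → Set where
  im-iso : ∀ {n} {G : Graph n} → H ≅ G → H ≼ G
  im-del : ∀ {n} {G : Graph (suc n)} (v : Fin (suc n)) →
           H ≼ deleteV v G → H ≼ G
  im-con : ∀ {n} {G : Graph (suc n)} (v : Fin (suc n)) (u' : Fin n) →
           G (punchIn v u') v ≡ true → H ≼ contractE v u' G → H ≼ G

-- The graph F₂ on {1,…,5} (here Fin 5 = {0,…,4}, vertex k ↦ k-1) with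
-- edges 12,15,23,24,34,35,45.

F₂edge : ℕ → ℕ → Bool
F₂edge 0 1 = true
F₂edge 0 4 = true
F₂edge 1 2 = true
F₂edge 1 3 = true
F₂edge 2 3 = true
F₂edge 2 4 = true
F₂edge 3 4 = true
F₂edge _ _ = false

F₂ : Graph 5
F₂ i j = F₂edge (toℕ i) (toℕ j) ∨ F₂edge (toℕ j) (toℕ i)

-- Deterministic single-tape Turing machines (bi-infinite tape).
-- Tape alphabet Fin (3 + Γ): 0 = blank, 1 = bit 0, 2 = bit 1.
-- States Fin (suc Q), 0 = initial.  A transition either halts with a
-- Boolean answer or writes, changes state and moves.

data Move : Set where
  L R S : Move

record TM : Set where
  field
    Q : ℕ
    Γ : ℕ
    δ : Fin (suc Q) → Fin (3 + Γ) →
        Bool ⊎ (Fin (suc Q) × Fin (3 + Γ) × Move)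

module _ (M : TM) where
  open TM M

  Sym : Set
  Sym = Fin (3 + Γ)

  blank : Sym
  blank = zero

  -- state, cells left of the head (nearest first), cells from the head rightwards
  record Config : Set where
    constructor conf
    field
      state : Fin (suc Q)
      left  : List Sym
      right : List Sym

  headSym : List Sym → Sym
  headSym []      = blank
  headSym (x ∷ _) = x

  tailSym : List Sym → List Sym
  tailSym []       = []
  tailSym (_ ∷ xs) = xs

  moveHead : Move → List Sym → List Sym → Fin (suc Q) → Config
  moveHead L []       r q = conf q [] (blank ∷ r)
  moveHead L (x ∷ ls) r q = conf q ls (x ∷ r)
  moveHead R ls []       q = conf q ls []
  moveHead R ls (x ∷ r) q = conf q (x ∷ ls) r
  moveHead S ls r q = conf q ls r

  step : Config → Bool ⊎ Config
  step (conf q ls rs) with δ q (headSym rs)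
  ... | inj₁ b = inj₁ b
  ... | inj₂ (q' , w , mv) = inj₂ (moveHead mv ls (w ∷ tailSym rs) q')

  run : ℕ → Config → Maybe Bool
  run zero    c = nothing
  run (suc t) c with step c
  ... | inj₁ b  = just b
  ... | inj₂ c' = run t c'

  bitSym : Bool → Sym
  bitSym false = suc zero
  bitSym true  = suc (suc zero)

  initConf : List Bool → Config
  initConf w = conf zero [] (map bitSym w)

encode : ∀ {n} → Graph n → List Bool
encode {n} G = concatMap (λ i → map (G i) (allFin n)) (allFin n)

DecidesInPolyTime : (∀ {n} → Graph n → Set) → Set
DecidesInPolyTime P =
  Σ TM λ M → Σ ℕ λ c →
    ∀ {n} (G : Graph n) → IsSimple G →
      Σ Bool λ b →
        (run M (c * length (encode G) ^ c + c) (initConf M (encode G)) ≡ just b)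
        × ((b ≡ true → P G) × (P G → b ≡ true))

{-# OPTIONS --safe #-}
module Submission where

-- Call the bags of a model of F₂ in G, for the vertices 1, 2, 3, 4, 5, by W, X, B, C, Y.
-- X and Y can be shrunk to at most two vertices: a non-cut vertex of X can be discarded or
-- moved to another bag, unless X has just two of them, both touching W, one being the only
-- contact of X with B and the other the only contact with C; then either they are adjacent
-- and suffice, or they become singleton bags for 2 and 5 in a rearranged model.
-- Replacing W by a shortest induced path starting at some v next to X, one may take B ∪ C
-- inside a component K of G − X − Y − N[v] such that v reaches Y outside N[K]: any other
-- attachment of K to the path gives a model with a shorter path.  Conversely, if no vertex
-- of such a K separates X from Y within K, then by Menger K contains two disjoint connected
-- sets joining X to Y, which can serve as B and C.
-- Hence F₂ ≼ G is expressed by a formula that quantifies over six vertices and otherwise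
-- only uses first-order logic and reachability.  A one-tape machine evaluates any such
-- formula in polynomial time by keeping each variable as a track of marks on the adjacency
-- matrix; n is recovered as the least k with k² ≥ length of the input.

open import Defs
open import Data.Bool using (Bool; true; false; not; _∧_; _∨_; if_then_else_; T)
open import Data.Empty using (⊥; ⊥-elim)
open import Data.Fin using (Fin; zero; suc; toℕ; fromℕ<; punchIn; punchOut; _↑ˡ_; _↑ʳ_; splitAt; combine; remQuot)
import Data.Fin.Properties as Finₚ
open import Data.List using (List; tabulate; []; _∷_; _++_; map; length; allFin; concatMap; reverse; applyUpTo)
import Data.Bool.Properties as Boolₚ
import Data.List.Properties as Listₚ
open import Data.List.Membership.Propositional using (_∈_)
import Data.List.Membership.DecPropositional as DecPropositional
open import Data.List.Membership.Propositional.Properties using (∈-allFin)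
open import Data.List.Relation.Unary.All using (All; []; _∷_)
import Data.List.Relation.Unary.All as All
open import Data.List.Relation.Unary.Any using (here; there)
import Data.Maybe.Properties as Maybeₚ
open import Data.Maybe using (Maybe; just; nothing)
open import Data.Nat
open import Data.Nat.Properties
open import Data.Product using (Σ; ∃; _×_; _,_; proj₁; proj₂)
open import Data.Sum using (_⊎_; inj₁; inj₂; [_,_]′)
open import Data.Unit using (⊤; tt)
open import Data.Vec using (Vec; []; _∷_)
open import Function using (_∘_; id; case_of_)
open import Function.Bundles using (Inverse; mk↔ₛ′)
open import Relation.Binary.Definitions using (tri<; tri≈; tri>)
open import Relation.Binary.PropositionalEquality
open import Relation.Nullary using (¬_; Dec; yes; no; does; ¬?; _×-dec_; _⊎-dec_)

-- The obstacle is that W, B and C are unbounded, and that disjoint connected sets with prescribed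
-- contacts amount to a disjoint paths problem. Bounding X and Y removes it: B and C both have to
-- join X to Y, so nothing prescribes which path ends where, and a cut vertex test in K suffices.
-- Their mutual contact comes for free, since K is connected and one of them can be extended inside
-- K. W needs no search either, being everything that v reaches away from X, Y and the neighbourhood
-- of K. The induced path serves only to show that a certificate exists; the certificate mentions
-- none, and every certificate yields a model. When a vertex u prevents K from being a whole
-- component, the first neighbour of u on the path takes over the role of 5, while u, the rest of
-- the path and the old Y are absorbed into K. This destroys B and C as separate sets but preserves
-- that no vertex cuts K between X and Y, which is why the argument carries K along instead of B and
-- C.

-- Finite types as machine states and symbols

record Finite (A : Set) : Set where
  field
    size    : ℕ
    enc     : A → Fin size
    dec     : Fin size → A
    -- A retraction suffices: a simulated machine only meets codes of actual values, so the
    -- behaviour of `dec` elsewhere is immaterial.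
    dec-enc : ∀ a → dec (enc a) ≡ a

finite-⊤ : Finite ⊤
finite-⊤ = record { size = 1 ; enc = λ _ → zero ; dec = λ _ → tt ; dec-enc = λ _ → refl }

finite-Bool : Finite Bool
finite-Bool = record
  { size = 2
  ; enc = λ { false → zero ; true → suc zero }
  ; dec = λ { zero → false ; (suc _) → true }
  ; dec-enc = λ { false → refl ; true → refl } }

finite-⊎ : ∀ {A B} → Finite A → Finite B → Finite (A ⊎ B)
finite-⊎ {A} {B} FA FB = record { size = FA.size + FB.size ; enc = e ; dec = d ; dec-enc = de }
  where
  module FA = Finite FA
  module FB = Finite FB
  e : A ⊎ B → Fin (FA.size + FB.size)
  e (inj₁ a) = FA.enc a ↑ˡ FB.size
  e (inj₂ b) = FA.size ↑ʳ FB.enc b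
  d′ : Fin FA.size ⊎ Fin FB.size → A ⊎ B
  d′ (inj₁ i) = inj₁ (FA.dec i)
  d′ (inj₂ j) = inj₂ (FB.dec j)
  d : Fin (FA.size + FB.size) → A ⊎ B
  d i = d′ (splitAt FA.size i)
  de : ∀ x → d (e x) ≡ x
  de (inj₁ a) rewrite Finₚ.splitAt-↑ˡ FA.size (FA.enc a) FB.size = cong inj₁ (FA.dec-enc a)
  de (inj₂ b) rewrite Finₚ.splitAt-↑ʳ FA.size FB.size (FB.enc b) = cong inj₂ (FB.dec-enc b)

finite-× : ∀ {A B} → Finite A → Finite B → Finite (A × B)
finite-× {A} {B} FA FB = record { size = FA.size * FB.size ; enc = e ; dec = d ; dec-enc = de }
  where
  module FA = Finite FA
  module FB = Finite FB
  e : A × B → Fin (FA.size * FB.size)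
  e (a , b) = combine (FA.enc a) (FB.enc b)
  d : Fin (FA.size * FB.size) → A × B
  d = (λ (i , j) → FA.dec i , FB.dec j) ∘ remQuot {FA.size} FB.size
  de : ∀ x → d (e x) ≡ x
  de (a , b) = trans (cong (λ (i , j) → FA.dec i , FB.dec j) (Finₚ.remQuot-combine (FA.enc a) (FB.enc b)))
                     (cong₂ _,_ (FA.dec-enc a) (FB.dec-enc b))

finite-Vec : ∀ m → Finite (Vec Bool m)
finite-Vec zero = record { size = 1 ; enc = λ _ → zero ; dec = λ _ → [] ; dec-enc = λ { [] → refl } }
finite-Vec (suc m) = record
  { size = F.size
  ; enc = λ { (b ∷ v) → F.enc (b , v) }
  ; dec = λ i → proj₁ (F.dec i) ∷ proj₂ (F.dec i)
  ; dec-enc = λ { (b ∷ v) → cong (λ p → proj₁ p ∷ proj₂ p) (F.dec-enc (b , v)) } }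
  where module F = Finite (finite-× finite-Bool (finite-Vec m))

-- A command language and its compilation to one-tape Turing machines

-- A pass sweeps the tape once from left to right as a transducer with a Boolean
-- state (initially false) and returns; its final state is the result.
data Cmd (Cell : Set) : Set where
  pass  : (Bool → Cell → Bool × Cell) → Cmd Cell
  neg   : Cmd Cell → Cmd Cell
  _&_   : Cmd Cell → Cmd Cell → Cmd Cell
  _⨾_   : Cmd Cell → Cmd Cell → Cmd Cell
  until : Cmd Cell → Cmd Cell

infixr 6 _&_
infixr 5 _⨾_

sweep : ∀ {Cell : Set} → (Bool → Cell → Bool × Cell) → Bool → List Cell → Bool × List Cell
sweep f b []       = b , []
sweep f b (x ∷ xs) = proj₁ r , proj₂ (f b x) ∷ proj₂ r
  where r = sweep f (proj₁ (f b x)) xs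

data Run {Cell : Set} : Cmd Cell → List Cell → Bool → List Cell → ℕ → Set where
  -- The time is `length xs` steps to the right, a turn at the right blank, `length xs` steps to the
  -- left and a turn at the left blank.
  run-pass  : ∀ {f xs} →
              Run (pass f) xs (proj₁ (sweep f false xs)) (proj₂ (sweep f false xs)) (length xs + (2 + length xs))
  run-neg   : ∀ {c xs b ys k} → Run c xs b ys k → Run (neg c) xs (not b) ys k
  run-&t    : ∀ {c d xs ys b zs k l} → Run c xs true ys k → Run d ys b zs l → Run (c & d) xs b zs (k + l)
  run-&f    : ∀ {c d xs ys k} → Run c xs false ys k → Run (c & d) xs false ys k
  run-⨾     : ∀ {c d xs a ys b zs k l} → Run c xs a ys k → Run d ys b zs l → Run (c ⨾ d) xs b zs (k + l)
  run-stop  : ∀ {c xs ys k} → Run c xs true ys k → Run (until c) xs true ys k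
  run-again : ∀ {c xs ys b zs k l} → Run c xs false ys k → Run (until c) ys b zs l → Run (until c) xs b zs (k + l)

module Machine (Cell : Set) (finite-Cell : Finite Cell) (init : Bool → Cell) where

  private module FC = Finite finite-Cell

  data Symbol : Set where
    blk  : Symbol
    raw  : Bool → Symbol
    cell : Cell → Symbol

  encS : Symbol → Fin (3 + FC.size)
  encS blk         = zero
  encS (raw false) = suc zero
  encS (raw true)  = suc (suc zero)
  encS (cell x)    = suc (suc (suc (FC.enc x)))

  decS : Fin (3 + FC.size) → Symbol
  decS zero                = blk
  decS (suc zero)          = raw false
  decS (suc (suc zero))    = raw true
  decS (suc (suc (suc i))) = cell (FC.dec i)

  decS-encS : ∀ y → decS (encS y) ≡ y
  decS-encS blk         = refl
  decS-encS (raw false) = refl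
  decS-encS (raw true)  = refl
  decS-encS (cell x)    = cong cell (FC.dec-enc x)

  -- Control states; for a pass, inj₁ b is sweeping right in transducer state b
  -- and inj₂ b is returning left with result b.
  St : Cmd Cell → Set
  St (pass f)  = Bool ⊎ Bool
  St (neg c)   = St c
  St (c & d)   = St c ⊎ St d
  St (c ⨾ d)   = St c ⊎ St d
  St (until c) = St c

  finite-St : ∀ c → Finite (St c)
  finite-St (pass f)  = finite-⊎ finite-Bool finite-Bool
  finite-St (neg c)   = finite-St c
  finite-St (c & d)   = finite-⊎ (finite-St c) (finite-St d)
  finite-St (c ⨾ d)   = finite-⊎ (finite-St c) (finite-St d)
  finite-St (until c) = finite-St c

  entry : ∀ c → St c
  entry (pass f)  = inj₁ false
  entry (neg c)   = entry c
  entry (c & d)   = inj₁ (entry c)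
  entry (c ⨾ d)   = inj₁ (entry c)
  entry (until c) = entry c

  -- In continuation style: `exit b` is the state entered when the command finishes with answer b.
  -- The control structures only redirect the exits of their parts and therefore cost no machine
  -- steps.
  δ-cmd : ∀ {X : Set} c → (St c → X) → (Bool → X) → St c → Symbol → X × Symbol × Move
  δ-cmd (pass f) ι exit (inj₁ b) (cell x) = ι (inj₁ (proj₁ (f b x))) , cell (proj₂ (f b x)) , R
  δ-cmd (pass f) ι exit (inj₁ b) y        = ι (inj₂ b) , y , L
  δ-cmd (pass f) ι exit (inj₂ b) (cell x) = ι (inj₂ b) , cell x , L
  δ-cmd (pass f) ι exit (inj₂ b) y        = exit b , y , R
  δ-cmd (neg c) ι exit s y = δ-cmd c ι (exit ∘ not) s y
  δ-cmd (c & d) ι exit (inj₁ s) y =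
    δ-cmd c (ι ∘ inj₁) (λ b → if b then ι (inj₂ (entry d)) else exit false) s y
  δ-cmd (c & d) ι exit (inj₂ s) y = δ-cmd d (ι ∘ inj₂) exit s y
  δ-cmd (c ⨾ d) ι exit (inj₁ s) y = δ-cmd c (ι ∘ inj₁) (λ _ → ι (inj₂ (entry d))) s y
  δ-cmd (c ⨾ d) ι exit (inj₂ s) y = δ-cmd d (ι ∘ inj₂) exit s y
  δ-cmd (until c) ι exit s y = δ-cmd c ι (λ b → if b then exit true else ι (entry c)) s y

  module Compile (c : Cmd Cell) where

    Q′ : Set
    Q′ = ⊤ ⊎ (St c ⊎ Bool)

    private module FQ = Finite (finite-⊎ finite-⊤ (finite-⊎ (finite-St c) finite-Bool))

    data State : Set where
      start : State
      on    : Q′ → State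

    pattern rewind = on (inj₁ tt)
    pattern exec s = on (inj₂ (inj₁ s))
    pattern halt b = on (inj₂ (inj₂ b))

    encQ : State → Fin (suc FQ.size)
    encQ start  = zero
    encQ (on q) = suc (FQ.enc q)

    decQ : Fin (suc FQ.size) → State
    decQ zero    = start
    decQ (suc i) = on (FQ.dec i)

    decQ-encQ : ∀ q → decQ (encQ q) ≡ q
    decQ-encQ start  = refl
    decQ-encQ (on q) = cong on (FQ.dec-enc q)

    δ : State → Symbol → Bool ⊎ (State × Symbol × Move)
    δ start    (raw b)  = inj₂ (start , cell (init b) , R)
    δ start    y        = inj₂ (rewind , y , L)
    δ rewind   (cell x) = inj₂ (rewind , cell x , L)
    δ rewind   y        = inj₂ (exec (entry c) , y , R)
    δ (exec s) y        = inj₂ (δ-cmd c (λ s′ → exec s′) (λ b → halt b) s y)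
    δ (halt b) y        = inj₁ b

    encδ : Bool ⊎ (State × Symbol × Move) → Bool ⊎ (Fin (suc FQ.size) × Fin (3 + FC.size) × Move)
    encδ (inj₁ b)           = inj₁ b
    encδ (inj₂ (q , y , m)) = inj₂ (encQ q , encS y , m)

    machine : TM
    machine = record { Q = FQ.size ; Γ = FC.size ; δ = λ q y → encδ (δ (decQ q) (decS y)) }

    record TConf : Set where
      constructor tconf
      field
        st : State
        ls : List Symbol
        rs : List Symbol

    encC : TConf → Config machine
    encC (tconf q ls rs) = conf (encQ q) (map encS ls) (map encS rs)

    hd : List Symbol → Symbol
    hd []      = blk
    hd (y ∷ _) = y

    tl : List Symbol → List Symbol
    tl []       = []
    tl (_ ∷ ys) = ys

    move : Move → List Symbol → List Symbol → State → TConf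
    move L []       rs       q = tconf q [] (blk ∷ rs)
    move L (y ∷ ls) rs       q = tconf q ls (y ∷ rs)
    move R ls       []       q = tconf q ls []
    move R ls       (y ∷ rs) q = tconf q (y ∷ ls) rs
    move S ls       rs       q = tconf q ls rs

    headSym-enc : ∀ rs → headSym machine (map encS rs) ≡ encS (hd rs)
    headSym-enc []      = refl
    headSym-enc (y ∷ _) = refl

    tailSym-enc : ∀ rs → tailSym machine (map encS rs) ≡ map encS (tl rs)
    tailSym-enc []      = refl
    tailSym-enc (y ∷ _) = refl

    move-enc : ∀ m ls rs q →
               moveHead machine m (map encS ls) (map encS rs) (encQ q) ≡ encC (move m ls rs q)
    move-enc L []       rs       q = refl
    move-enc L (y ∷ ls) rs       q = refl
    move-enc R ls       []       q = refl
    move-enc R ls       (y ∷ rs) q = refl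
    move-enc S ls       rs       q = refl

    step-enc : ∀ {q ls rs q′ y m} → δ q (hd rs) ≡ inj₂ (q′ , y , m) →
               step machine (encC (tconf q ls rs)) ≡ inj₂ (encC (move m ls (y ∷ tl rs) q′))
    step-enc {q} {ls} {rs} {q′} {y} {m} eq
      rewrite headSym-enc rs | decQ-encQ q | decS-encS (hd rs) | eq | tailSym-enc rs
      = cong inj₂ (move-enc m ls (y ∷ tl rs) q′)

    data Steps : ℕ → TConf → TConf → Set where
      done : ∀ {t} → Steps 0 t t
      more : ∀ {k q ls rs q′ y m t} → δ q (hd rs) ≡ inj₂ (q′ , y , m) →
             Steps k (move m ls (y ∷ tl rs) q′) t → Steps (suc k) (tconf q ls rs) t

    steps-++ : ∀ {k l t u v} → Steps k t u → Steps l u v → Steps (k + l) t v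
    steps-++ done        r = r
    steps-++ (more e r′) r = more e (steps-++ r′ r)

    run-steps : ∀ {k t u} l → Steps k t u → run machine (k + l) (encC t) ≡ run machine l (encC u)
    run-steps l done = refl
    run-steps l (more {q = q} {ls} {rs} e r) rewrite step-enc {q} {ls} {rs} e = run-steps l r

    step-halt : ∀ b ls rs → step machine (encC (tconf (halt b) ls rs)) ≡ inj₁ b
    step-halt b ls rs rewrite headSym-enc rs | decQ-encQ (halt b) = refl

    run-halt : ∀ b ls rs l → run machine (suc l) (encC (tconf (halt b) ls rs)) ≡ just b
    run-halt b ls rs l rewrite step-halt b ls rs = refl

    cells : List Cell → List Symbol
    cells = map cell

    -- The normal form of the tape between commands, with one explicit blank on each side and the
    -- head on the first cell. Since every command starts and ends in it, runs of commands are
    -- concatenated without adjustment.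
    tape : State → List Cell → TConf
    tape q xs = tconf q (blk ∷ []) (cells xs ++ blk ∷ [])

    cells-ʳ++ : ∀ xs x (zs : List Symbol) → cells xs ++ cell x ∷ zs ≡ cells (xs ++ x ∷ []) ++ zs
    cells-ʳ++ xs x zs rewrite Listₚ.map-++ cell xs (x ∷ []) = sym (Listₚ.++-assoc (cells xs) (cell x ∷ []) zs)

    -- The head finds a blank on leaving the used part of the tape to the left, whether
    -- or not the blank has been materialised there already.
    Base : List Symbol → Set
    Base zs = ∀ q rs → move L zs rs q ≡ tconf q [] (blk ∷ rs)

    returns : ∀ {q r zs} → Base zs → (∀ x → δ q (cell x) ≡ inj₂ (q , cell x , L)) →
              δ q blk ≡ inj₂ (r , blk , R) → ∀ us x rs →
              Steps (2 + length us) (tconf q (cells us ++ zs) (cell x ∷ rs))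
                    (tconf r (blk ∷ []) (cells (reverse us) ++ cell x ∷ rs))
    returns {q} {r} base hc hb [] x rs =
      more (hc x) (subst (λ t → Steps 1 t (tconf r (blk ∷ []) (cell x ∷ rs))) (sym (base q (cell x ∷ rs))) (more hb done))
    returns {q} {r} {zs} base hc hb (u ∷ us) x rs =
      more (hc x) (subst (λ ys → Steps (2 + length us) (tconf q (cells us ++ zs) (cell u ∷ cell x ∷ rs))
                                       (tconf r (blk ∷ []) ys))
        (trans (cells-ʳ++ (reverse us) u (cell x ∷ rs))
               (cong (λ vs → cells vs ++ cell x ∷ rs) (sym (Listₚ.unfold-reverse u us))))
        (returns base hc hb us u (cell x ∷ rs)))

    returns-from-end : ∀ {q r zs} → Base zs → (∀ x → δ q (cell x) ≡ inj₂ (q , cell x , L)) →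
                       δ q blk ≡ inj₂ (r , blk , R) → ∀ us →
                       Steps (suc (length us)) (move L (cells us ++ zs) (blk ∷ []) q) (tape r (reverse us))
    returns-from-end {q} {r} base hc hb [] =
      subst (λ t → Steps 1 t (tape r [])) (sym (base q (blk ∷ []))) (more hb done)
    returns-from-end {q} {r} {zs} base hc hb (u ∷ us) =
      subst (λ ys → Steps (2 + length us) (move L (cells (u ∷ us) ++ zs) (blk ∷ []) q) (tconf r (blk ∷ []) ys))
        (trans (cells-ʳ++ (reverse us) u (blk ∷ []))
               (cong (λ vs → cells vs ++ blk ∷ []) (sym (Listₚ.unfold-reverse u us))))
        (returns base hc hb us u (blk ∷ []))

    sweeps : ∀ {f : Bool → Cell → Bool × Cell} (q : Bool → State) {t : TConf} {k} →
             (∀ b x → δ (q b) (cell x) ≡ inj₂ (q (proj₁ (f b x)) , cell (proj₂ (f b x)) , R)) →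
             ∀ b xs us →
             Steps k (tconf (q (proj₁ (sweep f b xs))) (cells (reverse (proj₂ (sweep f b xs)) ++ us) ++ blk ∷ []) (blk ∷ [])) t →
             Steps (length xs + k) (tconf (q b) (cells us ++ blk ∷ []) (cells xs ++ blk ∷ [])) t
    sweeps q h b [] us r = r
    sweeps {f} q {t} {k} h b (x ∷ xs) us r =
      more (h b x) (sweeps q h (proj₁ (f b x)) xs (proj₂ (f b x) ∷ us)
        (subst (λ vs → Steps k (tconf (q (proj₁ (sweep f (proj₁ (f b x)) xs))) (cells vs ++ blk ∷ []) (blk ∷ [])) t)
          (trans (cong (_++ us) (Listₚ.unfold-reverse (proj₂ (f b x)) ys)) (Listₚ.++-assoc (reverse ys) _ us)) r))
      where ys = proj₂ (sweep f (proj₁ (f b x)) xs)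

    length-sweep : ∀ (f : Bool → Cell → Bool × Cell) b xs → length (proj₂ (sweep f b xs)) ≡ length xs
    length-sweep f b []       = refl
    length-sweep f b (x ∷ xs) = cong suc (length-sweep f (proj₁ (f b x)) xs)

    simulates : ∀ d (ι : St d → State) (exit : Bool → State) →
                (∀ s y → δ (ι s) y ≡ inj₂ (δ-cmd d ι exit s y)) →
                ∀ {xs b ys k} → Run d xs b ys k → Steps k (tape (ι (entry d)) xs) (tape (exit b) ys)
    simulates (pass f) ι exit h {xs} run-pass =
      sweeps (ι ∘ inj₁) (λ b x → h (inj₁ b) (cell x)) false xs []
        (more (h (inj₁ b′) blk)
          (subst₂ (λ l zs → Steps (suc l) (move L (cells (reverse ys ++ []) ++ blk ∷ []) (blk ∷ []) (ι (inj₂ b′)))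
                                  (tape (exit b′) zs))
            (trans (cong length (Listₚ.++-identityʳ (reverse ys))) (trans (Listₚ.length-reverse ys) (length-sweep f false xs)))
            (trans (cong reverse (Listₚ.++-identityʳ (reverse ys))) (Listₚ.reverse-involutive ys))
            (returns-from-end (λ _ _ → refl) (λ x → h (inj₂ b′) (cell x)) (h (inj₂ b′) blk) (reverse ys ++ []))))
      where
      ys = proj₂ (sweep f false xs)
      b′ = proj₁ (sweep f false xs)
    simulates (neg d) ι exit h (run-neg r) = simulates d ι (exit ∘ not) h r
    simulates (d & e) ι exit h (run-&t r r′) =
      steps-++ (simulates d (ι ∘ inj₁) _ (h ∘ inj₁) r) (simulates e (ι ∘ inj₂) exit (h ∘ inj₂) r′)
    simulates (d & e) ι exit h (run-&f r) = simulates d (ι ∘ inj₁) _ (h ∘ inj₁) r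
    simulates (d ⨾ e) ι exit h (run-⨾ r r′) =
      steps-++ (simulates d (ι ∘ inj₁) _ (h ∘ inj₁) r) (simulates e (ι ∘ inj₂) exit (h ∘ inj₂) r′)
    simulates (until d) ι exit h (run-stop r) = simulates d ι _ h r
    simulates (until d) ι exit h (run-again r r′) = steps-++ (simulates d ι _ h r) (simulates (until d) ι exit h r′)

    loads : ∀ w us → Steps (length w + (2 + (length w + length us))) (tconf start (cells us) (map raw w))
                           (tape (exec (entry c)) (reverse us ++ map init w))
    loads [] us =
      more refl (subst₂ (λ zs vs → Steps (suc (length us)) (move L zs (blk ∷ []) rewind) (tape (exec (entry c)) vs))
        (Listₚ.++-identityʳ (cells us)) (sym (Listₚ.++-identityʳ (reverse us)))
        (returns-from-end (λ _ _ → refl) (λ _ → refl) refl us))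
    loads (b ∷ w) us =
      more refl (subst₂ (λ l xs → Steps l (tconf start (cells (init b ∷ us)) (map raw w)) (tape (exec (entry c)) xs))
        (cong (λ l → length w + (2 + l)) (+-suc (length w) (length us)))
        (trans (cong (_++ map init w) (Listₚ.unfold-reverse (init b) us)) (Listₚ.++-assoc (reverse us) _ _))
        (loads w (init b ∷ us)))

    encC-init : ∀ w → encC (tconf start [] (map raw w)) ≡ initConf machine w
    encC-init w = cong (conf zero []) (lem w)
      where
      lem : ∀ w → map encS (map raw w) ≡ map (bitSym machine) w
      lem []          = refl
      lem (false ∷ w) = cong (suc zero ∷_) (lem w)
      lem (true ∷ w)  = cong (suc (suc zero) ∷_) (lem w)

    -- The bound is strict because a halting state gives its answer in one further step.
    machine-answers : ∀ w {b ys k t} → Run c (map init w) b ys k →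
                      length w + (2 + length w) + k < t → run machine t (initConf machine w) ≡ just b
    machine-answers w {b} {ys} {k} {t} r lt = begin
      run machine t (initConf machine w)                          ≡⟨ cong (λ u → run machine u (initConf machine w)) t≡ ⟩
      run machine (l + suc d) (initConf machine w)                ≡⟨ cong (run machine (l + suc d)) (sym (encC-init w)) ⟩
      run machine (l + suc d) (encC (tconf start [] (map raw w))) ≡⟨ run-steps (suc d) steps ⟩
      run machine (suc d) (encC (tape (halt b) ys))               ≡⟨ run-halt b _ _ d ⟩
      just b                                                      ∎
      where
      open ≡-Reasoning
      l = length w + (2 + length w) + k
      d = t ∸ suc l
      t≡ : t ≡ l + suc d
      t≡ = trans (sym (m+[n∸m]≡n lt)) (sym (+-suc l d))
      steps : Steps l (tconf start [] (map raw w)) (tape (halt b) ys)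
      steps = steps-++ (subst (λ m → Steps (length w + (2 + m)) (tconf start [] (map raw w)) (tape (exec (entry c)) (map init w))) (+-identityʳ (length w)) (loads w []))
                       (simulates c (λ s → exec s) (λ b′ → halt b′) (λ _ _ → refl) r)

-- Tracks of marks on the tape, and search loops over positions

-- Three families: working registers, element variables of formulas, and set variables of formulas.
data Track : Set where
  reg ivar svar : ℕ → Track

idx : Track → ℕ
idx (reg x)  = x
idx (ivar x) = x
idx (svar x) = x

_==_ : Track → Track → Bool
reg x  == reg y  = x ≡ᵇ y
ivar x == ivar y = x ≡ᵇ y
svar x == svar y = x ≡ᵇ y
_      == _      = false

≡ᵇ-refl : ∀ x → (x ≡ᵇ x) ≡ true
≡ᵇ-refl zero    = refl
≡ᵇ-refl (suc x) = ≡ᵇ-refl x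

≢⇒≡ᵇ-false : ∀ x y → x ≢ y → (x ≡ᵇ y) ≡ false
≢⇒≡ᵇ-false zero    zero    ne = ⊥-elim (ne refl)
≢⇒≡ᵇ-false zero    (suc y) ne = refl
≢⇒≡ᵇ-false (suc x) zero    ne = refl
≢⇒≡ᵇ-false (suc x) (suc y) ne = ≢⇒≡ᵇ-false x y (ne ∘ cong suc)

≡ᵇ-sym : ∀ x y → (x ≡ᵇ y) ≡ (y ≡ᵇ x)
≡ᵇ-sym zero    zero    = refl
≡ᵇ-sym zero    (suc y) = refl
≡ᵇ-sym (suc x) zero    = refl
≡ᵇ-sym (suc x) (suc y) = ≡ᵇ-sym x y

<⇒<ᵇ-true : ∀ {x y} → x < y → (x <ᵇ y) ≡ true
<⇒<ᵇ-true {zero}  (s≤s _) = refl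
<⇒<ᵇ-true {suc x} (s≤s p) = <⇒<ᵇ-true {x} p

≥⇒<ᵇ-false : ∀ {x y} → y ≤ x → (x <ᵇ y) ≡ false
≥⇒<ᵇ-false {x}     z≤n     = refl
≥⇒<ᵇ-false {suc x} (s≤s p) = ≥⇒<ᵇ-false {x} p

==-refl : ∀ t → (t == t) ≡ true
==-refl (reg x)  = ≡ᵇ-refl x
==-refl (ivar x) = ≡ᵇ-refl x
==-refl (svar x) = ≡ᵇ-refl x

==-≢ : ∀ s t → s ≢ t → (s == t) ≡ false
==-≢ (reg x)  (reg y)  ne = ≢⇒≡ᵇ-false x y (ne ∘ cong reg)
==-≢ (reg x)  (ivar y) ne = refl
==-≢ (reg x)  (svar y) ne = refl
==-≢ (ivar x) (reg y)  ne = refl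
==-≢ (ivar x) (ivar y) ne = ≢⇒≡ᵇ-false x y (ne ∘ cong ivar)
==-≢ (ivar x) (svar y) ne = refl
==-≢ (svar x) (reg y)  ne = refl
==-≢ (svar x) (ivar y) ne = refl
==-≢ (svar x) (svar y) ne = ≢⇒≡ᵇ-false x y (ne ∘ cong svar)

getV : ∀ {m} → Vec Bool m → ℕ → Bool
getV []      x       = false
getV (b ∷ v) zero    = b
getV (b ∷ v) (suc x) = getV v x

putV : ∀ {m} → Vec Bool m → ℕ → Bool → Vec Bool m
putV []      x       c = []
putV (b ∷ v) zero    c = c ∷ v
putV (b ∷ v) (suc x) c = b ∷ putV v x c

tabV : ∀ m → (ℕ → Bool) → Vec Bool m
tabV zero    f = []
tabV (suc m) f = f 0 ∷ tabV m (f ∘ suc)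

getV-tabV : ∀ {m x} f → x < m → getV (tabV m f) x ≡ f x
getV-tabV {suc m} {zero}  f p       = refl
getV-tabV {suc m} {suc x} f (s≤s p) = getV-tabV (f ∘ suc) p

putV-tabV : ∀ m x f c → putV (tabV m f) x c ≡ tabV m (λ y → if x ≡ᵇ y then c else f y)
putV-tabV zero    x       f c = refl
putV-tabV (suc m) zero    f c = refl
putV-tabV (suc m) (suc x) f c = cong (f 0 ∷_) (putV-tabV m x (f ∘ suc) c)

anyBelow : ℕ → (ℕ → Bool) → Bool
anyBelow zero    f = false
anyBelow (suc q) f = anyBelow q f ∨ f q

anyBelow-true : ∀ {k q} f → q < k → f q ≡ true → anyBelow k f ≡ true
anyBelow-true {suc k} {q} f p e with m≤n⇒m<n∨m≡n (s≤s⁻¹ p)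
... | inj₁ q<k  rewrite anyBelow-true f q<k e = refl
... | inj₂ refl rewrite e = Boolₚ.∨-zeroʳ (anyBelow k f)

anyBelow-false : ∀ k f → (∀ q → q < k → f q ≡ false) → anyBelow k f ≡ false
anyBelow-false zero    f h = refl
anyBelow-false (suc k) f h rewrite anyBelow-false k f (λ q p → h q (m≤n⇒m≤1+n p)) = h k ≤-refl

-- A store assigns bits to all positions, while the tape shows only those below its length. Updates
-- can thus be described without side conditions.
Store : Set
Store = Track → ℕ → Bool

_[_≔_] : Store → Track → (ℕ → Bool) → Store
(s [ a ≔ g ]) t q = if a == t then g q else s t q

get-updated : ∀ s a g q → (s [ a ≔ g ]) a q ≡ g q
get-updated s a g q rewrite ==-refl a = refl

get-other : ∀ s {a t} g q → a ≢ t → (s [ a ≔ g ]) t q ≡ s t q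
get-other s {a} {t} g q ne rewrite ==-≢ a t ne = refl

delayed : (ℕ → Bool) → ℕ → Bool
delayed g zero    = false
delayed g (suc q) = g q

shifted : Track → Store → Store
shifted a s = s [ a ≔ delayed (s a) ]

module Tracks (M : ℕ) where

  Cell : Set
  Cell = Vec Bool M × Vec Bool M × Vec Bool M

  finite-Cell : Finite Cell
  finite-Cell = finite-× (finite-Vec M) (finite-× (finite-Vec M) (finite-Vec M))

  get : Cell → Track → Bool
  get (u , v , w) (reg x)  = getV u x
  get (u , v , w) (ivar x) = getV v x
  get (u , v , w) (svar x) = getV w x

  put : Cell → Track → Bool → Cell
  put (u , v , w) (reg x)  b = putV u x b , v , w
  put (u , v , w) (ivar x) b = u , putV v x b , w
  put (u , v , w) (svar x) b = u , v , putV w x b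

  tab : (Track → Bool) → Cell
  tab f = tabV M (f ∘ reg) , tabV M (f ∘ ivar) , tabV M (f ∘ svar)

  get-tab : ∀ t f → idx t < M → get (tab f) t ≡ f t
  get-tab (reg x)  f p = getV-tabV (f ∘ reg) p
  get-tab (ivar x) f p = getV-tabV (f ∘ ivar) p
  get-tab (svar x) f p = getV-tabV (f ∘ svar) p

  put-tab : ∀ t f c → put (tab f) t c ≡ tab (λ t′ → if t == t′ then c else f t′)
  put-tab (reg x)  f c = cong (λ u → u , _ , _) (putV-tabV M x (f ∘ reg) c)
  put-tab (ivar x) f c = cong (λ v → _ , v , _) (putV-tabV M x (f ∘ ivar) c)
  put-tab (svar x) f c = cong (λ w → _ , _ , w) (putV-tabV M x (f ∘ svar) c)

  -- The one bit of memory of a pass tells in `reset` whether the first cell is behind, and in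
  -- `shift` holds the bit of the preceding cell. A mark shifted beyond the last cell disappears.
  reset shift clear : Track → Cmd Cell
  reset a = pass (λ b x → true , put x a (not b))
  shift a = pass (λ b x → get x a , put x a b)
  clear a = pass (λ b x → b , put x a false)

  copy union meets : Track → Track → Cmd Cell
  copy a b  = pass (λ c x → c , put x a (get x b))
  union a b = pass (λ c x → c , put x a (get x a ∨ get x b))
  meets a b = pass (λ c x → c ∨ (get x a ∧ get x b) , x)

  ff : Cmd Cell
  ff = pass (λ b x → b , x)

  -- Runs c for a = 0, 1, 2, … until it succeeds or a leaves the tape.
  some : Track → Cmd Cell → Cmd Cell
  some a c = reset a ⨾ (until (neg (meets a a & (neg c & neg (shift a ⨾ ff)))) ⨾ meets a a)

  module Semantics (N : ℕ) where

    column : Store → ℕ → Track → Bool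
    column s q t = s t q

    encode-store : Store → List Cell
    encode-store s = applyUpTo (λ q → tab (column s q)) N

    passTime : ℕ
    passTime = N + (2 + N)

    record Does (c : Cmd Cell) (s : Store) (b : Bool) (s′ : Store) (t : ℕ) : Set where
      constructor does-in
      field
        steps  : ℕ
        runs   : Run c (encode-store s) b (encode-store s′) steps
        within : steps ≤ t

    -- `β` is the predicted trajectory of the transducer state; with it a pass is verified by one
    -- equation per position.
    sweep-applyUpTo : ∀ {f : Bool → Cell → Bool × Cell} K (β : ℕ → Bool) (g h : ℕ → Cell) →
                      (∀ q → f (β q) (g q) ≡ (β (suc q) , h q)) →
                      sweep f (β 0) (applyUpTo g K) ≡ (β K , applyUpTo h K)
    sweep-applyUpTo zero    β g h eq = refl
    sweep-applyUpTo {f} (suc K) β g h eq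
      rewrite eq 0 | sweep-applyUpTo {f} K (β ∘ suc) (g ∘ suc) (h ∘ suc) (eq ∘ suc) = refl

    does-pass : ∀ {f : Bool → Cell → Bool × Cell} (β : ℕ → Bool) s s′ → β 0 ≡ false →
                (∀ q → f (β q) (tab (column s q)) ≡ (β (suc q) , tab (column s′ q))) →
                Does (pass f) s (β N) s′ passTime
    does-pass {f} β s s′ β0 eq = does-in passTime r ≤-refl
      where
      p : sweep f false (encode-store s) ≡ (β N , encode-store s′)
      p = trans (cong (λ b → sweep f b (encode-store s)) (sym β0))
                (sweep-applyUpTo {f} N β (λ q → tab (column s q)) (λ q → tab (column s′ q)) eq)
      r : Run (pass f) (encode-store s) (β N) (encode-store s′) passTime
      r = subst (λ l → Run (pass f) (encode-store s) (β N) (encode-store s′) (l + (2 + l)))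
            (Listₚ.length-applyUpTo (λ q → tab (column s q)) N)
            (subst₂ (λ b ys → Run (pass f) (encode-store s) b ys (length (encode-store s) + (2 + length (encode-store s))))
              (cong proj₁ p) (cong proj₂ p) run-pass)

    does-reset : ∀ a s → Σ Bool λ b → Does (reset a) s b (s [ a ≔ (_≡ᵇ 0) ]) passTime
    does-reset a s = β N , does-pass β s (s [ a ≔ (_≡ᵇ 0) ]) refl eq
      where
      β : ℕ → Bool
      β zero    = false
      β (suc _) = true
      eq : ∀ q → (true , put (tab (column s q)) a (not (β q))) ≡ (true , tab (column (s [ a ≔ (_≡ᵇ 0) ]) q))
      eq zero    = cong (true ,_) (put-tab a (column s 0) _)
      eq (suc q) = cong (true ,_) (put-tab a (column s (suc q)) _)

    does-shift : ∀ a s → idx a < M → Σ Bool λ b → Does (shift a) s b (shifted a s) passTime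
    does-shift a s p = delayed (s a) N ,
      does-pass (delayed (s a)) s (shifted a s) refl
        (λ q → cong₂ _,_ (get-tab a (column s q) p) (put-tab a (column s q) _))

    does-clear : ∀ a s → Does (clear a) s false (s [ a ≔ (λ _ → false) ]) passTime
    does-clear a s = does-pass (λ _ → false) s (s [ a ≔ (λ _ → false) ]) refl
      (λ q → cong (false ,_) (put-tab a (column s q) _))

    does-copy : ∀ a b s → idx b < M → Does (copy a b) s false (s [ a ≔ s b ]) passTime
    does-copy a b s p = does-pass (λ _ → false) s (s [ a ≔ s b ]) refl λ q → cong (false ,_)
      (trans (cong (put (tab (column s q)) a) (get-tab b (column s q) p)) (put-tab a (column s q) _))

    does-union : ∀ a b s → idx a < M → idx b < M →
                 Does (union a b) s false (s [ a ≔ (λ q → s a q ∨ s b q) ]) passTime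
    does-union a b s p p′ = does-pass (λ _ → false) s (s [ a ≔ (λ q → s a q ∨ s b q) ]) refl
      λ q → cong (false ,_) (trans (cong (put (tab (column s q)) a)
        (cong₂ _∨_ (get-tab a (column s q) p) (get-tab b (column s q) p′))) (put-tab a (column s q) _))

    does-meets : ∀ a b s → idx a < M → idx b < M →
                 Does (meets a b) s (anyBelow N (λ q → s a q ∧ s b q)) s passTime
    does-meets a b s p p′ = does-pass (λ q → anyBelow q (λ q → s a q ∧ s b q)) s s refl
      λ q → cong (λ c → anyBelow q (λ q → s a q ∧ s b q) ∨ c , tab (column s q))
        (cong₂ _∧_ (get-tab a (column s q) p) (get-tab b (column s q) p′))

    does-ff : ∀ s → Does ff s false s passTime
    does-ff s = does-pass (λ _ → false) s s refl (λ _ → refl)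

    does-neg : ∀ {c s b s′ t} → Does c s b s′ t → Does (neg c) s (not b) s′ t
    does-neg (does-in k r p) = does-in k (run-neg r) p

    does-&t : ∀ {c d s s′ b s″ t t′} → Does c s true s′ t → Does d s′ b s″ t′ → Does (c & d) s b s″ (t + t′)
    does-&t (does-in k r p) (does-in l r′ p′) = does-in (k + l) (run-&t r r′) (+-mono-≤ p p′)

    does-&f : ∀ {c d s s′ t} t′ → Does c s false s′ t → Does (c & d) s false s′ (t + t′)
    does-&f t′ (does-in k r p) = does-in k (run-&f r) (≤-trans p (m≤m+n _ t′))

    does-⨾ : ∀ {c d s a s′ b s″ t t′} → Does c s a s′ t → Does d s′ b s″ t′ → Does (c ⨾ d) s b s″ (t + t′)
    does-⨾ (does-in k r p) (does-in l r′ p′) = does-in (k + l) (run-⨾ r r′) (+-mono-≤ p p′)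

    -- The value i may be N or more, and the track is then empty. This is how a counter that has
    -- left the tape is described, and also how the number n itself is held when n = N = 1.
    Marks : (ℕ → Bool) → ℕ → Set
    Marks g i = ∀ q → q < N → g q ≡ (q ≡ᵇ i)

    meets-mark : ∀ {f g : ℕ → Bool} {i} → Marks g i → i < N → anyBelow N (λ q → f q ∧ g q) ≡ f i
    meets-mark {f} {g} {i} m i<N with f i in fi
    ... | true = anyBelow-true _ i<N (trans (cong₂ _∧_ fi (m i i<N)) (≡ᵇ-refl i))
    ... | false = anyBelow-false N _ h
      where
      h : ∀ q → q < N → f q ∧ g q ≡ false
      h q q<N rewrite m q q<N with q ≟ i
      ... | yes refl rewrite fi = refl
      ... | no  ne   rewrite ≢⇒≡ᵇ-false q i ne = Boolₚ.∧-zeroʳ (f q)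

    meets-off : ∀ {f g : ℕ → Bool} {i} → Marks g i → N ≤ i → anyBelow N (λ q → f q ∧ g q) ≡ false
    meets-off {f} {g} {i} m N≤i = anyBelow-false N _ h
      where
      h : ∀ q → q < N → f q ∧ g q ≡ false
      h q q<N rewrite m q q<N | ≢⇒≡ᵇ-false q i (<⇒≢ (<-≤-trans q<N N≤i)) = Boolₚ.∧-zeroʳ (f q)

    marks-delayed : ∀ {g : ℕ → Bool} {i} → Marks g i → Marks (delayed g) (suc i)
    marks-delayed m zero    p = refl
    marks-delayed m (suc q) p = m q (<-trans (n<1+n q) p)

    -- There is one round for each position and a last one that notices that the mark has left the
    -- tape, which explains the factor `suc N`.
    someTime : ℕ → ℕ
    someTime t = passTime + (suc N * (passTime + (t + (passTime + passTime))) + passTime)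

    -- A success is recorded as the first one, because `findRoot` looks for a least number.
    data Outcome (f : ℕ → Bool) (Inv Post : ℕ → Store → Set) : Bool → Store → Set where
      found : ∀ {i s} → i < N → f i ≡ true → (∀ j → j < i → f j ≡ false) → Post i s → Outcome f Inv Post true s
      fails : ∀ {s} → (∀ j → j < N → f j ≡ false) → Inv N s → Outcome f Inv Post false s

    -- `Inv i` holds before the body is run at position i and `Post i` after it; the shift of the
    -- mark leads from `Post i` to `Inv (suc i)`.
    module Some (a : Track) (a<M : idx a < M) (c : Cmd Cell) (t : ℕ) (f : ℕ → Bool) (Inv Post : ℕ → Store → Set)
                (inv-marks  : ∀ {i s} → Inv i s → Marks (s a) i)
                (post-marks : ∀ {i s} → Post i s → Marks (s a) i)
                (body       : ∀ {i s} → i < N → Inv i s → Σ Store λ s′ → Does c s (f i) s′ t × Post i s′)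
                (next       : ∀ {i s} → f i ≡ false → Post i s → Inv (suc i) (shifted a s)) where

      private
        round : Cmd Cell
        -- A round answers true, and so ends the loop, if the mark has left the tape or c succeeds.
        -- Otherwise the mark is shifted, and the inner `ff` makes the round answer false. The
        -- `meets a a` after the loop tells the two endings apart.
        round = neg (meets a a & (neg c & neg (shift a ⨾ ff)))
        roundTime : ℕ
        roundTime = passTime + (t + (passTime + passTime))

        loop : ∀ r i {s} → i + r ≡ N → Inv i s → (∀ j → j < i → f j ≡ false) →
               Σ Store λ s′ → Σ Bool λ b →
               Does (until round) s true s′ (suc r * roundTime) × Outcome f Inv Post b s′
        loop zero i {s} e inv prev
          with does-in k r p ← does-meets a a s a<M a<M
          rewrite trans (sym (+-identityʳ i)) e | meets-off {s a} (inv-marks inv) ≤-refl =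
          s , false , does-in k (run-stop (run-neg (run-&f r))) (≤-trans p (≤-trans (m≤m+n _ _) (m≤m+n _ _))) , fails prev inv
        loop (suc r) i {s} e inv prev
          with i<N ← subst (i <_) e (m<m+n i (s≤s z≤n))
          with does-in k rm p ← does-meets a a s a<M a<M
          rewrite meets-mark {s a} (inv-marks inv) i<N | inv-marks inv i i<N | ≡ᵇ-refl i
          with s′ , does-in l rc p′ , post ← body i<N inv
          with f i in fi
        ... | true = s′ , true ,
          does-in _ (run-stop (run-neg (run-&t rm (run-&f (run-neg rc)))))
            (≤-trans (+-mono-≤ p (≤-trans p′ (m≤m+n t _))) (m≤m+n _ _)) , found i<N fi prev post
        ... | false
          with _ , ds ← does-shift a s′ a<M
          with does-in u ru pu ← does-neg (does-⨾ ds (does-ff (shifted a s′)))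
          with s″ , b , does-in v rv pv , out ← loop r (suc i) (trans (sym (+-suc i r)) e) (next fi post)
                 (λ j j<i → [ prev j , (λ { refl → fi }) ]′ (m≤n⇒m<n∨m≡n (s≤s⁻¹ j<i))) =
          s″ , b , does-in _ (run-again (run-neg (run-&t rm (run-&t (run-neg rc) ru))) rv)
            (+-mono-≤ (+-mono-≤ p (+-mono-≤ p′ pu)) pv) , out

      abstract
        does-some : ∀ s → Inv 0 (s [ a ≔ (_≡ᵇ 0) ]) →
                    Σ Store λ s′ → Σ Bool λ b → Does (some a c) s b s′ (someTime t) × Outcome f Inv Post b s′
        does-some s inv
          with _ , d₁ ← does-reset a s
          with s′ , b , d₂ , out ← loop N 0 refl inv (λ _ ()) =
          s′ , b , does-⨾ d₁ (does-⨾ d₂ (subst (λ b → Does (meets a a) s′ b s′ passTime) (valid out) (does-meets a a s′ a<M a<M))) , out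
          where
          valid : ∀ {b s} → Outcome f Inv Post b s → anyBelow N (λ q → s a q ∧ s a q) ≡ b
          valid {s = s} (found {i} i<N _ _ post) =
            trans (meets-mark {s a} (post-marks post) i<N) (trans (post-marks post i i<N) (≡ᵇ-refl i))
          valid {s = s} (fails _ inv) = meets-off {s a} (inv-marks inv) ≤-refl

-- First-order formulas with inflationary closures

_[_↦_] : ∀ {A : Set} → (ℕ → A) → ℕ → A → ℕ → A
(f [ x ↦ a ]) y = if x ≡ᵇ y then a else f y

↦-same : ∀ {A : Set} (f : ℕ → A) x a → (f [ x ↦ a ]) x ≡ a
↦-same f x a rewrite ≡ᵇ-refl x = refl

↦-other : ∀ {A : Set} (f : ℕ → A) {x y} a → x ≢ y → (f [ x ↦ a ]) y ≡ f y
↦-other f {x} {y} a ne rewrite ≢⇒≡ᵇ-false x y ne = refl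

anyFin : ∀ {n} → (Fin n → Bool) → Bool
anyFin {zero}  f = false
anyFin {suc n} f = f zero ∨ anyFin (f ∘ suc)

anyFin-true : ∀ {n} (f : Fin n → Bool) a → f a ≡ true → anyFin f ≡ true
anyFin-true f zero    e rewrite e = refl
anyFin-true f (suc a) e rewrite anyFin-true (f ∘ suc) a e = Boolₚ.∨-zeroʳ (f zero)

anyFin-false : ∀ {n} (f : Fin n → Bool) → (∀ a → f a ≡ false) → anyFin f ≡ false
anyFin-false {zero}  f h = refl
anyFin-false {suc n} f h rewrite h zero = anyFin-false (f ∘ suc) (h ∘ suc)

anyFin-witness : ∀ {n} (f : Fin n → Bool) → anyFin f ≡ true → ∃ λ a → f a ≡ true
anyFin-witness {suc n} f e with f zero in eq
... | true  = zero , eq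
... | false = let a , e′ = anyFin-witness (f ∘ suc) e in suc a , e′

-- First-order formulas over a graph. Variables and set variables are de Bruijn levels:
-- at depth (d , e), ex binds variable d and letc binds set variable e.
-- letc φ ψ defines the set as the inflationary closure under φ (with variable d as
-- the candidate element) and evaluates ψ.
data Fm : Set where
  edge  : ℕ → ℕ → Fm
  equal : ℕ → ℕ → Fm
  mem   : ℕ → ℕ → Fm
  not′  : Fm → Fm
  _and_ : Fm → Fm → Fm
  _or_  : Fm → Fm → Fm
  ex    : Fm → Fm
  letc  : Fm → Fm → Fm

infixr 6 _and_
infixr 5 _or_

-- Elements are tested one at a time against the set as already enlarged, because the machine
-- updates the track of the set in place.
absorb : ∀ {n} → ((Fin n → Bool) → Fin n → Bool) → ℕ → (Fin n → Bool) → Fin n → Bool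
absorb F zero    X   = X
absorb F (suc i) X a = absorb F i X a ∨ ((i ≡ᵇ toℕ a) ∧ F (absorb F i X) a)

rounds : ∀ {n} → ((Fin n → Bool) → Fin n → Bool) → ℕ → ℕ → Fin n → Bool
rounds F N zero    = λ _ → false
rounds F N (suc r) = absorb F N (rounds F N r)

-- abstract, so that type checking never unrolls the iteration
abstract
  closure : ∀ {n} → ((Fin n → Bool) → Fin n → Bool) → ℕ → Fin n → Bool
  closure F N = rounds F N N

  closure-rounds : ∀ {n} F N (a : Fin n) → closure F N a ≡ rounds F N N a
  closure-rounds F N a = refl

eval : ∀ {n} → Graph n → ℕ → ℕ → Fm → (ℕ → Fin n) → (ℕ → Fin n → Bool) → Bool
eval G d e (edge x y)  ρ σ = G (ρ x) (ρ y)
eval G d e (equal x y) ρ σ = toℕ (ρ x) ≡ᵇ toℕ (ρ y)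
eval G d e (mem y x)   ρ σ = σ y (ρ x)
eval G d e (not′ φ)    ρ σ = not (eval G d e φ ρ σ)
eval G d e (φ and ψ)   ρ σ = eval G d e φ ρ σ ∧ eval G d e ψ ρ σ
eval G d e (φ or ψ)    ρ σ = eval G d e φ ρ σ ∨ eval G d e ψ ρ σ
eval G d e (ex φ)      ρ σ = anyFin (λ a → eval G (suc d) e φ (ρ [ d ↦ a ]) σ)
-- The number `n * n` of rounds is the length of the tape, hence the range of a machine counter.
-- Monotone closures are stable long before.
eval {n} G d e (letc φ ψ) ρ σ = eval G d (suc e) ψ ρ (σ [ e ↦ closure F (n * n) ])
  where
  F : (Fin n → Bool) → Fin n → Bool
  F X a = eval G (suc d) (suc e) φ (ρ [ d ↦ a ]) (σ [ e ↦ X ])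

-- Compiling formulas to commands

-- inp holds the adjacency matrix, nT marks position n, vv marks the positions below n,
-- and pT, iT, jT are scratch registers for arithmetic on positions.
pattern inp = reg 0
pattern nT  = reg 1
pattern vv  = reg 2
pattern pT  = reg 3
pattern iT  = reg 4
pattern jT  = reg 5

-- The tracks that code at depth (d , e) must leave intact: the fixed registers 0 to 2, the counters
-- `reg (6 + e′)` of enclosing closures, and the variables in scope. The scratch registers 3 to 5
-- are left out.
Safe : ℕ → ℕ → Track → Set
Safe d e (reg x)  = x < 3 ⊎ (6 ≤ x × x < 6 + e)
Safe d e (ivar x) = x < d
Safe d e (svar x) = x < e

safe-mono : ∀ {d d′ e e′} t → d ≤ d′ → e ≤ e′ → Safe d e t → Safe d′ e′ t
safe-mono (reg x)  p q (inj₁ r)       = inj₁ r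
safe-mono (reg x)  p q (inj₂ (r , h)) = inj₂ (r , ≤-trans h (+-monoʳ-≤ 6 q))
safe-mono (ivar x) p q r              = ≤-trans r p
safe-mono (svar x) p q r              = ≤-trans r q

Keeps : ℕ → ℕ → Store → Store → Set
Keeps d e s s′ = ∀ t → Safe d e t → ∀ q → s′ t q ≡ s t q

keeps-refl : ∀ {d e s} → Keeps d e s s
keeps-refl t p q = refl

keeps-trans : ∀ {d e s s′ s″} → Keeps d e s s′ → Keeps d e s′ s″ → Keeps d e s s″
keeps-trans k l t p q = trans (l t p q) (k t p q)

keeps-mono : ∀ {d d′ e e′ s s′} → d ≤ d′ → e ≤ e′ → Keeps d′ e′ s s′ → Keeps d e s s′
keeps-mono p q k t r = k t (safe-mono t p q r)

keeps-update : ∀ {d e s a g} → ¬ Safe d e a → Keeps d e s (s [ a ≔ g ])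
keeps-update {s = s} {a} {g} ns t p q = get-other s {a} {t} g q λ { refl → ns p }

0<3 : 0 < 3
0<3 = s≤s z≤n

1<3 : 1 < 3
1<3 = s≤s (s≤s z≤n)

2<3 : 2 < 3
2<3 = ≤-refl

unsafe-p : ∀ {d e} → ¬ Safe d e pT
unsafe-p (inj₁ (s≤s (s≤s (s≤s ()))))
unsafe-p (inj₂ (s≤s (s≤s (s≤s ())) , _))

unsafe-i : ∀ {d e} → ¬ Safe d e iT
unsafe-i (inj₁ (s≤s (s≤s (s≤s ()))))
unsafe-i (inj₂ (s≤s (s≤s (s≤s (s≤s ()))) , _))

unsafe-j : ∀ {d e} → ¬ Safe d e jT
unsafe-j (inj₁ (s≤s (s≤s (s≤s ()))))
unsafe-j (inj₂ (s≤s (s≤s (s≤s (s≤s (s≤s ())))) , _))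

unsafe-reg : ∀ {d} e → ¬ Safe d e (reg (6 + e))
unsafe-reg e (inj₁ (s≤s (s≤s (s≤s ()))))
unsafe-reg e (inj₂ (_ , p)) = <-irrefl refl p

true≢false : ∀ {b} → b ≡ true → b ≡ false → ⊥
true≢false refl ()

at : ∀ {n} → (Fin n → Bool) → ℕ → Bool
at {n} g i with i <? n
... | yes p = g (fromℕ< p)
... | no  _ = false

<ᵇ-suc : ∀ q i → (q <ᵇ i) ∨ (q ≡ᵇ i) ≡ (q <ᵇ suc i)
<ᵇ-suc zero    zero    = refl
<ᵇ-suc zero    (suc i) = refl
<ᵇ-suc (suc q) zero    = refl
<ᵇ-suc (suc q) (suc i) = <ᵇ-suc q i

module Programs (m : ℕ) where

  open Tracks (6 + m)

  _∥_ : Cmd Cell → Cmd Cell → Cmd Cell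
  c ∥ d = neg (neg c & neg d)

  -- A counting loop made from a search: the search succeeds at the mark of x, and before that runs
  -- c and reports failure. If x stands for N, the search just leaves the tape after N executions.
  repeat : Track → Track → Cmd Cell → Cmd Cell
  repeat a x c = some a (meets x a ∥ (c ⨾ ff))

  addMultiple : Track → Track → Cmd Cell
  addMultiple x y = repeat iT x (repeat jT y (shift pT))

  -- The matrix is stored by rows, so the entry for (x , y) is at position y + x · n. The sum is
  -- formed in unary, by moving the mark `pT` from y.
  edgeCmd : Track → Track → Cmd Cell
  edgeCmd x y = copy pT y ⨾ (addMultiple x nT ⨾ meets inp pT)

  -- No comparison of numbers is needed: i² is at least the length of the tape exactly when the mark
  -- `pT`, moved i · i times, has left it.
  findRoot : Cmd Cell
  findRoot = some nT (reset pT ⨾ (addMultiple nT nT ⨾ neg (meets pT pT)))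

  setup : Cmd Cell
  setup = findRoot ⨾ (clear vv ⨾ repeat iT nT (union vv iT))

  comp : ℕ → ℕ → Fm → Cmd Cell
  comp d e (edge x y)  = edgeCmd (ivar x) (ivar y)
  comp d e (equal x y) = meets (ivar x) (ivar y)
  comp d e (mem y x)   = meets (svar y) (ivar x)
  comp d e (not′ φ)    = neg (comp d e φ)
  comp d e (φ and ψ)   = comp d e φ & comp d e ψ
  comp d e (φ or ψ)    = comp d e φ ∥ comp d e ψ
  -- A variable runs through all n² positions of the tape; the test against `vv` restricts it to
  -- vertices.
  comp d e (ex φ)      = some (ivar d) (meets vv (ivar d) & comp (suc d) e φ)
  -- Both searches always fail, thanks to `ff`, and so act as plain loops: each round of the outer
  -- one offers every vertex once to the set. The counter is indexed by e to keep nested closures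
  -- apart.
  comp d e (letc φ ψ)  = clear (svar e) ⨾
    (some (reg (6 + e)) (some (ivar d) (((meets vv (ivar d) & comp (suc d) (suc e) φ) & union (svar e) (ivar d)) ⨾ ff))
    ⨾ comp d (suc e) ψ)

  wf : ℕ → ℕ → Fm → Bool
  wf d e (edge x y)  = (x <ᵇ d) ∧ (y <ᵇ d)
  wf d e (equal x y) = (x <ᵇ d) ∧ (y <ᵇ d)
  wf d e (mem y x)   = (y <ᵇ e) ∧ (x <ᵇ d)
  wf d e (not′ φ)    = wf d e φ
  wf d e (φ and ψ)   = wf d e φ ∧ wf d e ψ
  wf d e (φ or ψ)    = wf d e φ ∧ wf d e ψ
  wf d e (ex φ)      = (d <ᵇ m) ∧ wf (suc d) e φ
  wf d e (letc φ ψ)  = ((d <ᵇ m) ∧ (e <ᵇ m)) ∧ (wf (suc d) (suc e) φ ∧ wf d (suc e) ψ)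

  split-∧ : ∀ {a b} → T (a ∧ b) → T a × T b
  split-∧ {true} {true} _ = tt , tt

  module Bounds (N : ℕ) where
    open Semantics N

    addTime edgeTime : ℕ
    addTime = someTime (passTime + (someTime (passTime + (passTime + passTime)) + passTime))
    edgeTime = passTime + (addTime + passTime)

    setupTime : ℕ
    setupTime = someTime (passTime + (addTime + passTime)) + (passTime + someTime (passTime + (passTime + passTime)))

    time : Fm → ℕ
    time (edge x y)  = edgeTime
    time (equal x y) = passTime
    time (mem y x)   = passTime
    time (not′ φ)    = time φ
    time (φ and ψ)   = time φ + time ψ
    time (φ or ψ)    = time φ + time ψ
    time (ex φ)      = someTime (passTime + time φ)
    time (letc φ ψ)  = passTime + (someTime (someTime (((passTime + time φ) + passTime) + passTime)) + time ψ)

    does-∥t : ∀ {c d s s′ t} t′ → Does c s true s′ t → Does (c ∥ d) s true s′ (t + t′)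
    does-∥t t′ D = does-neg (does-&f t′ (does-neg D))

    does-∥f : ∀ {c d s s′ b s″ t t′} → Does c s false s′ t → Does d s′ b s″ t′ → Does (c ∥ d) s b s″ (t + t′)
    does-∥f {c} {d} {s} {s′} {b} {s″} {t} {t′} D D′ =
      subst (λ b → Does (c ∥ d) s b s″ (t + t′)) (Boolₚ.not-involutive b) (does-neg (does-&t (does-neg D) (does-neg D′)))

    reg<M : ∀ {x} → x < 6 → x < 6 + m
    reg<M p = ≤-trans p (m≤m+n 6 m)

    inp<M : 0 < 6 + m
    inp<M = reg<M (s≤s z≤n)

    n<M : 1 < 6 + m
    n<M = reg<M (s≤s (s≤s z≤n))

    vv<M : 2 < 6 + m
    vv<M = reg<M (s≤s (s≤s (s≤s z≤n)))

    p<M : 3 < 6 + m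
    p<M = reg<M (s≤s (s≤s (s≤s (s≤s z≤n))))

    i<M : 4 < 6 + m
    i<M = reg<M (s≤s (s≤s (s≤s (s≤s (s≤s z≤n)))))

    j<M : 5 < 6 + m
    j<M = reg<M ≤-refl

    -- `J i` is what holds after i executions of c. It must not depend on the track a, which the
    -- loop overwrites (`J-free`).
    module Repeat (a x : Track) (a<M : idx a < 6 + m) (x<M : idx x < 6 + m) (c : Cmd Cell) (t : ℕ)
                  (v : ℕ) (v≤N : v ≤ N) (J : ℕ → Store → Set)
                  (J-limit : ∀ {i s} → J i s → Marks (s x) v)
                  (J-free  : ∀ {i s g} → J i s → J i (s [ a ≔ g ]))
                  (body    : ∀ {i s} → i < v → J i s → Marks (s a) i →
                             Σ Store λ s′ → Σ Bool λ b → Does c s b s′ t × J (suc i) s′ × (∀ q → s′ a q ≡ s a q)) where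

      private
        f : ℕ → Bool
        f i = i ≡ᵇ v

        Inv Post : ℕ → Store → Set
        Inv i s = Marks (s a) i × i ≤ v × J i s
        Post i s = Marks (s a) i × (f i ≡ true → J v s) × (f i ≡ false → suc i ≤ v × J (suc i) s)

        f-true : ∀ {i} → f i ≡ true → i ≡ v
        f-true {i} e = ≡ᵇ⇒≡ i v (subst T (sym e) tt)

        run-body : ∀ {i s} → i < N → Inv i s →
                   Σ Store λ s′ → Does (meets x a ∥ (c ⨾ ff)) s (f i) s′ (passTime + (t + passTime)) × Post i s′
        run-body {i} {s} i<N (ma , i≤v , j) =
          decide (f i) refl (subst (λ b → Does (meets x a) s b s passTime)
            (trans (meets-mark {s x} ma i<N) (J-limit j i i<N)) (does-meets x a s x<M a<M))
          where
          decide : ∀ b → f i ≡ b → Does (meets x a) s b s passTime →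
                   Σ Store λ s′ → Does (meets x a ∥ (c ⨾ ff)) s b s′ (passTime + (t + passTime)) × Post i s′
          decide true e D =
            s , does-∥t (t + passTime) D , ma , (λ _ → subst (λ k → J k s) (f-true e) j) , λ e′ → ⊥-elim (true≢false e e′)
          decide false e D =
            let i<v = ≤∧≢⇒< i≤v λ i≡v → true≢false (trans (cong (i ≡ᵇ_) (sym i≡v)) (≡ᵇ-refl i)) e
                s′ , b , D′ , j′ , same = body i<v j ma in
            s′ , does-∥f D (does-⨾ D′ (does-ff s′)) , (λ q p → trans (same q) (ma q p)) ,
            (λ e′ → ⊥-elim (true≢false e′ e)) , λ _ → i<v , j′

        open Some a a<M (meets x a ∥ (c ⨾ ff)) (passTime + (t + passTime)) f Inv Post
          proj₁ proj₁ run-body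
          (λ {i} {s} e (ma , _ , h) →
             (λ q p → trans (get-updated s a (delayed (s a)) q) (marks-delayed ma q p)) , proj₁ (h e) , J-free (proj₂ (h e)))

      abstract
        does-repeat : ∀ {s} → J 0 s → Σ Store λ s′ → Σ Bool λ b →
                      Does (repeat a x c) s b s′ (someTime (passTime + (t + passTime))) × J v s′
        does-repeat {s} j =
          let s′ , b , D , out = does-some s ((λ q p → get-updated s a (_≡ᵇ 0) q) , z≤n , J-free j) in
          s′ , b , D , conclude out
          where
          conclude : ∀ {b s} → Outcome f Inv Post b s → J v s
          conclude (found _ e _ (_ , h , _)) = h e
          conclude {s = s} (fails _ (_ , N≤v , j′)) = subst (λ k → J k s) (≤-antisym N≤v v≤N) j′

    abstract
      -- Two nested counting loops move the mark `pT` by one position u · v times; the outer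
      -- invariant is the position `base + i * v`, the inner one adds l to it.
      does-addMultiple : ∀ {d e s x y u v base} → Safe d e x → Safe d e y → idx x < 6 + m → idx y < 6 + m →
        u ≤ N → v ≤ N → Marks (s x) u → Marks (s y) v → Marks (s pT) base →
        Σ Store λ s′ → Σ Bool λ b → Does (addMultiple x y) s b s′ addTime × Keeps d e s s′ × Marks (s′ pT) (base + u * v)
      does-addMultiple {d} {e} {s} {x} {y} {u} {v} {base} sx sy x<M y<M u≤N v≤N mx my mp =
        Outer.does-repeat (keeps-refl , subst (Marks (s pT)) (sym (+-identityʳ base)) mp)
        where
        moved : ∀ {t w s′} → Safe d e t → Marks (s t) w → Keeps d e s s′ → Marks (s′ t) w
        moved {t} st mt k q p = trans (k t st q) (mt q p)

        shift-once : ∀ {i l s′ s″} → (Keeps d e s′ s″ × Marks (s″ pT) ((base + i * v) + l)) × (∀ q → s″ iT q ≡ s′ iT q) →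
                     Σ Store λ s‴ → Σ Bool λ b → Does (shift pT) s″ b s‴ passTime ×
                     ((Keeps d e s′ s‴ × Marks (s‴ pT) ((base + i * v) + suc l)) × (∀ q → s‴ iT q ≡ s′ iT q)) ×
                     (∀ q → s‴ jT q ≡ s″ jT q)
        shift-once {i} {l} {s′} {s″} ((k , mk) , same) =
          let b , D = does-shift pT s″ p<M in
          shifted pT s″ , b , D ,
          ((keeps-trans k (keeps-update {s = s″} {g = delayed (s″ pT)} (unsafe-p {d} {e})) ,
            subst (Marks (delayed (s″ pT))) (sym (+-suc (base + i * v) l)) (marks-delayed mk)) , same) ,
          λ q → refl

        addValue : ∀ {i s′} → i < u → Keeps d e s s′ × Marks (s′ pT) (base + i * v) → Marks (s′ iT) i →
                Σ Store λ s″ → Σ Bool λ b → Does (repeat jT y (shift pT)) s′ b s″ (someTime (passTime + (passTime + passTime))) ×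
                (Keeps d e s s″ × Marks (s″ pT) (base + suc i * v)) × (∀ q → s″ iT q ≡ s′ iT q)
        addValue {i} {s′} _ (k , mk) _ =
          let s″ , b , D , (k′ , mk′) , same =
                Inner.does-repeat ((keeps-refl , subst (Marks (s′ pT)) (sym (+-identityʳ _)) mk) , λ q → refl) in
          s″ , b , D , (keeps-trans k k′ , subst (Marks (s″ pT))
            (trans (+-assoc base (i * v) v) (cong (base +_) (+-comm (i * v) v))) mk′) , same
          where
          module Inner = Repeat jT y j<M y<M (shift pT) passTime v v≤N
            (λ l s″ → (Keeps d e s′ s″ × Marks (s″ pT) ((base + i * v) + l)) × (∀ q → s″ iT q ≡ s′ iT q))
            (λ ((k′ , _) , _) → moved sy my (keeps-trans k k′))
            (λ {_} {s″} {g} ((k′ , mk′) , same) → (keeps-trans k′ (keeps-update {s = s″} {g = g} (unsafe-j {d} {e})) , mk′) , same)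
            (λ _ h _ → shift-once {i} h)

        module Outer = Repeat iT x i<M x<M (repeat jT y (shift pT))
          (someTime (passTime + (passTime + passTime))) u u≤N
          (λ i s′ → Keeps d e s s′ × Marks (s′ pT) (base + i * v))
          (λ (k , _) → moved sx mx k)
          (λ {_} {s′} {g} (k , mk) → keeps-trans k (keeps-update {s = s′} {g = g} (unsafe-i {d} {e})) , mk)
          addValue

at-< : ∀ {n i} (g : Fin n → Bool) (p : i < n) → at g i ≡ g (fromℕ< p)
at-< {n} {i} g p with i <? n
... | yes q = cong g (Finₚ.fromℕ<-cong i i refl q p)
... | no ¬q = ⊥-elim (¬q p)

at-≥ : ∀ {n i} (g : Fin n → Bool) → ¬ i < n → at g i ≡ false
at-≥ {n} {i} g ¬p with i <? n
... | yes q = ⊥-elim (¬p q)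
... | no _  = refl

at-toℕ : ∀ {n} (g : Fin n → Bool) a → at g (toℕ a) ≡ g a
at-toℕ g a = trans (at-< g (Finₚ.toℕ<n a)) (cong g (Finₚ.fromℕ<-toℕ a (Finₚ.toℕ<n a)))

at-witness : ∀ {n i} (g : Fin n → Bool) → at g i ≡ true → ∃ λ a → g a ≡ true
at-witness {n} {i} g e with i <? n
... | yes q = fromℕ< q , e

-- The compiled commands evaluate formulas

module Simulation (m : ℕ) {n′ : ℕ} (G : Graph (suc n′)) where

  n N : ℕ
  n = suc n′
  N = n * n

  open Programs m
  open Tracks (6 + m)
  open Semantics N
  open Bounds N

  n≤N : n ≤ N
  n≤N = m≤m*n n n

  toℕ<N : (a : Fin n) → toℕ a < N
  toℕ<N a = <-≤-trans (Finₚ.toℕ<n a) n≤N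

  position<N : (a b : Fin n) → toℕ b + toℕ a * n < N
  position<N a b = ≤-trans (+-monoˡ-≤ (toℕ a * n) (Finₚ.toℕ<n b)) (*-monoˡ-≤ n (Finₚ.toℕ<n a))

  record Rep (d e : ℕ) (ρ : ℕ → Fin n) (σ : ℕ → Fin n → Bool) (s : Store) : Set where
    field
      input : ∀ a b → s inp (toℕ b + toℕ a * n) ≡ G a b
      size  : Marks (s nT) n
      verts : ∀ q → q < N → s vv q ≡ (q <ᵇ n)
      vars  : ∀ x → x < d → Marks (s (ivar x)) (toℕ (ρ x))
      sets  : ∀ y → y < e → ∀ a → s (svar y) (toℕ a) ≡ σ y a
  open Rep

  rep-keeps : ∀ {d e ρ σ s s′} → Keeps d e s s′ → Rep d e ρ σ s → Rep d e ρ σ s′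
  rep-keeps k r = record
    { input = λ a b → trans (k inp (inj₁ 0<3) _) (input r a b)
    ; size  = λ q p → trans (k nT (inj₁ 1<3) q) (size r q p)
    ; verts = λ q p → trans (k vv (inj₁ 2<3) q) (verts r q p)
    ; vars  = λ x x<d q p → trans (k (ivar x) x<d q) (vars r x x<d q p)
    ; sets  = λ y y<e a → trans (k (svar y) y<e _) (sets r y y<e a) }

  rep-bind : ∀ {d e ρ σ s a} → Marks (s (ivar d)) (toℕ a) → Rep d e ρ σ s → Rep (suc d) e (ρ [ d ↦ a ]) σ s
  rep-bind {d} {ρ = ρ} {s = s} {a} mk r = record
    { input = input r ; size = size r ; verts = verts r ; sets = sets r ; vars = vs }
    where
    vs : ∀ x → x < suc d → Marks (s (ivar x)) (toℕ ((ρ [ d ↦ a ]) x))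
    vs x p with m≤n⇒m<n∨m≡n (s≤s⁻¹ p)
    ... | inj₁ x<d  = subst (Marks (s (ivar x)) ∘ toℕ) (sym (↦-other ρ a (≢-sym (<⇒≢ x<d)))) (vars r x x<d)
    ... | inj₂ refl = subst (Marks (s (ivar x)) ∘ toℕ) (sym (↦-same ρ x a)) mk

  rep-bindSet : ∀ {d e ρ σ s X} → (∀ a → s (svar e) (toℕ a) ≡ X a) → Rep d e ρ σ s → Rep d (suc e) ρ (σ [ e ↦ X ]) s
  rep-bindSet {d} {e} {ρ} {σ} {s} {X} h r = record
    { input = input r ; size = size r ; verts = verts r ; vars = vars r ; sets = ss }
    where
    ss : ∀ y → y < suc e → ∀ a → s (svar y) (toℕ a) ≡ (σ [ e ↦ X ]) y a
    ss y p a with m≤n⇒m<n∨m≡n (s≤s⁻¹ p)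
    ... | inj₁ y<e  = trans (sets r y y<e a) (cong (λ Y → Y a) (sym (↦-other σ X (≢-sym (<⇒≢ y<e)))))
    ... | inj₂ refl = trans (h a) (cong (λ Y → Y a) (sym (↦-same σ y X)))

  does-edge : ∀ {d e ρ σ s x y} → x < d → y < d → x < 6 + m → y < 6 + m → Rep d e ρ σ s →
              Σ Store λ s′ → Does (edgeCmd (ivar x) (ivar y)) s (G (ρ x) (ρ y)) s′ edgeTime × Keeps d e s s′
  does-edge {d} {e} {ρ} {σ} {s} {x} {y} x<d y<d x<M y<M r =
    let s₁ = s [ pT ≔ s (ivar y) ]
        k₁ = keeps-update {d} {e} {s} {pT} {s (ivar y)} (unsafe-p {d} {e})
        r₁ = rep-keeps k₁ r
        s₂ , b , D₂ , k₂ , mp = does-addMultiple {d} {e} {s₁} {ivar x} {nT} {toℕ (ρ x)} {n} {toℕ (ρ y)}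
          x<d (inj₁ 1<3) x<M n<M (<⇒≤ (toℕ<N (ρ x))) n≤N (vars r₁ x x<d) (size r₁) (vars r y y<d)
        D₃ = does-meets inp pT s₂ inp<M p<M
        eq = trans (meets-mark {s₂ inp} mp (position<N (ρ x) (ρ y))) (input (rep-keeps k₂ r₁) (ρ x) (ρ y)) in
    s₂ , does-⨾ (does-copy pT (ivar y) s y<M) (does-⨾ D₂ (subst (λ b → Does (meets inp pT) s₂ b s₂ passTime) eq D₃)) ,
    keeps-trans k₁ k₂

  -- Owing to short-circuiting the final store may be that of either part, so P is required of both.
  does-& : ∀ {c d s s′ s″ t t′} {P : Store → Set} b b′ → P s′ → P s″ → Does c s b s′ t → Does d s′ b′ s″ t′ →
           Σ Store λ u → Does (c & d) s (b ∧ b′) u (t + t′) × P u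
  does-& {s″ = s″}         true  b′ p′ p″ D D′ = s″ , does-&t D D′ , p″
  does-& {s′ = s′} {t′ = t′} false b′ p′ p″ D D′ = s′ , does-&f t′ D , p′

  does-∥ : ∀ {c d s s′ s″ t t′} {P : Store → Set} b b′ → P s′ → P s″ → Does c s b s′ t → Does d s′ b′ s″ t′ →
           Σ Store λ u → Does (c ∥ d) s (b ∨ b′) u (t + t′) × P u
  does-∥ {s′ = s′} {t′ = t′} true  b′ p′ p″ D D′ = s′ , does-∥t t′ D , p′
  does-∥ {s″ = s″}         false b′ p′ p″ D D′ = s″ , does-∥f D D′ , p″

  outcome-anyFin : ∀ {g : Fin n → Bool} {Inv Post b s} → Outcome (at g) Inv Post b s → b ≡ anyFin g
  outcome-anyFin {g} (found {i} i<N e _ _) = let a , e′ = at-witness {i = i} g e in sym (anyFin-true g a e′)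
  outcome-anyFin {g} (fails none _) =
    sym (anyFin-false g λ a → trans (sym (at-toℕ g a)) (none (toℕ a) (toℕ<N a)))

  outcome-holds : ∀ {f Inv Post b s} {P : Store → Set} → (∀ {s} → Inv N s → P s) → (∀ {i s} → Post i s → P s) →
                  Outcome f Inv Post b s → P s
  outcome-holds h h′ (found _ _ _ p) = h′ p
  outcome-holds h h′ (fails _ p)     = h p

  outcome-never : ∀ {Inv Post b s} → Outcome (λ _ → false) Inv Post b s → b ≡ false × Inv N s
  outcome-never (fails _ p) = refl , p

  m<6+m : ∀ {x} → x < m → x < 6 + m
  m<6+m p = ≤-trans p (m≤n+m m 6)

  below : ∀ {x d} → T (x <ᵇ d) → x < d
  below {x} {d} = <ᵇ⇒< x d

  vertex-test : ∀ {d e ρ σ s i} → d < m → i < N → Rep d e ρ σ s → Marks (s (ivar d)) i →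
                Does (meets vv (ivar d)) s (i <ᵇ n) s passTime
  vertex-test {d} {s = s} {i} d<m i<N r mk =
    subst (λ b → Does (meets vv (ivar d)) s b s passTime) (trans (meets-mark {s vv} mk i<N) (verts r i i<N))
      (does-meets vv (ivar d) s vv<M (m<6+m d<m))

  Simulates : ℕ → ℕ → Fm → Set
  Simulates d e φ = ∀ {ρ σ s} → Rep d e ρ σ s →
    Σ Store λ s′ → Does (comp d e φ) s (eval G d e φ ρ σ) s′ (time φ) × Keeps d e s s′

  module Exists (d e : ℕ) (d<m : d < m) (φ : Fm) (ih : Simulates (suc d) e φ)
                {ρ σ s} (r : Rep d e ρ σ s) where

    g : Fin n → Bool
    g a = eval G (suc d) e φ (ρ [ d ↦ a ]) σ

    Inv : ℕ → Store → Set
    Inv i s′ = Keeps d e s s′ × Marks (s′ (ivar d)) i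

    body : ∀ {i s′} → i < N → Inv i s′ →
           Σ Store λ s″ → Does (meets vv (ivar d) & comp (suc d) e φ) s′ (at g i) s″ (passTime + time φ) × Inv i s″
    body {i} {s′} i<N (k , mk) = decide (i <? n)
      where
      D₀ = vertex-test d<m i<N (rep-keeps k r) mk
      decide : Dec (i < n) → Σ Store λ s″ → Does (meets vv (ivar d) & comp (suc d) e φ) s′ (at g i) s″ (passTime + time φ) × Inv i s″
      decide (yes p) =
        let mk′ = subst (Marks (s′ (ivar d))) (sym (Finₚ.toℕ-fromℕ< p)) mk
            s″ , D , k′ = ih (rep-bind {a = fromℕ< p} mk′ (rep-keeps k r)) in
        s″ , subst (λ b → Does (meets vv (ivar d) & comp (suc d) e φ) s′ b s″ (passTime + time φ)) (sym (at-< g p))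
               (does-&t (subst (λ b → Does (meets vv (ivar d)) s′ b s′ passTime) (<⇒<ᵇ-true p) D₀) D) ,
        keeps-trans k (keeps-mono (n≤1+n d) ≤-refl k′) , λ q lt → trans (k′ (ivar d) ≤-refl q) (mk q lt)
      decide (no ¬p) =
        s′ , subst (λ b → Does (meets vv (ivar d) & comp (suc d) e φ) s′ b s′ (passTime + time φ)) (sym (at-≥ g ¬p))
               (does-&f (time φ) (subst (λ b → Does (meets vv (ivar d)) s′ b s′ passTime) (≥⇒<ᵇ-false (≮⇒≥ ¬p)) D₀)) , k , mk

    next : ∀ {i s′} → at g i ≡ false → Inv i s′ → Inv (suc i) (shifted (ivar d) s′)
    next {i} {s′} _ (k , mk) =
      keeps-trans k (keeps-update {d} {e} {s′} {ivar d} {delayed (s′ (ivar d))} (<-irrefl refl)) ,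
      λ q p → trans (get-updated s′ (ivar d) (delayed (s′ (ivar d))) q) (marks-delayed mk q p)

    open Some (ivar d) (m<6+m d<m) (meets vv (ivar d) & comp (suc d) e φ) (passTime + time φ) (at g) Inv Inv
      proj₂ proj₂ body next

    result : Σ Store λ s′ → Does (comp d e (ex φ)) s (anyFin g) s′ (time (ex φ)) × Keeps d e s s′
    result =
      let s′ , b , D , out = does-some s
            (keeps-update {d} {e} {s} {ivar d} {_≡ᵇ 0} (<-irrefl refl) , λ q p → get-updated s (ivar d) (_≡ᵇ 0) q) in
      s′ , subst (λ b → Does (comp d e (ex φ)) s b s′ (time (ex φ))) (outcome-anyFin out) D ,
      outcome-holds {P = Keeps d e s} proj₁ proj₁ out

  module Closure (d e : ℕ) (d<m : d < m) (e<m : e < m) (φ : Fm) (ih : Simulates (suc d) (suc e) φ)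
                 {ρ σ s} (r : Rep d e ρ σ s) where

    F : (Fin n → Bool) → Fin n → Bool
    F X a = eval G (suc d) (suc e) φ (ρ [ d ↦ a ]) (σ [ e ↦ X ])

    counter : Track
    counter = reg (6 + e)

    Holds : Store → (Fin n → Bool) → Set
    Holds s′ X = ∀ a → s′ (svar e) (toℕ a) ≡ X a

    -- The counter of the outer loop is not yet safe at depth (d , e), so its mark `k₀` is carried
    -- through the inner loop as an invariant of its own.
    module Round (k₀ : ℕ) (X : Fin n → Bool) where

      Inv Post : ℕ → Store → Set
      Inv i s′ = Keeps d e s s′ × Marks (s′ counter) k₀ × Marks (s′ (ivar d)) i × Holds s′ (absorb F i X)
      Post i s′ = Keeps d e s s′ × Marks (s′ counter) k₀ × Marks (s′ (ivar d)) i × Holds s′ (absorb F (suc i) X)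

      tries : Cmd Cell
      tries = meets vv (ivar d) & comp (suc d) (suc e) φ

      insert : Cmd Cell
      insert = (tries & union (svar e) (ivar d)) ⨾ ff

      insertTime : ℕ
      insertTime = ((passTime + time φ) + passTime) + passTime

      body : ∀ {i s′} → i < N → Inv i s′ → Σ Store λ s″ → Does insert s′ false s″ insertTime × Post i s″
      body {i} {s′} i<N (k , mc , mk , hX) = decide (i <? n)
        where
        Y = absorb F i X
        D₀ = vertex-test d<m i<N (rep-keeps k r) mk
        decide : Dec (i < n) → Σ Store λ s″ → Does insert s′ false s″ insertTime × Post i s″
        decide (no ¬p) = s′ ,
          does-⨾ (does-&f passTime (does-&f (time φ)
            (subst (λ b → Does (meets vv (ivar d)) s′ b s′ passTime) (≥⇒<ᵇ-false (≮⇒≥ ¬p)) D₀))) (does-ff s′) ,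
          k , mc , mk , λ a → trans (hX a) (sym (trans
            (cong (λ b → Y a ∨ (b ∧ F Y a)) (≢⇒≡ᵇ-false i (toℕ a) λ { refl → ¬p (Finₚ.toℕ<n a) })) (Boolₚ.∨-identityʳ (Y a))))
        decide (yes p) =
          let mk′ = subst (Marks (s′ (ivar d))) (sym (Finₚ.toℕ-fromℕ< p)) mk
              s″ , D , k′ = ih (rep-bind {a = fromℕ< p} mk′ (rep-bindSet {X = Y} hX (rep-keeps k r))) in
          finish s″ k′ (F Y (fromℕ< p)) refl
            (does-&t (subst (λ b → Does (meets vv (ivar d)) s′ b s′ passTime) (<⇒<ᵇ-true p) D₀) D)
          where
          finish : ∀ s″ → Keeps (suc d) (suc e) s′ s″ → ∀ b → F Y (fromℕ< p) ≡ b →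
                   Does tries s′ b s″ (passTime + time φ) → Σ Store λ s‴ → Does insert s′ false s‴ insertTime × Post i s‴
          finish s″ k′ b eq D = go b eq D
            where
            keeps : Keeps d e s s″
            keeps = keeps-trans k (keeps-mono (n≤1+n d) (n≤1+n e) k′)
            marks : Marks (s″ (ivar d)) i
            marks q lt = trans (k′ (ivar d) ≤-refl q) (mk q lt)
            counts : Marks (s″ counter) k₀
            counts q lt = trans (k′ counter (inj₂ (m≤m+n 6 e , ≤-refl)) q) (mc q lt)
            holds : Holds s″ Y
            holds a = trans (k′ (svar e) ≤-refl (toℕ a)) (hX a)
            absorbed : ∀ a {b} → F Y (fromℕ< p) ≡ b → (i ≡ᵇ toℕ a) ∧ F Y a ≡ (i ≡ᵇ toℕ a) ∧ b
            absorbed a eq with i ≟ toℕ a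
            ... | yes refl = cong ((toℕ a ≡ᵇ toℕ a) ∧_) (trans (cong (F Y) (sym (Finₚ.fromℕ<-toℕ a p))) eq)
            ... | no ne rewrite ≢⇒≡ᵇ-false i (toℕ a) ne = refl
            go : ∀ b → F Y (fromℕ< p) ≡ b → Does tries s′ b s″ (passTime + time φ) →
                 Σ Store λ s‴ → Does insert s′ false s‴ insertTime × Post i s‴
            go false eq D = s″ , does-⨾ (does-&f passTime D) (does-ff s″) , keeps , counts , marks ,
              λ a → trans (holds a) (sym (trans
                (cong (Y a ∨_) (trans (absorbed a eq) (Boolₚ.∧-zeroʳ (i ≡ᵇ toℕ a)))) (Boolₚ.∨-identityʳ (Y a))))
            go true eq D =
              s‴ , does-⨾ (does-&t D (does-union (svar e) (ivar d) s″ (m<6+m e<m) (m<6+m d<m))) (does-ff s‴) ,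
              keeps-trans keeps (keeps-update {d} {e} {s″} {svar e} {h} (<-irrefl refl)) , counts , marks ,
              λ a → trans (get-updated s″ (svar e) h (toℕ a)) (cong₂ _∨_ (holds a)
                (trans (marks (toℕ a) (toℕ<N a)) (trans (≡ᵇ-sym (toℕ a) i)
                  (sym (trans (absorbed a eq) (Boolₚ.∧-identityʳ (i ≡ᵇ toℕ a)))))))
              where
              h : ℕ → Bool
              h q = s″ (svar e) q ∨ s″ (ivar d) q
              s‴ = s″ [ svar e ≔ h ]

      next : ∀ {i s′} → false ≡ false → Post i s′ → Inv (suc i) (shifted (ivar d) s′)
      next {i} {s′} _ (k , mc , mk , hX) =
        keeps-trans k (keeps-update {d} {e} {s′} {ivar d} {delayed (s′ (ivar d))} (<-irrefl refl)) , mc ,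
        (λ q p → trans (get-updated s′ (ivar d) (delayed (s′ (ivar d))) q) (marks-delayed mk q p)) , hX

      open Some (ivar d) (m<6+m d<m) insert insertTime (λ _ → false) Inv Post
        (proj₁ ∘ proj₂ ∘ proj₂) (proj₁ ∘ proj₂ ∘ proj₂) body next

      result : ∀ {s′} → Keeps d e s s′ → Marks (s′ counter) k₀ → Holds s′ X →
               Σ Store λ s″ → Does (some (ivar d) insert) s′ false s″ (someTime insertTime) × Inv N s″
      result {s′} k mc hX =
        let s″ , b , D , out = does-some s′
              (keeps-trans k (keeps-update {d} {e} {s′} {ivar d} {_≡ᵇ 0} (<-irrefl refl)) , mc ,
               (λ q p → get-updated s′ (ivar d) (_≡ᵇ 0) q) , hX)
            b≡ , inv = outcome-never out in
        s″ , subst (λ b → Does (some (ivar d) insert) s′ b s″ (someTime insertTime)) b≡ D , inv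

    Inv Post : ℕ → Store → Set
    Inv k₀ s′ = Keeps d e s s′ × Marks (s′ counter) k₀ × Holds s′ (rounds F N k₀)
    Post k₀ s′ = Keeps d e s s′ × Marks (s′ counter) k₀ × Holds s′ (rounds F N (suc k₀))

    open Round 0 (λ _ → false) using (insert; insertTime)

    body : ∀ {k₀ s′} → k₀ < N → Inv k₀ s′ →
           Σ Store λ s″ → Does (some (ivar d) insert) s′ false s″ (someTime insertTime) × Post k₀ s″
    body {k₀} _ (k , mc , hX) =
      let s″ , D , (k′ , mc′ , _ , hX′) = Round.result k₀ (rounds F N k₀) k mc hX in s″ , D , k′ , mc′ , hX′

    next : ∀ {k₀ s′} → false ≡ false → Post k₀ s′ → Inv (suc k₀) (shifted counter s′)
    next {k₀} {s′} _ (k , mc , hX) =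
      keeps-trans k (keeps-update {d} {e} {s′} {counter} {delayed (s′ counter)} (unsafe-reg {d} e)) ,
      (λ q p → trans (get-updated s′ counter (delayed (s′ counter)) q) (marks-delayed mc q p)) , hX

    open Some counter (+-monoʳ-< 6 e<m) (some (ivar d) insert) (someTime insertTime) (λ _ → false) Inv Post
      (proj₁ ∘ proj₂) (proj₁ ∘ proj₂) body next

    result : ∀ ψ → Simulates d (suc e) ψ →
             Σ Store λ s′ → Does (comp d e (letc φ ψ)) s (eval G d e (letc φ ψ) ρ σ) s′ (time (letc φ ψ)) × Keeps d e s s′
    result ψ ihψ =
      let s₁ = s [ svar e ≔ (λ _ → false) ]
          k₁ = keeps-update {d} {e} {s} {svar e} {λ _ → false} (<-irrefl refl)
          s₂ , b , D₂ , out = does-some s₁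
            (keeps-trans k₁ (keeps-update {d} {e} {s₁} {counter} {_≡ᵇ 0} (unsafe-reg {d} e)) ,
             (λ q p → get-updated s₁ counter (_≡ᵇ 0) q) ,
             λ a → trans (get-other s₁ {counter} {svar e} (_≡ᵇ 0) (toℕ a) λ ()) (get-updated s (svar e) (λ _ → false) (toℕ a)))
          b≡ , (k₂ , _ , hX) = outcome-never out
          s₃ , D₃ , k₃ = ihψ (rep-bindSet {X = closure F N} (λ a → trans (hX a) (sym (closure-rounds F N a))) (rep-keeps k₂ r)) in
      s₃ , does-⨾ (does-clear (svar e) s) (does-⨾ D₂ D₃) , keeps-trans k₂ (keeps-mono ≤-refl (n≤1+n e) k₃)

  simulates-fm : ∀ φ d e → d ≤ m → e ≤ m → T (wf d e φ) → Simulates d e φ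
  simulates-fm (edge x y) d e dm em w r =
    let p , q = split-∧ {x <ᵇ d} w in
    does-edge (below p) (below q) (m<6+m (<-≤-trans (below p) dm)) (m<6+m (<-≤-trans (below q) dm)) r
  simulates-fm (equal x y) d e dm em w {ρ} {σ} {s} r =
    let p , q = split-∧ {x <ᵇ d} w in
    s , subst (λ b → Does (meets (ivar x) (ivar y)) s b s passTime)
          (trans (meets-mark {s (ivar x)} (vars r y (below q)) (toℕ<N (ρ y)))
            (trans (vars r x (below p) (toℕ (ρ y)) (toℕ<N (ρ y))) (≡ᵇ-sym (toℕ (ρ y)) (toℕ (ρ x)))))
          (does-meets (ivar x) (ivar y) s (m<6+m (<-≤-trans (below p) dm)) (m<6+m (<-≤-trans (below q) dm))) , keeps-refl
  simulates-fm (mem y x) d e dm em w {ρ} {σ} {s} r =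
    let p , q = split-∧ {y <ᵇ e} w in
    s , subst (λ b → Does (meets (svar y) (ivar x)) s b s passTime)
          (trans (meets-mark {s (svar y)} (vars r x (below q)) (toℕ<N (ρ x))) (sets r y (below p) (ρ x)))
          (does-meets (svar y) (ivar x) s (m<6+m (<-≤-trans (below p) em)) (m<6+m (<-≤-trans (below q) dm))) , keeps-refl
  simulates-fm (not′ φ) d e dm em w r =
    let s′ , D , k = simulates-fm φ d e dm em w r in s′ , does-neg D , k
  simulates-fm (φ and ψ) d e dm em w {ρ} {σ} {s} r =
    let p , q = split-∧ {wf d e φ} w
        s′ , D , k = simulates-fm φ d e dm em p r
        s″ , D′ , k′ = simulates-fm ψ d e dm em q (rep-keeps k r) in
    does-& {P = Keeps d e s} (eval G d e φ ρ σ) _ k (keeps-trans k k′) D D′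
  simulates-fm (φ or ψ) d e dm em w {ρ} {σ} {s} r =
    let p , q = split-∧ {wf d e φ} w
        s′ , D , k = simulates-fm φ d e dm em p r
        s″ , D′ , k′ = simulates-fm ψ d e dm em q (rep-keeps k r) in
    does-∥ {P = Keeps d e s} (eval G d e φ ρ σ) _ k (keeps-trans k k′) D D′
  simulates-fm (ex φ) d e dm em w r =
    let p , q = split-∧ {d <ᵇ m} w in
    Exists.result d e (below p) φ (simulates-fm φ (suc d) e (below p) em q) r
  simulates-fm (letc φ ψ) d e dm em w r =
    let p , q = split-∧ {(d <ᵇ m) ∧ (e <ᵇ m)} w
        p₁ , p₂ = split-∧ {d <ᵇ m} p
        q₁ , q₂ = split-∧ {wf (suc d) (suc e) φ} q in
    Closure.result d e (below p₁) (below p₂) φ (simulates-fm φ (suc d) (suc e) (below p₁) (below p₂) q₁) r ψ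
      (simulates-fm ψ d (suc e) dm (below p₂) q₂)

-- Positions in the encoded adjacency matrix

bitAt : List Bool → ℕ → Bool
bitAt []       q       = false
bitAt (b ∷ bs) zero    = b
bitAt (b ∷ bs) (suc q) = bitAt bs q

bitAt-++ˡ : ∀ us vs {q} → q < length us → bitAt (us ++ vs) q ≡ bitAt us q
bitAt-++ˡ (u ∷ us) vs {zero}  p       = refl
bitAt-++ˡ (u ∷ us) vs {suc q} (s≤s p) = bitAt-++ˡ us vs p

bitAt-++ʳ : ∀ us vs q → bitAt (us ++ vs) (length us + q) ≡ bitAt vs q
bitAt-++ʳ []       vs q = refl
bitAt-++ʳ (u ∷ us) vs q = bitAt-++ʳ us vs q

bitAt-tabulate : ∀ {n} (g : Fin n → Bool) j → bitAt (tabulate g) (toℕ j) ≡ g j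
bitAt-tabulate g zero    = refl
bitAt-tabulate g (suc j) = bitAt-tabulate (g ∘ suc) j

bitAt-concatMap : ∀ {A : Set} {n k} (f : A → List Bool) (h : Fin k → A) → (∀ a → length (f a) ≡ n) →
                  ∀ i j → j < n → bitAt (concatMap f (tabulate h)) (j + toℕ i * n) ≡ bitAt (f (h i)) j
bitAt-concatMap {n = n} f h len zero j p =
  trans (cong (bitAt (concatMap f (tabulate h))) (+-identityʳ j))
        (bitAt-++ˡ (f (h zero)) _ (subst (j <_) (sym (len (h zero))) p))
bitAt-concatMap {n = n} f h len (suc i) j p =
  trans (cong (bitAt (concatMap f (tabulate h))) eq)
    (trans (bitAt-++ʳ (f (h zero)) _ (j + toℕ i * n)) (bitAt-concatMap f (h ∘ suc) len i j p))
  where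
  eq : j + (n + toℕ i * n) ≡ length (f (h zero)) + (j + toℕ i * n)
  eq rewrite len (h zero) = trans (sym (+-assoc j n _)) (trans (cong (_+ toℕ i * n) (+-comm j n)) (+-assoc n j _))

length-concatMap : ∀ {A : Set} {n} (f : A → List Bool) xs → (∀ a → length (f a) ≡ n) → length (concatMap f xs) ≡ length xs * n
length-concatMap f []       len = refl
length-concatMap f (x ∷ xs) len =
  trans (Listₚ.length-++ (f x)) (cong₂ _+_ (len x) (length-concatMap f xs len))

length-row : ∀ {n} (G : Graph n) i → length (map (G i) (allFin n)) ≡ n
length-row {n} G i = trans (Listₚ.length-map (G i) (allFin n)) (Listₚ.length-tabulate id)

length-encode : ∀ {n} (G : Graph n) → length (encode G) ≡ n * n
length-encode {n} G = trans (length-concatMap _ (allFin n) (length-row G)) (cong (_* n) (Listₚ.length-tabulate {n = n} id))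

bitAt-encode : ∀ {n} (G : Graph n) i j → bitAt (encode G) (toℕ j + toℕ i * n) ≡ G i j
bitAt-encode {n} G i j =
  trans (bitAt-concatMap {n = n} (λ i → map (G i) (allFin n)) id (length-row G) i (toℕ j) (Finₚ.toℕ<n j))
    (trans (cong (λ bs → bitAt bs (toℕ j)) (Listₚ.map-tabulate id (G i))) (bitAt-tabulate (G i) j))

-- Polynomial bounds

^-distribʳ-* : ∀ k a b → (a * b) ^ k ≡ a ^ k * b ^ k
^-distribʳ-* zero    a b = refl
^-distribʳ-* (suc k) a b = trans (cong (a * b *_) (^-distribʳ-* k a b)) ([m*n]*[o*p]≡[m*o]*[n*p] a b (a ^ k) (b ^ k))

-- Powers of `suc N` instead of N keep the bounds valid at N = 0 and monotone in the degree.
record Poly (f : ℕ → ℕ) : Set where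
  constructor poly
  field
    factor degree : ℕ
    bound : ∀ N → f N ≤ factor * suc N ^ degree

poly-const : ∀ c → Poly (λ _ → c)
poly-const c = poly c 0 (λ N → ≤-reflexive (sym (*-identityʳ c)))

poly-id : Poly (λ N → N)
poly-id = poly 1 1 (λ N → ≤-trans (n≤1+n N) (≤-reflexive (sym (trans (*-identityˡ _) (*-identityʳ (suc N))))))

poly-+ : ∀ {f g} → Poly f → Poly g → Poly (λ N → f N + g N)
poly-+ {f} {g} (poly A B p) (poly A′ B′ p′) = poly (A + A′) (B + B′) λ N → begin
  f N + g N                                     ≤⟨ +-mono-≤ (p N) (p′ N) ⟩
  A * suc N ^ B + A′ * suc N ^ B′               ≤⟨ +-mono-≤ (*-monoʳ-≤ A (^-monoʳ-≤ (suc N) (m≤m+n B B′)))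
                                                            (*-monoʳ-≤ A′ (^-monoʳ-≤ (suc N) (m≤n+m B′ B))) ⟩
  A * suc N ^ (B + B′) + A′ * suc N ^ (B + B′)  ≡⟨ *-distribʳ-+ (suc N ^ (B + B′)) A A′ ⟨
  (A + A′) * suc N ^ (B + B′)                   ∎
  where open ≤-Reasoning

poly-* : ∀ {f g} → Poly f → Poly g → Poly (λ N → f N * g N)
poly-* {f} {g} (poly A B p) (poly A′ B′ p′) = poly (A * A′) (B + B′) λ N → begin
  f N * g N                           ≤⟨ *-mono-≤ (p N) (p′ N) ⟩
  (A * suc N ^ B) * (A′ * suc N ^ B′) ≡⟨ [m*n]*[o*p]≡[m*o]*[n*p] A (suc N ^ B) A′ (suc N ^ B′) ⟩
  (A * A′) * (suc N ^ B * suc N ^ B′) ≡⟨ cong (A * A′ *_) (^-distribˡ-+-* (suc N) B B′) ⟨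
  (A * A′) * suc N ^ (B + B′)         ∎
  where open ≤-Reasoning

-- One constant has to serve as factor, exponent and summand. For positive arguments k, k + 1 ≤ 2k
-- turns A (k + 1)^B into A 2^B k^B, whence the choice of c; at 0 the summand c pays for everything.
poly-exponent : ∀ {f} → Poly f → Σ ℕ λ c → ∀ N → f N < c * N ^ c + c
poly-exponent {f} (poly A B p) = c , λ { zero → base ; (suc N) → step′ N }
  where
  open ≤-Reasoning
  c = suc (A * 2 ^ B + B)
  A≤ : A * 2 ^ B ≤ c
  A≤ = ≤-trans (m≤m+n _ B) (n≤1+n _)
  base : f 0 < c * 0 ^ c + c
  base = begin-strict
    f 0          ≤⟨ p 0 ⟩
    A * 1 ^ B    ≤⟨ *-monoʳ-≤ A (^-monoˡ-≤ B (s≤s z≤n)) ⟩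
    A * 2 ^ B    <⟨ s≤s (m≤m+n _ B) ⟩
    c            ≤⟨ m≤n+m c _ ⟩
    c * 0 ^ c + c ∎
  step′ : ∀ N → f (suc N) < c * suc N ^ c + c
  step′ N = begin-strict
    f (suc N)                     ≤⟨ p (suc N) ⟩
    A * suc (suc N) ^ B           ≤⟨ *-monoʳ-≤ A (^-monoˡ-≤ B (s≤s (s≤s (≤-trans (m≤m+n N N) (≤-reflexive (cong (N +_) (sym (+-identityʳ N)))))))) ⟩
    A * (2 + 2 * N) ^ B           ≡⟨ cong (λ x → A * x ^ B) (*-suc 2 N) ⟨
    A * (2 * suc N) ^ B           ≡⟨ cong (A *_) (^-distribʳ-* B 2 (suc N)) ⟩
    A * (2 ^ B * suc N ^ B)       ≡⟨ *-assoc A (2 ^ B) _ ⟨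
    A * 2 ^ B * suc N ^ B         ≤⟨ *-mono-≤ A≤ (^-monoʳ-≤ (suc N) (≤-trans (m≤n+m B (A * 2 ^ B)) (n≤1+n _))) ⟩
    c * suc N ^ c                 <⟨ m<m+n _ (s≤s z≤n) ⟩
    c * suc N ^ c + c             ∎

-- The complete machine and its running time

module Compilation (m : ℕ) where

  open Programs m
  open Tracks (6 + m)
  open module B (N : ℕ) = Bounds N
  private module S (N : ℕ) = Semantics N

  poly-passTime : Poly (λ N → S.passTime N)
  poly-passTime = poly-+ poly-id (poly-+ (poly-const 2) poly-id)

  poly-someTime : ∀ {f} → Poly f → Poly (λ N → S.someTime N (f N))
  poly-someTime p = poly-+ poly-passTime (poly-+ (poly-* (poly-+ (poly-const 1) poly-id)
    (poly-+ poly-passTime (poly-+ p (poly-+ poly-passTime poly-passTime)))) poly-passTime)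

  poly-addTime : Poly (λ N → addTime N)
  poly-addTime = poly-someTime (poly-+ poly-passTime (poly-+ (poly-someTime
    (poly-+ poly-passTime (poly-+ poly-passTime poly-passTime))) poly-passTime))

  poly-setupTime : Poly (λ N → setupTime N)
  poly-setupTime = poly-+ (poly-someTime (poly-+ poly-passTime (poly-+ poly-addTime poly-passTime)))
    (poly-+ poly-passTime (poly-someTime (poly-+ poly-passTime (poly-+ poly-passTime poly-passTime))))

  poly-time : ∀ φ → Poly (λ N → time N φ)
  poly-time (edge x y)  = poly-+ poly-passTime (poly-+ poly-addTime poly-passTime)
  poly-time (equal x y) = poly-passTime
  poly-time (mem y x)   = poly-passTime
  poly-time (not′ φ)    = poly-time φ
  poly-time (φ and ψ)   = poly-+ (poly-time φ) (poly-time ψ)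
  poly-time (φ or ψ)    = poly-+ (poly-time φ) (poly-time ψ)
  poly-time (ex φ)      = poly-someTime (poly-+ poly-passTime (poly-time φ))
  poly-time (letc φ ψ)  = poly-+ poly-passTime (poly-+ (poly-someTime (poly-someTime
    (poly-+ (poly-+ (poly-+ poly-passTime (poly-time φ)) poly-passTime) poly-passTime))) (poly-time ψ))

  blankStore : (ℕ → Bool) → Store
  blankStore w = (λ _ _ → false) [ inp ≔ w ]

  init : Bool → Cell
  init b = put (tab (λ _ → false)) inp b

  map-init : ∀ w → map init w ≡ Semantics.encode-store (length w) (blankStore (bitAt w))
  map-init w = go w
    where
    go : ∀ w → map init w ≡ applyUpTo (λ q → tab (λ t → blankStore (bitAt w) t q)) (length w)
    go []      = refl
    go (b ∷ w) = cong₂ _∷_ (put-tab inp (λ _ → false) b) (go w)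

  module Setup {n′ : ℕ} (G : Graph (suc n′)) where

    open Simulation m G
    open Semantics N

    square-test : ∀ {i} {s : Store} → Marks (s pT) (i * i) → anyBelow N (λ q → s pT q ∧ s pT q) ≡ (i * i <ᵇ N)
    square-test {i} {s} mk with i * i <? N
    ... | yes p = trans (meets-mark {s pT} mk p) (trans (mk (i * i) p) (trans (≡ᵇ-refl (i * i)) (sym (<⇒<ᵇ-true p))))
    ... | no ¬p = trans (meets-off {s pT} mk (≮⇒≥ ¬p)) (sym (≥⇒<ᵇ-false (≮⇒≥ ¬p)))

    module Root (s : Store) where

      f : ℕ → Bool
      f i = not (i * i <ᵇ N)

      Inv : ℕ → Store → Set
      Inv i s′ = (∀ q → s′ inp q ≡ s inp q) × Marks (s′ nT) i

      try : Cmd Cell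
      try = reset pT ⨾ (addMultiple nT nT ⨾ neg (meets pT pT))

      tryTime : ℕ
      tryTime = passTime + (addTime N + passTime)

      body : ∀ {i s′} → i < N → Inv i s′ → Σ Store λ s″ → Does try s′ (f i) s″ tryTime × Inv i s″
      body {i} {s′} i<N (hi , mk) =
        let s₁ = s′ [ pT ≔ (_≡ᵇ 0) ]
            _ , D₁ = does-reset pT s′
            s₂ , b , D₂ , k , mp = does-addMultiple N {0} {0} {s₁} {nT} {nT} {i} {i} {0}
              (inj₁ 1<3) (inj₁ 1<3) (n<M N) (n<M N)
              (<⇒≤ i<N) (<⇒≤ i<N) mk mk (λ q p → refl)
            p<M′ = p<M N in
        s₂ , does-⨾ D₁ (does-⨾ D₂ (does-neg
          (subst (λ b → Does (meets pT pT) s₂ b s₂ passTime) (square-test {i} {s₂} mp) (does-meets pT pT s₂ p<M′ p<M′)))) ,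
        (λ q → trans (k inp (inj₁ 0<3) q) (hi q)) , λ q p → trans (k nT (inj₁ 1<3) q) (mk q p)

      open Some nT (n<M N) try tryTime f Inv Inv proj₂ proj₂ body
        (λ {i} {s′} _ (hi , mk) → hi , marks-delayed mk)

      root : ∀ {b s′} → Outcome f Inv Inv b s′ → Inv n s′
      root {s′ = s′} (found {i} i<N e prev (hi , mk)) = hi , subst (Marks (s′ nT)) i≡n mk
        where
        i≡n : i ≡ n
        i≡n with <-cmp i n
        ... | tri≈ _ i≡n _ = i≡n
        ... | tri< i<n _ _ = ⊥-elim (true≢false e (cong not (<⇒<ᵇ-true (*-mono-< i<n i<n))))
        ... | tri> _ _ n<i = ⊥-elim (true≢false (cong not (≥⇒<ᵇ-false {N} {N} ≤-refl)) (prev n n<i))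
      -- Since n² = N, the search fails only when n is not below N, that is, when n = N. The mark
      -- has then run to N, which is the right value.
      root {s′ = s′} (fails none (hi , mk)) = hi , subst (Marks (s′ nT)) (sym n≡N) mk
        where
        n≡N : n ≡ N
        n≡N with m≤n⇒m<n∨m≡n n≤N
        ... | inj₁ n<N = ⊥-elim (true≢false (cong not (≥⇒<ᵇ-false {N} {N} ≤-refl)) (none n n<N))
        ... | inj₂ eq  = eq

      result : Σ Store λ s′ → Σ Bool λ b → Does findRoot s b s′ (someTime tryTime) × Inv n s′
      result = let s′ , b , D , out = does-some s ((λ q → refl) , λ q p → refl) in s′ , b , D , root out

    does-setup : ∀ s → Σ Store λ s′ → Σ Bool λ b → Does setup s b s′ (setupTime N) ×
                 (∀ q → s′ inp q ≡ s inp q) × Marks (s′ nT) n × (∀ q → q < N → s′ vv q ≡ (q <ᵇ n))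
    does-setup s =
      let s₁ , b , D , hi , mk = Root.result s
          s₂ = s₁ [ vv ≔ (λ _ → false) ]
          s₃ , b′ , D′ , J′ = Verts.does-repeat {s₂} (hi , mk , λ q p → refl) in
      s₃ , b′ , does-⨾ D (does-⨾ (does-clear vv s₁) D′) , J′
      where
      Below : ℕ → Store → Set
      Below i s′ = (∀ q → s′ inp q ≡ s inp q) × Marks (s′ nT) n × (∀ q → q < N → s′ vv q ≡ (q <ᵇ i))
      add-vertex : ∀ {i s′} → i < n → Below i s′ → Marks (s′ iT) i →
                   Σ Store λ s″ → Σ Bool λ b → Does (union vv iT) s′ b s″ passTime × Below (suc i) s″ × (∀ q → s″ iT q ≡ s′ iT q)
      add-vertex {i} {s′} _ (hi , mk , hv) mi =
        s′ [ vv ≔ (λ q → s′ vv q ∨ s′ iT q) ] , false , does-union vv iT s′ (vv<M N) (i<M N) ,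
        (hi , mk , λ q p → trans (cong₂ _∨_ (hv q p) (mi q p)) (<ᵇ-suc q i)) , λ q → refl
      module Verts = Repeat N iT nT (i<M N) (n<M N) (union vv iT) passTime n n≤N Below (proj₁ ∘ proj₂) id add-vertex

    does-all : ∀ φ → T (wf 0 0 φ) → ∀ ρ σ → Σ Store λ s′ →
               Does (setup ⨾ comp 0 0 φ) (blankStore (bitAt (encode G))) (eval G 0 0 φ ρ σ) s′ (setupTime N + time N φ)
    does-all φ w ρ σ =
      let s₁ , b , D , hi , mk , hv = does-setup (blankStore (bitAt (encode G)))
          r = record { input = λ a b → trans (hi _) (bitAt-encode G a b) ; size = mk ; verts = hv
                     ; vars = λ _ () ; sets = λ _ () }
          s₂ , D₂ , _ = simulates-fm φ 0 0 z≤n z≤n w {ρ} {σ} r in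
      s₂ , does-⨾ D D₂

  run-some-[] : ∀ a {c} → Run (some a c) [] false [] 6
  run-some-[] a = run-⨾ run-pass (run-⨾ (run-stop (run-neg (run-&f run-pass))) run-pass)

  module _ (φ : Fm) (w : T (wf 0 0 (ex φ))) where

    open Machine Cell finite-Cell init
    open Compile (setup ⨾ comp 0 0 (ex φ))

    total : ℕ → ℕ
    -- The 50 leaves room for the empty graph, whose run is computed separately and takes 22 steps
    -- before the halting step.
    total N = (N + (2 + N) + (setupTime N + time N (ex φ))) + 50

    poly-total : Poly total
    poly-total = poly-+ (poly-+ poly-passTime (poly-+ poly-setupTime (poly-time (ex φ)))) (poly-const 50)

    abstract
      total-exponent : Σ ℕ λ c → ∀ N → total N < c * N ^ c + c
      total-exponent = poly-exponent {total} poly-total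

    exponent : ℕ
    exponent = proj₁ total-exponent

    total< : ∀ N → total N < exponent * N ^ exponent + exponent
    total< = proj₂ total-exponent

    total-bound : ∀ {l N k} → l ≡ N → k ≤ setupTime N + time N (ex φ) →
                  l + (2 + l) + k < exponent * l ^ exponent + exponent
    total-bound {N = N} refl p = ≤-<-trans (≤-trans (+-monoʳ-≤ (N + (2 + N)) p) (m≤m+n _ 50)) (total< N)

    answers : ∀ {n′} (G : Graph (suc n′)) ρ σ →
              run machine (exponent * length (encode G) ^ exponent + exponent) (initConf machine (encode G))
              ≡ just (eval G 0 0 (ex φ) ρ σ)
    answers {n′} G ρ σ = go (Setup.does-all G (ex φ) w ρ σ)
      where
      N = suc n′ * suc n′
      open Semantics N
      bits = blankStore (bitAt (encode G))
      loaded : encode-store bits ≡ map init (encode G)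
      loaded = sym (trans (map-init (encode G)) (cong (λ l → Semantics.encode-store l bits) (length-encode G)))
      go : (Σ Store λ s′ → Does (setup ⨾ comp 0 0 (ex φ)) bits (eval G 0 0 (ex φ) ρ σ) s′ (setupTime N + time N (ex φ))) →
           run machine (exponent * length (encode G) ^ exponent + exponent) (initConf machine (encode G))
           ≡ just (eval G 0 0 (ex φ) ρ σ)
      go (s′ , does-in k r p) = machine-answers (encode G) {ys = encode-store s′} {k = k}
        (subst (λ xs → Run (setup ⨾ comp 0 0 (ex φ)) xs (eval G 0 0 (ex φ) ρ σ) (encode-store s′) k) loaded r)
        (total-bound (length-encode G) p)

    answers-empty : (G : Graph 0) →
                    run machine (exponent * length (encode G) ^ exponent + exponent) (initConf machine (encode G)) ≡ just false
    -- On the empty tape each of the three searches takes 6 steps and the clearing pass takes 2,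
    -- which makes 20.
    answers-empty G = machine-answers [] {ys = []} {k = 20}
      (run-⨾ (run-⨾ (run-some-[] nT) (run-⨾ run-pass (run-some-[] iT))) (run-some-[] (ivar 0)))
      (≤-<-trans (≤-trans (m≤m+n 22 28) (m≤n+m 50 (0 + (2 + 0) + (setupTime 0 + time 0 (ex φ))))) (total< 0))

-- Induced minors and their models

data Conn {n} (G : Graph n) (P : Fin n → Set) : Fin n → Fin n → Set where
  stop : ∀ {u} → P u → Conn G P u u
  go   : ∀ {u v w} → P u → G u v ≡ true → Conn G P v w → Conn G P u w

module _ {n} {G : Graph n} where

  conn-map : ∀ {P Q : Fin n → Set} → (∀ {u} → P u → Q u) → ∀ {u v} → Conn G P u v → Conn G Q u v
  conn-map f (stop p)   = stop (f p)
  conn-map f (go p e c) = go (f p) e (conn-map f c)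

  conn-trans : ∀ {P : Fin n → Set} {u v w} → Conn G P u v → Conn G P v w → Conn G P u w
  conn-trans (stop p)   d = d
  conn-trans (go p e c) d = go p e (conn-trans c d)

  conn-source : ∀ {P : Fin n → Set} {u v} → Conn G P u v → P u
  conn-source (stop p)   = p
  conn-source (go p _ _) = p

  conn-target : ∀ {P : Fin n → Set} {u v} → Conn G P u v → P v
  conn-target (stop p)   = p
  conn-target (go _ _ c) = conn-target c

  conn-sym : (∀ i j → G i j ≡ G j i) → ∀ {P : Fin n → Set} {u v} → Conn G P u v → Conn G P v u
  conn-sym s (stop p) = stop p
  conn-sym s (go {u} {v} p e c) = conn-trans (conn-sym s c) (go (conn-source c) (trans (s v u) e) (stop p))

-- The bags are the fibres of a partial labelling. They are disjoint by construction, and deletions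
-- and contractions act on a model by composition with the vertex maps.
record Model {m n} (H : Graph m) (G : Graph n) (φ : Fin n → Maybe (Fin m)) : Set where
  field
    surj     : ∀ i → ∃ λ u → φ u ≡ just i
    conn     : ∀ {u v i} → φ u ≡ just i → φ v ≡ just i → Conn G (λ w → φ w ≡ just i) u v
    edge-to  : ∀ {i j} → i ≢ j → H i j ≡ true → ∃ λ u → ∃ λ v → φ u ≡ just i × φ v ≡ just j × G u v ≡ true
    edge-of  : ∀ {i j u v} → i ≢ j → φ u ≡ just i → φ v ≡ just j → G u v ≡ true → H i j ≡ true

just-injective : ∀ {A : Set} {a b : A} → just a ≡ just b → a ≡ b
just-injective refl = refl

∨-cases : ∀ a {b} → a ∨ b ≡ true → a ≡ true ⊎ b ≡ true
∨-cases true  _ = inj₁ refl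
∨-cases false e = inj₂ e

∧-split : ∀ a {b} → a ∧ b ≡ true → a ≡ true × b ≡ true
∧-split true e = refl , e

module _ {n} (v : Fin (suc n)) where

  data View : Fin (suc n) → Set where
    here  : View v
    there : ∀ y → View (punchIn v y)

  view : ∀ x → View x
  view x with v Finₚ.≟ x
  ... | yes refl = here
  ... | no ne    = subst View (Finₚ.punchIn-punchOut ne) (there (punchOut ne))

  -- the quotient map of the contraction that merges v into u′
  merge : Fin n → Fin (suc n) → Fin n
  merge u′ x with v Finₚ.≟ x
  ... | yes _ = u′
  ... | no ne = punchOut ne

  merge-v : ∀ u′ → merge u′ v ≡ u′
  merge-v u′ with v Finₚ.≟ v
  ... | yes _ = refl
  ... | no ne = ⊥-elim (ne refl)

  merge-in : ∀ u′ y → merge u′ (punchIn v y) ≡ y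
  merge-in u′ y with v Finₚ.≟ punchIn v y
  ... | yes e = ⊥-elim (Finₚ.punchInᵢ≢i v y (sym e))
  ... | no ne = trans (Finₚ.punchOut-cong v refl) (Finₚ.punchOut-punchIn v)

module Contraction {n} (v : Fin (suc n)) (u′ : Fin n) (G : Graph (suc n)) (simple : IsSimple G)
                   (uv : G (punchIn v u′) v ≡ true) where

  private
    C = contractE v u′ G
    ρ = merge v u′

  vu : G v (punchIn v u′) ≡ true
  vu = trans (proj₁ simple v _) uv

  not-same : ∀ {i j} → i ≢ j → C i j ≡ (G (punchIn v i) (punchIn v j) ∨ (does (i Finₚ.≟ u′) ∧ G v (punchIn v j))
                                        ∨ (does (j Finₚ.≟ u′) ∧ G (punchIn v i) v))
  not-same {i} {j} ne with i Finₚ.≟ j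
  ... | yes e = ⊥-elim (ne e)
  ... | no _  = refl

  diag : ∀ i → C i i ≡ false
  diag i with i Finₚ.≟ i
  ... | yes _ = refl
  ... | no ne = ⊥-elim (ne refl)

  does-refl : ∀ (i : Fin n) → does (i Finₚ.≟ i) ≡ true
  does-refl i with i Finₚ.≟ i
  ... | yes _ = refl
  ... | no ne = ⊥-elim (ne refl)

  does-true : ∀ {i j : Fin n} → does (i Finₚ.≟ j) ≡ true → i ≡ j
  does-true {i} {j} e with i Finₚ.≟ j
  ... | yes p = p

  push-edge : ∀ {x y} → G x y ≡ true → ρ x ≢ ρ y → C (ρ x) (ρ y) ≡ true
  push-edge {x} {y} e ne with view v x | view v y
  ... | here | here = ⊥-elim (ne refl)
  ... | here | there j rewrite merge-v v u′ | merge-in v u′ j | not-same {u′} {j} ne | does-refl u′ | e =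
    Boolₚ.∨-zeroʳ _
  ... | there i | here rewrite merge-v v u′ | merge-in v u′ i | not-same {i} {u′} ne | does-refl u′ | e =
    trans (cong (G (punchIn v i) (punchIn v u′) ∨_) (Boolₚ.∨-zeroʳ _)) (Boolₚ.∨-zeroʳ _)
  ... | there i | there j rewrite merge-in v u′ i | merge-in v u′ j | not-same {i} {j} ne | e = refl

  pull-edge : ∀ {i j} → C i j ≡ true → ∃ λ x → ∃ λ y → ρ x ≡ i × ρ y ≡ j × G x y ≡ true
  pull-edge {i} {j} e with i Finₚ.≟ j
  ... | no ne with ∨-cases (G (punchIn v i) (punchIn v j)) e
  ...   | inj₁ e₁ = punchIn v i , punchIn v j , merge-in v u′ i , merge-in v u′ j , e₁
  ...   | inj₂ e₁ with ∨-cases (does (i Finₚ.≟ u′) ∧ G v (punchIn v j)) e₁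
  ...     | inj₁ e₂ = let p , q = ∧-split (does (i Finₚ.≟ u′)) e₂ in
                      v , punchIn v j , trans (merge-v v u′) (sym (does-true p)) , merge-in v u′ j , q
  ...     | inj₂ e₂ = let p , q = ∧-split (does (j Finₚ.≟ u′)) e₂ in
                      punchIn v i , v , merge-in v u′ i , trans (merge-v v u′) (sym (does-true p)) , q

  -- The only two vertices that are identified are the ends of the contracted edge.
  fibre : ∀ {x y} → ρ x ≡ ρ y → x ≡ y ⊎ G x y ≡ true
  fibre {x} {y} e with view v x | view v y
  ... | here    | here = inj₁ refl
  ... | here    | there j = inj₂ (subst (λ z → G v (punchIn v z) ≡ true) (trans (sym (merge-v v u′)) (trans e (merge-in v u′ j))) vu)
  ... | there i | here    = inj₂ (subst (λ z → G (punchIn v z) v ≡ true) (trans (sym (merge-v v u′)) (trans (sym e) (merge-in v u′ i))) uv)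
  ... | there i | there j = inj₁ (cong (punchIn v) (trans (sym (merge-in v u′ i)) (trans e (merge-in v u′ j))))

  contract-simple : IsSimple C
  contract-simple = symm , diag
    where
    le : ∀ {i j} → C i j ≡ true → C j i ≡ true
    le {i} {j} e with pull-edge e
    ... | x , y , refl , refl , exy =
      push-edge (trans (proj₁ simple y x) exy) λ eq → true≢false e (trans (cong (C (ρ x)) eq) (diag (ρ x)))
    symm : ∀ i j → C i j ≡ C j i
    symm i j with C i j in p | C j i in q
    ... | true  | true  = refl
    ... | false | false = refl
    ... | true  | false = ⊥-elim (true≢false (le p) q)
    ... | false | true  = ⊥-elim (true≢false (le q) p)

  -- An edge of the contraction lifts to an edge that may start at the other end of the contracted
  -- edge; `fibre` bridges the gap without leaving the preimage of P.
  lift-conn : ∀ {P : Fin n → Set} {i j} → Conn C P i j → ∀ {x y} → ρ x ≡ i → ρ y ≡ j → Conn G (P ∘ ρ) x y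
  lift-conn {P} (stop p) {x} {y} refl e with fibre {x} {y} (sym e)
  ... | inj₁ refl = stop p
  ... | inj₂ g    = go p g (stop (subst P (sym e) p))
  lift-conn {P} (go p g c) {x} {y} refl e with pull-edge g
  ... | x′ , y′ , eq , refl , g′ with fibre {x} {x′} (sym eq)
  ...   | inj₁ refl = go p g′ (lift-conn c refl e)
  ...   | inj₂ h    = go p h (go (subst P (sym eq) p) g′ (lift-conn c refl e))

  drop-conn : ∀ {P : Fin (suc n) → Set} {Q : Fin n → Set} → (∀ {x} → P x → Q (ρ x)) →
              ∀ {x y} → Conn G P x y → Conn C Q (ρ x) (ρ y)
  drop-conn h (stop p) = stop (h p)
  drop-conn h (go {x} {y} p e c) with ρ x Finₚ.≟ ρ y
  ... | yes eq = subst (λ z → Conn C _ z _) (sym eq) (drop-conn h c)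
  ... | no ne  = go (h p) (push-edge e ne) (drop-conn h c)

  model-lift : ∀ {m} {H : Graph m} {φ} → Model H C φ → Model H G (φ ∘ ρ)
  model-lift {φ = φ} M = record
    { surj = λ i → let u , e = surj i in punchIn v u , trans (cong φ (merge-in v u′ u)) e
    ; conn = λ p q → lift-conn (conn p q) refl refl
    ; edge-to = λ ne e → let i , j , p , q , g = edge-to ne e in lift p q (pull-edge g)
    ; edge-of = λ ne p q g → edge-of ne p q (push-edge g λ eq → ne (just-injective (trans (sym p) (trans (cong φ eq) q)))) }
    where
    open Model M
    lift : ∀ {a b i j} → φ i ≡ just a → φ j ≡ just b → (∃ λ x → ∃ λ y → ρ x ≡ i × ρ y ≡ j × G x y ≡ true) →
           ∃ λ x → ∃ λ y → φ (ρ x) ≡ just a × φ (ρ y) ≡ just b × G x y ≡ true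
    lift p q (x , y , refl , refl , g) = x , y , p , q , g

  model-drop : ∀ {m} {H : Graph m} {φ} → φ v ≡ φ (punchIn v u′) → Model H G φ → Model H C (φ ∘ punchIn v)
  model-drop {H = H} {φ} eq M = record
    { surj = λ i → let u , e = surj i in ρ u , trans (sym (φ-ρ u)) e
    ; conn = λ {x} {y} {i} p q → subst₂ (Conn C (λ w → φ (punchIn v w) ≡ just i)) (merge-in v u′ x) (merge-in v u′ y)
        (drop-conn (λ {z} r → trans (sym (φ-ρ z)) r) (conn p q))
    ; edge-to = λ ne e → let x , y , p , q , g = edge-to ne e
                             p′ = trans (sym (φ-ρ x)) p ; q′ = trans (sym (φ-ρ y)) q in
        ρ x , ρ y , p′ , q′ , push-edge g λ eq → ne (just-injective (trans (sym p′) (trans (cong (φ ∘ punchIn v) eq) q′)))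
    ; edge-of = λ ne p q g → drop-edge ne p q (pull-edge g) }
    where
    open Model M
    φ-ρ : ∀ x → φ x ≡ φ (punchIn v (ρ x))
    φ-ρ x with view v x
    ... | here    = trans eq (cong (φ ∘ punchIn v) (sym (merge-v v u′)))
    ... | there y = cong (φ ∘ punchIn v) (sym (merge-in v u′ y))
    drop-edge : ∀ {a b i j} → a ≢ b → φ (punchIn v i) ≡ just a → φ (punchIn v j) ≡ just b →
                (∃ λ x → ∃ λ y → ρ x ≡ i × ρ y ≡ j × G x y ≡ true) → H a b ≡ true
    drop-edge ne p q (x , y , refl , refl , g) = edge-of ne (trans (φ-ρ x) p) (trans (φ-ρ y) q) g

module Deletion {n} (v : Fin (suc n)) (G : Graph (suc n)) where

  extend : ∀ {m} → (Fin n → Maybe (Fin m)) → Fin (suc n) → Maybe (Fin m)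
  extend φ x with v Finₚ.≟ x
  ... | yes _ = nothing
  ... | no ne = φ (punchOut ne)

  extend-in : ∀ {m} (φ : Fin n → Maybe (Fin m)) y → extend φ (punchIn v y) ≡ φ y
  extend-in φ y with v Finₚ.≟ punchIn v y
  ... | yes e = ⊥-elim (Finₚ.punchInᵢ≢i v y (sym e))
  ... | no ne = cong φ (trans (Finₚ.punchOut-cong v refl) (Finₚ.punchOut-punchIn v))

  extend-v : ∀ {m} (φ : Fin n → Maybe (Fin m)) → extend φ v ≡ nothing
  extend-v φ with v Finₚ.≟ v
  ... | yes _ = refl
  ... | no ne = ⊥-elim (ne refl)

  model-extend : ∀ {m} {H : Graph m} {φ} → Model H (deleteV v G) φ → Model H G (extend φ)
  model-extend {H = H} {φ} M = record
    { surj = λ i → let u , e = surj i in punchIn v u , trans (extend-in φ u) e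
    ; conn = λ {x} {y} → lift (view v x) (view v y)
    ; edge-to = λ ne e → let x , y , p , q , g = edge-to ne e in
        punchIn v x , punchIn v y , trans (extend-in φ x) p , trans (extend-in φ y) q , g
    ; edge-of = λ {i} {j} {x} {y} ne → drop-edge ne (view v x) (view v y) }
    where
    open Model M
    absurd : ∀ {i} → extend φ v ≡ just i → ⊥
    absurd p with () ← trans (sym (extend-v φ)) p
    lift-conn : ∀ {i x y} → Conn (deleteV v G) (λ w → φ w ≡ just i) x y →
                Conn G (λ w → extend φ w ≡ just i) (punchIn v x) (punchIn v y)
    lift-conn {x = x} (stop p)   = stop (trans (extend-in φ x) p)
    lift-conn {x = x} (go p e c) = go (trans (extend-in φ x) p) e (lift-conn c)
    lift : ∀ {x y i} → View v x → View v y → extend φ x ≡ just i → extend φ y ≡ just i →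
           Conn G (λ w → extend φ w ≡ just i) x y
    lift here      _         p q = ⊥-elim (absurd p)
    lift (there x) here      p q = ⊥-elim (absurd q)
    lift (there x) (there y) p q = lift-conn (conn (trans (sym (extend-in φ x)) p) (trans (sym (extend-in φ y)) q))
    drop-edge : ∀ {i j x y} → i ≢ j → View v x → View v y → extend φ x ≡ just i → extend φ y ≡ just j →
                G x y ≡ true → H i j ≡ true
    drop-edge ne here      _         p q g = ⊥-elim (absurd p)
    drop-edge ne (there x) here      p q g = ⊥-elim (absurd q)
    drop-edge ne (there x) (there y) p q g = edge-of ne (trans (sym (extend-in φ x)) p) (trans (sym (extend-in φ y)) q) g

  model-restrict : ∀ {m} {H : Graph m} {φ} → φ v ≡ nothing → Model H G φ → Model H (deleteV v G) (φ ∘ punchIn v)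
  model-restrict {H = H} {φ} none M = record
    { surj = λ i → let u , e = surj i in found (view v u) e
    ; conn = λ {x} {y} p q → drop-conn refl refl (conn p q)
    ; edge-to = λ ne e → let x , y , p , q , g = edge-to ne e in drop-edge (view v x) (view v y) p q g
    ; edge-of = edge-of }
    where
    open Model M
    absurd : ∀ {i} → φ v ≡ just i → ⊥
    absurd p with () ← trans (sym none) p
    found : ∀ {x i} → View v x → φ x ≡ just i → ∃ λ u → φ (punchIn v u) ≡ just i
    found here      e = ⊥-elim (absurd e)
    found (there y) e = y , e
    drop-conn : ∀ {i x y a b} → punchIn v x ≡ a → punchIn v y ≡ b → Conn G (λ w → φ w ≡ just i) a b →
                Conn (deleteV v G) (λ w → φ (punchIn v w) ≡ just i) x y
    drop-conn {x = x} {y} ea eb (stop p) =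
      subst (Conn (deleteV v G) _ x) (Finₚ.punchIn-injective v x y (trans ea (sym eb))) (stop (trans (cong φ ea) p))
    drop-conn {x = x} refl eb (go {v = w} p e c) with view v w
    ... | here    = ⊥-elim (absurd (conn-source c))
    ... | there z = go p e (drop-conn refl eb c)
    drop-edge : ∀ {x y i j} → View v x → View v y → φ x ≡ just i → φ y ≡ just j → G x y ≡ true →
                ∃ λ u → ∃ λ w → φ (punchIn v u) ≡ just i × φ (punchIn v w) ≡ just j × G (punchIn v u) (punchIn v w) ≡ true
    drop-edge here      _         p q g = ⊥-elim (absurd p)
    drop-edge (there x) here      p q g = ⊥-elim (absurd q)
    drop-edge (there x) (there y) p q g = x , y , p , q , g

delete-simple : ∀ {n} {G : Graph (suc n)} (v : Fin (suc n)) → IsSimple G → IsSimple (deleteV v G)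
delete-simple v (s , i) = (λ x y → s _ _) , λ x → i _

≼⇒Model : ∀ {m n} {H : Graph m} {G : Graph n} → IsSimple G → H ≼ G → ∃ (Model H G)
≼⇒Model {H = H} {G} simple (im-iso (f , pres)) = just ∘ Inverse.from f , record
  { surj = λ i → to i , cong just (Inverse.strictlyInverseʳ f i)
  ; conn = λ {u} {v} p q → subst (Conn G _ u) (trans (trans (sym (to-from u))
      (cong to (just-injective (trans p (sym q))))) (to-from v)) (stop p)
  ; edge-to = λ {i} {j} ne e → to i , to j , cong just (Inverse.strictlyInverseʳ f i) , cong just (Inverse.strictlyInverseʳ f j) ,
      trans (sym (pres i j)) e
  ; edge-of = λ {i} {j} {u} {v} ne p q g → trans (pres i j) (trans (cong₂ G
      (trans (cong to (sym (just-injective p))) (to-from u)) (trans (cong to (sym (just-injective q))) (to-from v))) g) }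
  where
  to = Inverse.to f
  to-from = Inverse.strictlyInverseˡ f
≼⇒Model {G = G} simple (im-del v r) =
  let φ , M = ≼⇒Model (delete-simple v simple) r in Deletion.extend v G φ , Deletion.model-extend v G M
≼⇒Model {G = G} simple (im-con v u′ e r) =
  let open Contraction v u′ G simple e
      φ , M = ≼⇒Model contract-simple r in φ ∘ merge v u′ , model-lift M

module _ {m} {H : Graph m} (H-simple : IsSimple H) where

  private
    _≟ₘ_ : (x y : Maybe (Fin m)) → Dec (x ≡ y)
    _≟ₘ_ = Maybeₚ.≡-dec Finₚ._≟_

  first-edge : ∀ {n} {G : Graph n} {P : Fin n → Set} {u v} → u ≢ v → Conn G P u v → ∃ λ w → P w × G u w ≡ true
  first-edge ne (stop _)   = ⊥-elim (ne refl)
  first-edge ne (go _ e c) = _ , conn-source c , e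

  -- An unlabelled vertex can be deleted, and a bag with two vertices contains an edge that can be
  -- contracted. When neither occurs, the labelling is a bijection, and the edge conditions make it
  -- an isomorphism.
  Model⇒≼ : ∀ {n} {G : Graph n} {φ} → IsSimple G → Model H G φ → H ≼ G
  Model⇒≼ {n} {G} {φ} simple M with Finₚ.any? (λ v → φ v ≟ₘ nothing)
  Model⇒≼ {suc n} {G} simple M | yes (v , none) =
    im-del v (Model⇒≼ (delete-simple v simple) (Deletion.model-restrict v G none M))
  Model⇒≼ {n} {G} {φ} simple M | no total
    with Finₚ.any? (λ u → Finₚ.any? (λ w → ¬? (u Finₚ.≟ w) ×-dec (φ u ≟ₘ φ w)))
  Model⇒≼ {suc n} {G} {φ} simple M | no total | yes (u , w , u≢w , eq) with φ u in φu
  ... | nothing = ⊥-elim (total (u , φu))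
  ... | just i with first-edge u≢w (Model.conn M φu (sym eq))
  ...   | v , φv , g = im-con v u′ e (Model⇒≼ contract-simple (model-drop (trans φv (sym (trans (cong φ u≡) φu))) M))
    where
    v≢u : v ≢ u
    v≢u refl = true≢false g (proj₂ simple v)
    u′ = punchOut v≢u
    u≡ : punchIn v u′ ≡ u
    u≡ = Finₚ.punchIn-punchOut v≢u
    e : G (punchIn v u′) v ≡ true
    e = trans (cong (λ x → G x v) u≡) g
    open Contraction v u′ G simple e
  Model⇒≼ {n} {G} {φ} simple M | no total | no inj = im-iso (mk↔ₛ′ to from to-from from-to , pres)
    where
    open Model M
    to : Fin m → Fin n
    to i = proj₁ (surj i)
    labelled : ∀ u → ∃ λ i → φ u ≡ just i
    labelled u with φ u in eq
    ... | just i  = i , refl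
    ... | nothing = ⊥-elim (total (u , eq))
    from : Fin n → Fin m
    from u = proj₁ (labelled u)
    φ-inj : ∀ {u w i} → φ u ≡ just i → φ w ≡ just i → u ≡ w
    φ-inj {u} {w} p q with u Finₚ.≟ w
    ... | yes e = e
    ... | no ne = ⊥-elim (inj (u , w , ne , trans p (sym q)))
    to-from : ∀ u → to (from u) ≡ u
    to-from u = φ-inj (proj₂ (surj (from u))) (proj₂ (labelled u))
    from-to : ∀ i → from (to i) ≡ i
    from-to i = just-injective (trans (sym (proj₂ (labelled (to i)))) (proj₂ (surj i)))
    pres : ∀ i j → H i j ≡ G (to i) (to j)
    pres i j with i Finₚ.≟ j
    ... | yes refl = trans (proj₂ H-simple i) (sym (proj₂ simple (to i)))
    ... | no ne with H i j in h | G (to i) (to j) in g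
    ...   | true  | true  = refl
    ...   | false | false = refl
    ...   | false | true  = trans (sym h) (edge-of ne (proj₂ (surj i)) (proj₂ (surj j)) g)
    ...   | true  | false =
      let u , w , p , q , e = edge-to ne h in
      trans (sym e) (trans (cong₂ G (φ-inj p (proj₂ (surj i))) (φ-inj q (proj₂ (surj j)))) g)

F₂-simple : IsSimple F₂
F₂-simple = (λ i j → Boolₚ.∨-comm (F₂edge (toℕ i) (toℕ j)) (F₂edge (toℕ j) (toℕ i))) ,
  λ { zero → refl ; (suc zero) → refl ; (suc (suc zero)) → refl ; (suc (suc (suc zero))) → refl
    ; (suc (suc (suc (suc zero)))) → refl }

pattern b₁ = zero
pattern b₂ = suc zero
pattern b₃ = suc (suc zero)
pattern b₄ = suc (suc (suc zero))
pattern b₅ = suc (suc (suc (suc zero)))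

-- Connected vertex sets, components and non-cut vertices

module Sets {n} (G : Graph n) (simple : IsSimple G) where

  V : Set
  V = Fin n

  E : V → V → Set
  E u v = G u v ≡ true

  E? : ∀ u v → Dec (E u v)
  E? u v = G u v Boolₚ.≟ true

  E-sym : ∀ {u v} → E u v → E v u
  E-sym {u} {v} e = trans (proj₁ simple v u) e

  E-irrefl : ∀ {u} → E u u → ⊥
  E-irrefl {u} e = true≢false e (proj₂ simple u)

  Decidable Connected : (V → Set) → Set
  Decidable P = ∀ u → Dec (P u)
  Connected P = ∀ {u v} → P u → P v → Conn G P u v

  infixr 6 _∪_ _∪?_
  infixl 7 _∖_ _∖?_

  _∪_ : (V → Set) → (V → Set) → V → Set
  (P ∪ Q) u = P u ⊎ Q u

  _∖_ : (V → Set) → V → V → Set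
  (P ∖ l) u = P u × u ≢ l

  ⟨_⟩ : V → V → Set
  ⟨ l ⟩ u = u ≡ l

  _∪?_ : ∀ {P Q} → Decidable P → Decidable Q → Decidable (P ∪ Q)
  (P? ∪? Q?) u = P? u ⊎-dec Q? u

  _∖?_ : ∀ {P} → Decidable P → ∀ l → Decidable (P ∖ l)
  (P? ∖? l) u = P? u ×-dec ¬? (u Finₚ.≟ l)

  ⟨_⟩? : ∀ l → Decidable ⟨ l ⟩
  ⟨ l ⟩? u = u Finₚ.≟ l

  Touch Disj Far Near : (V → Set) → (V → Set) → Set
  Touch P Q = ∃ λ u → ∃ λ v → P u × Q v × E u v
  Disj P Q = ∀ {u} → P u → Q u → ⊥
  Far P Q = Disj P Q × (∀ {u v} → P u → Q v → E u v → ⊥)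
  Near P Q = Disj P Q × Touch P Q

  AdjTo : (V → Set) → V → Set
  AdjTo P u = ∃ λ p → P p × E u p

  adjTo? : ∀ {P} → Decidable P → Decidable (AdjTo P)
  adjTo? P? u = Finₚ.any? λ p → P? p ×-dec E? u p

  touch? : ∀ {P Q} → Decidable P → Decidable Q → Dec (Touch P Q)
  touch? P? Q? = Finₚ.any? λ u → Finₚ.any? λ v → P? u ×-dec (Q? v ×-dec E? u v)

  touch-sym : ∀ {P Q} → Touch P Q → Touch Q P
  touch-sym (u , v , p , q , e) = v , u , q , p , E-sym e

  touch-mono : ∀ {P P′ Q Q′ : V → Set} → (∀ {u} → P u → P′ u) → (∀ {u} → Q u → Q′ u) → Touch P Q → Touch P′ Q′
  touch-mono f g (u , v , p , q , e) = u , v , f p , g q , e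

  far-sym : ∀ {P Q} → Far P Q → Far Q P
  far-sym (d , f) = (λ q p → d p q) , λ q p e → f p q (E-sym e)

  near-sym : ∀ {P Q} → Near P Q → Near Q P
  near-sym (d , t) = (λ q p → d p q) , touch-sym t

  far-mono : ∀ {P P′ Q Q′ : V → Set} → (∀ {u} → P′ u → P u) → (∀ {u} → Q′ u → Q u) → Far P Q → Far P′ Q′
  far-mono f g (d , h) = (λ p q → d (f p) (g q)) , λ p q → h (f p) (g q)

  far-∪ : ∀ {P P′ Q} → Far P Q → Far P′ Q → Far (P ∪ P′) Q
  far-∪ (d , f) (d′ , f′) = (λ { (inj₁ p) q → d p q ; (inj₂ p) q → d′ p q }) ,
                            λ { (inj₁ p) q e → f p q e ; (inj₂ p) q e → f′ p q e }

  near-∪ˡ : ∀ {P P′ Q} → Near P Q → Disj P′ Q → Near (P ∪ P′) Q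
  near-∪ˡ (d , t) d′ = (λ { (inj₁ p) q → d p q ; (inj₂ p) q → d′ p q }) , touch-mono inj₁ id t

  untouched : ∀ {P Q} → Disj P Q → ¬ Touch P Q → Far P Q
  untouched d ¬t = d , λ p q e → ¬t (_ , _ , p , q , e)

  conn-∪ : ∀ {P Q} → Connected P → Connected Q → Touch P Q → Connected (P ∪ Q)
  conn-∪ cP cQ (a , b , pa , qb , e) = λ where
    (inj₁ p) (inj₁ p′) → conn-map inj₁ (cP p p′)
    (inj₂ q) (inj₂ q′) → conn-map inj₂ (cQ q q′)
    (inj₁ p) (inj₂ q)  → conn-trans (conn-map inj₁ (cP p pa)) (go (inj₁ pa) e (conn-map inj₂ (cQ qb q)))
    (inj₂ q) (inj₁ p)  → conn-trans (conn-map inj₂ (cQ q qb)) (go (inj₂ qb) (E-sym e) (conn-map inj₁ (cP pa p)))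

  conn-⟨⟩ : ∀ {l} → Connected ⟨ l ⟩
  conn-⟨⟩ refl refl = stop refl

  count : ∀ {P} → Decidable P → List V → ℕ
  count P? []       = 0
  count P? (x ∷ xs) = (if does (P? x) then 1 else 0) + count P? xs

  count-mono : ∀ {P Q} (P? : Decidable P) (Q? : Decidable Q) → (∀ {u} → P u → Q u) → ∀ xs → count P? xs ≤ count Q? xs
  count-mono P? Q? f []       = z≤n
  count-mono P? Q? f (x ∷ xs) with P? x | Q? x
  ... | yes p | yes q = s≤s (count-mono P? Q? f xs)
  ... | yes p | no ¬q = ⊥-elim (¬q (f p))
  ... | no ¬p | yes q = m≤n⇒m≤1+n (count-mono P? Q? f xs)
  ... | no ¬p | no ¬q = count-mono P? Q? f xs

  count-strict : ∀ {P Q} (P? : Decidable P) (Q? : Decidable Q) → (∀ {u} → P u → Q u) → ∀ {l} → Q l → ¬ P l →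
                 ∀ {xs} → l ∈ xs → count P? xs < count Q? xs
  count-strict P? Q? f ql ¬pl {x ∷ xs} (here refl) with P? x | Q? x
  ... | yes p | _     = ⊥-elim (¬pl p)
  ... | no ¬p | yes q = s≤s (count-mono P? Q? f xs)
  ... | no ¬p | no ¬q = ⊥-elim (¬q ql)
  count-strict P? Q? f ql ¬pl {x ∷ xs} (there l∈) with P? x | Q? x
  ... | yes p | yes q = s≤s (count-strict P? Q? f ql ¬pl l∈)
  ... | yes p | no ¬q = ⊥-elim (¬q (f p))
  ... | no ¬p | yes q = m≤n⇒m≤1+n (count-strict P? Q? f ql ¬pl l∈)
  ... | no ¬p | no ¬q = count-strict P? Q? f ql ¬pl l∈

  size : ∀ {P} → Decidable P → ℕ
  size P? = count P? (allFin n)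

  size-strict : ∀ {P Q} (P? : Decidable P) (Q? : Decidable Q) → (∀ {u} → P u → Q u) → ∀ {l} → Q l → ¬ P l →
                size P? < size Q?
  size-strict P? Q? f {l} ql ¬pl = count-strict P? Q? f ql ¬pl (∈-allFin l)

  _∖∖?_ : ∀ {P Q} → Decidable P → Decidable Q → Decidable (λ u → P u × ¬ Q u)
  (P? ∖∖? Q?) u = P? u ×-dec ¬? (Q? u)

  -- The set is given by closure under neighbours in P and not by reachability, so that membership
  -- is decidable from its construction.
  record Component (P : V → Set) (u : V) : Set₁ where
    field
      set      : V → Set
      set?     : Decidable set
      within : ∀ {v} → set v → P v
      root   : set u
      conn   : Connected set
      closed : ∀ {x y} → set x → P y → E x y → set y

    complete : ∀ {x y} → set x → Conn G P x y → set y
    complete s (stop _)   = s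
    complete s (go _ e c) = complete (closed s (conn-source c) e) c

  component : ∀ {P} → Decidable P → ∀ {u} → P u → Component P u
  component {P} P? {u} pu = grow (size (P? ∖∖? ⟨ u ⟩?)) ⟨ u ⟩? (λ { refl → pu }) refl conn-⟨⟩ ≤-refl
    where
    grow : ∀ k {set} (set? : Decidable set) → (∀ {v} → set v → P v) → set u → Connected set →
           size (P? ∖∖? set?) ≤ k → Component P u
    grow k {set} set? sub su cS le with Finₚ.any? (λ x → Finₚ.any? λ y → set? x ×-dec (P? y ×-dec (¬? (set? y) ×-dec E? x y)))
    ... | no none = record { set = set ; set? = set? ; within = sub ; root = su ; conn = cS ; closed = closed }
      where
      closed : ∀ {x y} → set x → P y → E x y → set y
      closed {x} {y} sx py e with set? y
      ... | yes sy = sy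
      ... | no ¬sy = ⊥-elim (none (x , y , sx , py , ¬sy , e))
    grow zero {set} set? sub su cS le | yes (x , y , sx , py , ¬sy , e) =
      ⊥-elim (n≮0 (<-≤-trans (size-strict (λ _ → no id) (P? ∖∖? set?) ⊥-elim (py , ¬sy) id) le))
    grow (suc k) {set} set? sub su cS le | yes (x , y , sx , py , ¬sy , e) =
      grow k (set? ∪? ⟨ y ⟩?) (λ { (inj₁ s) → sub s ; (inj₂ refl) → py }) (inj₁ su)
        (conn-∪ cS conn-⟨⟩ (x , y , sx , refl , e))
        (s≤s⁻¹ (≤-trans (size-strict (P? ∖∖? (set? ∪? ⟨ y ⟩?)) (P? ∖∖? set?) (λ (p , ¬s) → p , ¬s ∘ inj₁) (py , ¬sy)
          (λ (_ , ¬s) → ¬s (inj₂ refl))) le))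

  leaving : ∀ {X P : V → Set} → Decidable P → ∀ {u v} → Conn G X u v → P u → ¬ P v →
            ∃ λ x → ∃ λ y → P x × X y × ¬ P y × E x y
  leaving P? (stop _) p ¬p = ⊥-elim (¬p p)
  leaving P? (go {v = w} _ e c) p ¬p with P? w
  ... | yes pw = leaving P? c pw ¬p
  ... | no ¬pw = _ , w , p , conn-source c , ¬pw , e

  -- Growing a connected subset of X from r one vertex at a time, the last vertex
  -- added is not a cut vertex.
  noncut : ∀ {X} → Decidable X → Connected X → ∀ {r s} → X r → X s → s ≢ r →
           ∃ λ l → X l × l ≢ r × Connected (X ∖ l)
  noncut {X} X? cX {r} {s} xr xs s≢r = grow (size (X? ∖∖? ⟨ r ⟩?)) ⟨ r ⟩? (λ { refl → xr }) refl conn-⟨⟩ xs s≢r ≤-refl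
    where
    grow : ∀ k {P} (P? : Decidable P) → (∀ {v} → P v → X v) → P r → Connected P → ∀ {s} → X s → ¬ P s →
           size (X? ∖∖? P?) ≤ k → ∃ λ l → X l × l ≢ r × Connected (X ∖ l)
    grow k {P} P? sub pr cP xs ¬ps le with leaving P? (cX xr xs) pr ¬ps
    ... | x , y , px , xy , ¬py , e with Finₚ.any? (λ t → X? t ×-dec (¬? (P? t) ×-dec ¬? (t Finₚ.≟ y)))
    ... | no none = y , xy , (λ { refl → ¬py pr }) ,
      λ (xu , u≢y) (xv , v≢y) → conn-map (λ p → sub p , λ { refl → ¬py p }) (cP (all xu u≢y) (all xv v≢y))
      where
      all : ∀ {u} → X u → u ≢ y → P u
      all {u} xu u≢y with P? u
      ... | yes p = p
      ... | no ¬p = ⊥-elim (none (u , xu , ¬p , u≢y))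
    grow zero {P} P? sub pr cP xs ¬ps le | x , y , px , xy , ¬py , e | yes _ =
      ⊥-elim (n≮0 (<-≤-trans (size-strict (λ _ → no id) (X? ∖∖? P?) ⊥-elim (xy , ¬py) id) le))
    grow (suc k) {P} P? sub pr cP xs ¬ps le | x , y , px , xy , ¬py , e | yes (t , xt , ¬pt , t≢y) =
      grow k (P? ∪? ⟨ y ⟩?) (λ { (inj₁ s) → sub s ; (inj₂ refl) → xy }) (inj₁ pr)
        (conn-∪ cP conn-⟨⟩ (x , y , px , refl , e)) xt (λ { (inj₁ p) → ¬pt p ; (inj₂ q) → t≢y q })
        (s≤s⁻¹ (≤-trans (size-strict (X? ∖∖? (P? ∪? ⟨ y ⟩?)) (X? ∖∖? P?) (λ (p , ¬s) → p , ¬s ∘ inj₁) (xy , ¬py)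
          (λ (_ , ¬s) → ¬s (inj₂ refl))) le))

  record Interior (X : V → Set) (a b : V) : Set₁ where
    field
      set     : V → Set
      set?    : Decidable set
      conn  : Connected set
      sub   : ∀ {u} → set u → X u × u ≢ a × u ≢ b
      near₁ : Touch set ⟨ a ⟩
      near₂ : Touch set ⟨ b ⟩

  record Tail (X : V → Set) (a b u : V) : Set₁ where
    field
      set  : V → Set
      set? : Decidable set
      conn : Connected set
      sub  : ∀ {u} → set u → X u × u ≢ a × u ≢ b
      at-u : set u
      near : Touch set ⟨ b ⟩

  -- The walk is read from its end. The stretch since the most recently read visit to b avoids both
  -- a and b, and it becomes an interior once a is met; non-adjacency excludes that a directly
  -- precedes b.
  tail-scan : ∀ {X a b u} → ¬ E a b → Conn G X u b → u ≡ b ⊎ (Tail X a b u ⊎ Interior X a b)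
  tail-scan ¬ab (stop _) = inj₁ refl
  tail-scan {X} {a} {b} {u} ¬ab (go xu e c) with tail-scan {a = a} ¬ab c | u Finₚ.≟ a | u Finₚ.≟ b
  ... | _                | _        | yes u≡b = inj₁ u≡b
  ... | inj₂ (inj₂ I)    | _        | no _    = inj₂ (inj₂ I)
  ... | inj₁ refl        | yes refl | no _    = ⊥-elim (¬ab e)
  ... | inj₁ refl        | no u≢a   | no u≢b  = inj₂ (inj₁ (record
    { set = ⟨ u ⟩ ; set? = ⟨ u ⟩? ; conn = conn-⟨⟩ ; sub = λ { refl → xu , u≢a , u≢b } ; at-u = refl
    ; near = u , b , refl , refl , e }))
  ... | inj₂ (inj₁ t)    | yes refl | no u≢b  = inj₂ (inj₂ (record
    { set = set ; set? = set? ; conn = conn ; sub = sub ; near₁ = _ , a , at-u , refl , E-sym e ; near₂ = near }))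
    where open Tail t
  ... | inj₂ (inj₁ t)    | no u≢a   | no u≢b  = inj₂ (inj₁ (record
    { set = set ∪ ⟨ u ⟩ ; set? = set? ∪? ⟨ u ⟩? ; conn = conn-∪ conn conn-⟨⟩ (_ , u , at-u , refl , E-sym e)
    ; sub = λ { (inj₁ s) → sub s ; (inj₂ refl) → xu , u≢a , u≢b } ; at-u = inj₂ refl ; near = touch-mono inj₁ id near }))
    where open Tail t

  interior : ∀ {X a b} → Connected X → X a → X b → a ≢ b → ¬ E a b → Interior X a b
  interior cX xa xb a≢b ¬ab with tail-scan ¬ab (cX xa xb)
  ... | inj₁ a≡b       = ⊥-elim (a≢b a≡b)
  ... | inj₂ (inj₁ t)  = ⊥-elim (proj₁ (proj₂ (Tail.sub t (Tail.at-u t))) refl)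
  ... | inj₂ (inj₂ I)  = I

-- Shrinking the bags of 2 and 5

-- Induced minor models of F₂, with bags W, X, B, C, Y for the vertices 1, 2, 3, 4, 5.
module Bags {n} (G : Graph n) (simple : IsSimple G) where

  open Sets G simple

  record FModel : Set₁ where
    field
      {W X Y B C} : V → Set
      W? : Decidable W
      X? : Decidable X
      Y? : Decidable Y
      B? : Decidable B
      C? : Decidable C
      cW : Connected W
      cX : Connected X
      cY : Connected Y
      cB : Connected B
      cC : Connected C
      WX : Near W X
      WY : Near W Y
      XB : Near X B
      XC : Near X C
      YB : Near Y B
      YC : Near Y C
      BC : Near B C
      XY : Far X Y
      WB : Far W B
      WC : Far W C

  -- Together with `swapBC` this is a symmetry of F₂: 2 and 5 can be exchanged, and so can 3 and 4.
  swapXY : FModel → FModel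
  swapXY M = record
    { W? = W? ; X? = Y? ; Y? = X? ; B? = B? ; C? = C? ; cW = cW ; cX = cY ; cY = cX ; cB = cB ; cC = cC
    ; WX = WY ; WY = WX ; XB = YB ; XC = YC ; YB = XB ; YC = XC ; BC = BC ; XY = far-sym XY ; WB = WB ; WC = WC }
    where open FModel M

  swapBC : FModel → FModel
  swapBC M = record
    { W? = W? ; X? = X? ; Y? = Y? ; B? = C? ; C? = B? ; cW = cW ; cX = cX ; cY = cY ; cB = cC ; cC = cB
    ; WX = WX ; WY = WY ; XB = XC ; XC = XB ; YB = YC ; YC = YB ; BC = near-sym BC ; XY = XY ; WB = WC ; WC = WB }
    where open FModel M

  Model⇒FModel : ∀ {φ} → Model F₂ G φ → FModel
  Model⇒FModel {φ} M = record
    { W? = bag? b₁ ; X? = bag? b₂ ; B? = bag? b₃ ; C? = bag? b₄ ; Y? = bag? b₅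
    ; cW = conn ; cX = conn ; cB = conn ; cC = conn ; cY = conn
    ; WX = near (λ ()) refl ; WY = near (λ ()) refl ; XB = near (λ ()) refl ; XC = near (λ ()) refl
    ; YB = near (λ ()) refl ; YC = near (λ ()) refl ; BC = near (λ ()) refl
    ; XY = far (λ ()) refl ; WB = far (λ ()) refl ; WC = far (λ ()) refl }
    where
    open Model M
    bag : Fin 5 → V → Set
    bag i u = φ u ≡ just i
    bag? : ∀ i → Decidable (bag i)
    bag? i u = Maybeₚ.≡-dec Finₚ._≟_ (φ u) (just i)
    disj : ∀ {i j} → i ≢ j → Disj (bag i) (bag j)
    disj ne p q = ne (just-injective (trans (sym p) q))
    near : ∀ {i j} → i ≢ j → F₂ i j ≡ true → Near (bag i) (bag j)
    near ne e = disj ne , edge-to ne e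
    far : ∀ {i j} → i ≢ j → F₂ i j ≡ false → Far (bag i) (bag j)
    far ne e = disj ne , λ p q g → true≢false (edge-of ne p q g) e

  FModel⇒Model : FModel → ∃ (Model F₂ G)
  FModel⇒Model M = φ , record
    { surj = λ i → let u , p = inhabited i in u , label p
    ; conn = λ {u} {v} {i} p q → conn-map label (connected i (unlabel p) (unlabel q))
    ; edge-to = λ {i} {j} ne e → touching (F₂ i j) refl e ne
    ; edge-of = λ {i} {j} ne p q g → adjacent (F₂ i j) refl ne (unlabel p) (unlabel q) g }
    where
    open FModel M
    bag : Fin 5 → V → Set
    bag b₁ = W
    bag b₂ = X
    bag b₃ = B
    bag b₄ = C
    bag b₅ = Y
    bag? : ∀ i → Decidable (bag i)
    bag? b₁ = W?
    bag? b₂ = X?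
    bag? b₃ = B?
    bag? b₄ = C?
    bag? b₅ = Y?
    connected : ∀ i → Connected (bag i)
    connected b₁ = cW
    connected b₂ = cX
    connected b₃ = cB
    connected b₄ = cC
    connected b₅ = cY
    Related : Bool → (V → Set) → (V → Set) → Set
    Related true  P Q = Near P Q
    Related false P Q = Far P Q
    related : ∀ i j → i ≢ j → Related (F₂ i j) (bag i) (bag j)
    related b₁ b₁ ne = ⊥-elim (ne refl)
    related b₁ b₂ ne = WX
    related b₁ b₃ ne = WB
    related b₁ b₄ ne = WC
    related b₁ b₅ ne = WY
    related b₂ b₁ ne = near-sym WX
    related b₂ b₂ ne = ⊥-elim (ne refl)
    related b₂ b₃ ne = XB
    related b₂ b₄ ne = XC
    related b₂ b₅ ne = XY
    related b₃ b₁ ne = far-sym WB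
    related b₃ b₂ ne = near-sym XB
    related b₃ b₃ ne = ⊥-elim (ne refl)
    related b₃ b₄ ne = BC
    related b₃ b₅ ne = near-sym YB
    related b₄ b₁ ne = far-sym WC
    related b₄ b₂ ne = near-sym XC
    related b₄ b₃ ne = near-sym BC
    related b₄ b₄ ne = ⊥-elim (ne refl)
    related b₄ b₅ ne = near-sym YC
    related b₅ b₁ ne = near-sym WY
    related b₅ b₂ ne = far-sym XY
    related b₅ b₃ ne = YB
    related b₅ b₄ ne = YC
    related b₅ b₅ ne = ⊥-elim (ne refl)
    disjoint : ∀ b {P Q} → Related b P Q → Disj P Q
    disjoint true  = proj₁
    disjoint false = proj₁
    inhabited : ∀ i → ∃ (bag i)
    inhabited b₁ = let u , _ , p , _ = proj₂ WX in u , p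
    inhabited b₂ = let u , _ , p , _ = proj₂ XB in u , p
    inhabited b₃ = let u , _ , p , _ = proj₂ BC in u , p
    inhabited b₄ = let _ , u , _ , p , _ = proj₂ BC in u , p
    inhabited b₅ = let u , _ , p , _ = proj₂ YB in u , p
    φ : V → Maybe (Fin 5)
    φ u with Finₚ.any? (λ i → bag? i u)
    ... | yes (i , _) = just i
    ... | no _        = nothing
    unlabel : ∀ {u i} → φ u ≡ just i → bag i u
    unlabel {u} e with Finₚ.any? (λ i → bag? i u)
    unlabel refl | yes (i , p) = p
    label : ∀ {u i} → bag i u → φ u ≡ just i
    label {u} {i} p with Finₚ.any? (λ i → bag? i u)
    ... | no none = ⊥-elim (none (i , p))
    ... | yes (j , q) with i Finₚ.≟ j
    ...   | yes refl = refl
    ...   | no ne    = ⊥-elim (disjoint (F₂ i j) (related i j ne) p q)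
    touching : ∀ {i j} b → F₂ i j ≡ b → b ≡ true → i ≢ j → ∃ λ u → ∃ λ v → φ u ≡ just i × φ v ≡ just j × G u v ≡ true
    touching {i} {j} b eq refl ne =
      let u , v , p , q , e = proj₂ (subst (λ b → Related b (bag i) (bag j)) eq (related i j ne)) in u , v , label p , label q , e
    adjacent : ∀ {i j u v} b → F₂ i j ≡ b → i ≢ j → bag i u → bag j v → G u v ≡ true → F₂ i j ≡ true
    adjacent true  eq ne p q e = eq
    adjacent {i} {j} false eq ne p q e =
      ⊥-elim (proj₂ (subst (λ b → Related b (bag i) (bag j)) eq (related i j ne)) p q e)

  Small : (V → Set) → Set
  Small P = ∃ λ a → ∃ λ b → P a × P b × (∀ {u} → P u → u ≡ a ⊎ u ≡ b) × (a ≡ b ⊎ E a b)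

  small-⟨⟩ : ∀ {l} → Small ⟨ l ⟩
  small-⟨⟩ {l} = l , l , refl , refl , inj₁ , inj₁ refl

  module Moves (M : FModel) where
    open FModel M

    restrictX : ∀ {X′ : V → Set} → Decidable X′ → Connected X′ → (∀ {u} → X′ u → X u) →
                Touch W X′ → Touch X′ B → Touch X′ C → FModel
    restrictX {X′} X′? cX′ sub tW tB tC = record
      { W? = W? ; X? = X′? ; Y? = Y? ; B? = B? ; C? = C? ; cW = cW ; cX = cX′ ; cY = cY ; cB = cB ; cC = cC
      ; WX = (λ w x → proj₁ WX w (sub x)) , tW ; WY = WY
      ; XB = (λ x b → proj₁ XB (sub x) b) , tB ; XC = (λ x c → proj₁ XC (sub x) c) , tC
      ; YB = YB ; YC = YC ; BC = BC ; XY = far-mono sub id XY ; WB = WB ; WC = WC }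

    module _ {l : V} (xl : X l) (cX∖l : Connected (X ∖ l)) where

      private
        X′ = X ∖ l
        X′? = X? ∖? l
        sub : ∀ {u} → X′ u → X u
        sub = proj₁
        apart : Disj X′ ⟨ l ⟩
        apart (_ , ne) refl = ne refl

      drop : Touch W X′ → Touch X′ B → Touch X′ C → FModel
      drop = restrictX X′? cX∖l sub

      -- The vertex l has to miss W, because W and B must stay far apart. What is left of X then
      -- meets the new B in l itself.
      moveToB : Touch X′ ⟨ l ⟩ → ¬ Touch W ⟨ l ⟩ → Touch ⟨ l ⟩ B → Touch W X′ → Touch X′ C → FModel
      moveToB t ¬tW tB tW tC = record
        { W? = W? ; X? = X′? ; Y? = Y? ; B? = B? ∪? ⟨ l ⟩? ; C? = C?
        ; cW = cW ; cX = cX∖l ; cY = cY ; cB = conn-∪ cB conn-⟨⟩ (touch-sym tB) ; cC = cC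
        ; WX = (λ w x → proj₁ WX w (sub x)) , tW ; WY = WY
        ; XB = (λ { x (inj₁ b) → proj₁ XB (sub x) b ; x (inj₂ e) → apart x e }) , touch-mono id inj₂ t
        ; XC = (λ x c → proj₁ XC (sub x) c) , tC
        ; YB = near-sym (near-∪ˡ (near-sym YB) λ { refl y → proj₁ XY xl y }) ; YC = YC
        ; BC = near-∪ˡ BC λ { refl c → proj₁ XC xl c } ; XY = far-mono sub id XY
        ; WB = far-sym (far-∪ (far-sym WB) (far-sym (untouched (λ { w refl → proj₁ WX w xl }) ¬tW))) ; WC = WC }

      -- A remainder of X that sees neither B nor C satisfies all that is asked of W, so it can join
      -- W and leave l alone.
      flip : Touch X′ ⟨ l ⟩ → ¬ Touch X′ B → ¬ Touch X′ C → Touch W X′ → Touch ⟨ l ⟩ B → Touch ⟨ l ⟩ C → FModel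
      flip t ¬tB ¬tC tW tB tC = record
        { W? = W? ∪? X′? ; X? = ⟨ l ⟩? ; Y? = Y? ; B? = B? ; C? = C?
        ; cW = conn-∪ cW cX∖l tW ; cX = conn-⟨⟩ ; cY = cY ; cB = cB ; cC = cC
        ; WX = (λ { (inj₁ w) refl → proj₁ WX w xl ; (inj₂ x) e → apart x e }) , touch-mono inj₂ id t
        ; WY = near-∪ˡ WY λ x y → proj₁ XY (sub x) y
        ; XB = (λ { refl b → proj₁ XB xl b }) , tB ; XC = (λ { refl c → proj₁ XC xl c }) , tC
        ; YB = YB ; YC = YC ; BC = BC ; XY = far-mono (λ { refl → xl }) id XY
        ; WB = far-∪ WB (untouched (λ x b → proj₁ XB (sub x) b) ¬tB)
        ; WC = far-∪ WC (untouched (λ x c → proj₁ XC (sub x) c) ¬tC) }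

    -- If the bag X meets B only in l and C only in l′, and W touches both l and l′, then
    -- the rest of X yields a new model in which l and l′ are the bags of 2 and 5.
    module _ {l l′ : V} (xl : X l) (xl′ : X l′) (l≢l′ : l ≢ l′) (¬ll′ : ¬ E l l′)
             (tWl : Touch W ⟨ l ⟩) (tWl′ : Touch W ⟨ l′ ⟩) (tlB : Touch ⟨ l ⟩ B) (tl′C : Touch ⟨ l′ ⟩ C)
             (I : Interior X l l′) (far-B : Far (Interior.set I) B) (far-C : Far (Interior.set I) C) where

      private
        open Interior I renaming (set to Z; set? to Z?; conn to cZ)
        l∉B : Disj ⟨ l ⟩ B
        l∉B refl = proj₁ XB xl
        l∉C : Disj ⟨ l ⟩ C
        l∉C refl = proj₁ XC xl
        l′∉B : Disj ⟨ l′ ⟩ B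
        l′∉B refl = proj₁ XB xl′
        l′∉C : Disj ⟨ l′ ⟩ C
        l′∉C refl = proj₁ XC xl′
        W∌l : Disj W ⟨ l ⟩
        W∌l w refl = proj₁ WX w xl
        W∌l′ : Disj W ⟨ l′ ⟩
        W∌l′ w refl = proj₁ WX w xl′
        Z∌l : Disj Z ⟨ l ⟩
        Z∌l z refl = proj₁ (proj₂ (sub z)) refl
        Z∌l′ : Disj Z ⟨ l′ ⟩
        Z∌l′ z refl = proj₂ (proj₂ (sub z)) refl
        ll′ : Far ⟨ l ⟩ ⟨ l′ ⟩
        ll′ = (λ { refl e → l≢l′ e }) , λ { refl refl → ¬ll′ }
        cBC = conn-∪ cB cC (proj₂ BC)

      -- W and the interior Z of X become the bags of 3 and 4. The bag of 1 is B ∪ C, which sees l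
      -- and l′ but neither W nor Z.
      rotate-near : Touch W Z → FModel
      rotate-near t = record
        { W? = B? ∪? C? ; X? = ⟨ l ⟩? ; Y? = ⟨ l′ ⟩? ; B? = W? ; C? = Z?
        ; cW = cBC ; cX = conn-⟨⟩ ; cY = conn-⟨⟩ ; cB = cW ; cC = cZ
        ; WX = near-∪ˡ (near-sym (l∉B , tlB)) λ c e → l∉C e c
        ; WY = (λ { (inj₁ b) e → l′∉B e b ; (inj₂ c) e → l′∉C e c }) , touch-mono inj₂ id (touch-sym tl′C)
        ; XB = near-sym (W∌l , tWl) ; XC = near-sym (Z∌l , near₁)
        ; YB = near-sym (W∌l′ , tWl′) ; YC = near-sym (Z∌l′ , near₂)
        ; BC = (λ w z → proj₁ WX w (proj₁ (sub z))) , t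
        ; XY = ll′ ; WB = far-∪ (far-sym WB) (far-sym WC) ; WC = far-∪ (far-sym far-B) (far-sym far-C) }

      -- As Z now misses W, it can be the bag of 1, with W as the bag of 3. The bag of 4 is B ∪ C ∪
      -- Y, where Y supplies the contact with W.
      rotate-far : ¬ Touch W Z → FModel
      rotate-far ¬t = record
        { W? = Z? ; X? = ⟨ l ⟩? ; Y? = ⟨ l′ ⟩? ; B? = W? ; C? = (B? ∪? C?) ∪? Y?
        ; cW = cZ ; cX = conn-⟨⟩ ; cY = conn-⟨⟩ ; cB = cW
        ; cC = conn-∪ cBC cY (touch-mono inj₁ id (touch-sym (proj₂ YB)))
        ; WX = Z∌l , near₁ ; WY = Z∌l′ , near₂
        ; XB = near-sym (W∌l , tWl)
        ; XC = near-sym (near-∪ˡ (near-∪ˡ (near-sym (l∉B , tlB)) λ c e → l∉C e c) λ { y refl → proj₁ XY xl y })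
        ; YB = near-sym (W∌l′ , tWl′)
        ; YC = (λ { e (inj₁ (inj₁ b)) → l′∉B e b ; e (inj₁ (inj₂ c)) → l′∉C e c ; refl (inj₂ y) → proj₁ XY xl′ y }) ,
               touch-mono id (inj₁ ∘ inj₂) tl′C
        ; BC = (λ { w (inj₁ (inj₁ b)) → proj₁ WB w b ; w (inj₁ (inj₂ c)) → proj₁ WC w c ; w (inj₂ y) → proj₁ WY w y }) ,
               touch-mono id inj₂ (proj₂ WY)
        ; XY = ll′ ; WB = far-sym (untouched (λ w z → proj₁ WX w (proj₁ (sub z))) ¬t)
        ; WC = far-sym (far-∪ (far-∪ (far-sym far-B) (far-sym far-C)) (far-sym (far-mono (proj₁ ∘ sub) id XY))) }

  split-touch : ∀ {P X : V → Set} {l} → Touch P X → Touch P (X ∖ l) ⊎ Touch P ⟨ l ⟩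
  split-touch {l = l} (u , v , p , x , e) with v Finₚ.≟ l
  ... | yes v≡l = inj₂ (u , v , p , v≡l , e)
  ... | no v≢l  = inj₁ (u , v , p , (x , v≢l) , e)

  split-touchˡ : ∀ {P X : V → Set} {l} → Touch X P → ¬ Touch (X ∖ l) P → Touch ⟨ l ⟩ P
  split-touchˡ t ¬t with split-touch (touch-sym t)
  ... | inj₁ t′ = ⊥-elim (¬t (touch-sym t′))
  ... | inj₂ t′ = touch-sym t′

  -- `keepsY` allows the reduction to be applied to the two bags in turn, as the second application
  -- does not spoil the first.
  record Shrunk (M : FModel) : Set₁ where
    field
      model  : FModel
      smallX : Small (FModel.X model)
      keepsY : Small (FModel.Y M) → Small (FModel.Y model)

  record Smaller (M : FModel) : Set₁ where
    field
      model  : FModel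
      shorter   : size (FModel.X? model) < size (FModel.X? M)
      keepsY : Small (FModel.Y M) → Small (FModel.Y model)

  -- If l misses W, the contacts of the rest of X decide: with both B and C, l is dropped; if one of
  -- them is lost, l moves to that bag; if both are lost, the rest of X joins W.
  analyse : ∀ M {l r} → FModel.X M l → FModel.X M r → r ≢ l → Connected (FModel.X M ∖ l) →
            Smaller M ⊎ Touch (FModel.W M) ⟨ l ⟩
  analyse M {l} {r} xl xr r≢l cX∖l = cases (touch? W? ⟨ l ⟩?) (touch? (X? ∖? l) B?) (touch? (X? ∖? l) C?)
    where
    open FModel M
    open Moves M
    t : Touch (X ∖ l) ⟨ l ⟩
    t with leaving (X? ∖? l) (cX xr xl) (xr , r≢l) (λ (_ , ne) → ne refl)
    ... | x , y , p , xy , ¬p , e with y Finₚ.≟ l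
    ...   | yes y≡l = x , y , p , y≡l , e
    ...   | no y≢l  = ⊥-elim (¬p (xy , y≢l))
    shorter : size (X? ∖? l) < size X?
    shorter = size-strict (X? ∖? l) X? proj₁ xl (λ (_ , ne) → ne refl)
    cases : Dec (Touch W ⟨ l ⟩) → Dec (Touch (X ∖ l) B) → Dec (Touch (X ∖ l) C) → Smaller M ⊎ Touch W ⟨ l ⟩
    cases (yes tWl) _ _ = inj₂ tWl
    cases (no ¬tWl) tB tC with split-touch {l = l} (proj₂ WX)
    ... | inj₂ tWl = ⊥-elim (¬tWl tWl)
    ... | inj₁ tW with tB | tC
    ...   | yes tB′ | yes tC′ = inj₁ (record { model = drop xl cX∖l tW tB′ tC′ ; shorter = shorter ; keepsY = id })
    ...   | yes tB′ | no ¬tC  = inj₁ (record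
      { model = Moves.moveToB (swapBC M) xl cX∖l t ¬tWl (split-touchˡ (proj₂ XC) ¬tC) tW tB′ ; shorter = shorter ; keepsY = id })
    ...   | no ¬tB  | yes tC′ = inj₁ (record
      { model = moveToB xl cX∖l t ¬tWl (split-touchˡ (proj₂ XB) ¬tB) tW tC′ ; shorter = shorter ; keepsY = id })
    ...   | no ¬tB  | no ¬tC  = inj₁ (record
      { model = flip xl cX∖l t ¬tB ¬tC tW (split-touchˡ (proj₂ XB) ¬tB) (split-touchˡ (proj₂ XC) ¬tC)
      ; shorter = size-strict ⟨ l ⟩? X? (λ { refl → xl }) xr r≢l ; keepsY = id })

  finish : ∀ M {l l′} → FModel.X M l → FModel.X M l′ → l ≢ l′ →
           Touch (FModel.W M) ⟨ l ⟩ → Touch (FModel.W M) ⟨ l′ ⟩ →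
           ¬ Touch (FModel.X M ∖ l) (FModel.B M) → ¬ Touch (FModel.X M ∖ l′) (FModel.C M) → Shrunk M
  finish M {l} {l′} xl xl′ l≢l′ tWl tWl′ ¬tB ¬tC with E? l l′
  ... | yes e = record
    { model = restrictX (⟨ l ⟩? ∪? ⟨ l′ ⟩?) (conn-∪ conn-⟨⟩ conn-⟨⟩ (l , l′ , refl , refl , e))
        (λ { (inj₁ refl) → xl ; (inj₂ refl) → xl′ }) (touch-mono id inj₁ tWl)
        (touch-mono inj₁ id (split-touchˡ (proj₂ XB) ¬tB)) (touch-mono inj₂ id (split-touchˡ (proj₂ XC) ¬tC))
    ; smallX = l , l′ , inj₁ refl , inj₂ refl , id , inj₂ e
    ; keepsY = id }
    where
    open FModel M
    open Moves M
  ... | no ¬e = rotate (touch? W? (Interior.set? I))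
    where
    open FModel M
    open Moves M
    I = interior cX xl xl′ l≢l′ ¬e
    tlB = split-touchˡ (proj₂ XB) ¬tB
    tl′C = split-touchˡ (proj₂ XC) ¬tC
    far-B = untouched (λ z b → proj₁ XB (proj₁ (Interior.sub I z)) b)
              λ t → ¬tB (touch-mono (λ z → let x , ne , _ = Interior.sub I z in x , ne) id t)
    far-C = untouched (λ z c → proj₁ XC (proj₁ (Interior.sub I z)) c)
              λ t → ¬tC (touch-mono (λ z → let x , _ , ne = Interior.sub I z in x , ne) id t)
    rotate : Dec (Touch W (Interior.set I)) → Shrunk M
    rotate (yes t) = record
      { model = rotate-near xl xl′ l≢l′ ¬e tWl tWl′ tlB tl′C I far-B far-C t ; smallX = small-⟨⟩ ; keepsY = λ _ → small-⟨⟩ }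
    rotate (no ¬t) = record
      { model = rotate-far xl xl′ l≢l′ ¬e tWl tWl′ tlB tl′C I far-B far-C ¬t ; smallX = small-⟨⟩ ; keepsY = λ _ → small-⟨⟩ }

  shrunk-by : ∀ {M M′} → (Small (FModel.Y M) → Small (FModel.Y M′)) → Shrunk M′ → Shrunk M
  shrunk-by f s = record { model = Shrunk.model s ; smallX = Shrunk.smallX s ; keepsY = Shrunk.keepsY s ∘ f }

  progress : ∀ M {l l′} → FModel.X M l → FModel.X M l′ → l ≢ l′ → Connected (FModel.X M ∖ l) →
             Connected (FModel.X M ∖ l′) → Touch (FModel.W M) ⟨ l ⟩ → Touch (FModel.W M) ⟨ l′ ⟩ → Smaller M ⊎ Shrunk M
  progress M {l} {l′} xl xl′ l≢l′ c c′ tWl tWl′ =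
    cases (touch? (X? ∖? l) B?) (touch? (X? ∖? l) C?) (touch? (X? ∖? l′) B?) (touch? (X? ∖? l′) C?)
    where
    open FModel M
    open Moves M
    tW : Touch W (X ∖ l)
    tW = touch-mono id (λ { refl → xl′ , ≢-sym l≢l′ }) tWl′
    tW′ : Touch W (X ∖ l′)
    tW′ = touch-mono id (λ { refl → xl , l≢l′ }) tWl
    both : ∀ {P} → Touch X P → ¬ Touch (X ∖ l) P → ¬ Touch (X ∖ l′) P → ⊥
    both t ¬t ¬t′ = ¬t′ (touch-mono (λ { refl → xl , l≢l′ }) id (split-touchˡ t ¬t))
    cases : Dec (Touch (X ∖ l) B) → Dec (Touch (X ∖ l) C) → Dec (Touch (X ∖ l′) B) → Dec (Touch (X ∖ l′) C) →
            Smaller M ⊎ Shrunk M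
    cases (yes tB) (yes tC) _ _ = inj₁ (record
      { model = drop xl c tW tB tC ; shorter = size-strict (X? ∖? l) X? proj₁ xl (λ (_ , ne) → ne refl) ; keepsY = id })
    cases _ _ (yes tB) (yes tC) = inj₁ (record
      { model = drop xl′ c′ tW′ tB tC ; shorter = size-strict (X? ∖? l′) X? proj₁ xl′ (λ (_ , ne) → ne refl) ; keepsY = id })
    cases (no ¬tB) _ (no ¬tB′) _ = ⊥-elim (both (proj₂ XB) ¬tB ¬tB′)
    cases _ (no ¬tC) _ (no ¬tC′) = ⊥-elim (both (proj₂ XC) ¬tC ¬tC′)
    cases (no ¬tB) _ _ (no ¬tC′) = inj₂ (finish M xl xl′ l≢l′ tWl tWl′ ¬tB ¬tC′)
    cases _ (no ¬tC) (no ¬tB′) _ = inj₂ (shrunk-by id (finish (swapBC M) xl xl′ l≢l′ tWl tWl′ ¬tC ¬tB′))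

  Reduction : FModel → Set₁
  Reduction M = Smaller M ⊎ Shrunk M

  reduce : ∀ M → Reduction M
  reduce M with proj₂ (FModel.XB M)
  ... | r , _ , xr , _ with Finₚ.any? (λ s → FModel.X? M s ×-dec ¬? (s Finₚ.≟ r))
  ... | no none = inj₂ (record { model = M ; smallX = r , r , xr , xr , only , inj₁ refl ; keepsY = id })
    where
    only : ∀ {u} → FModel.X M u → u ≡ r ⊎ u ≡ r
    only {u} xu with u Finₚ.≟ r
    ... | yes e = inj₁ e
    ... | no ne = ⊥-elim (none (u , xu , ne))
  ... | yes (s , xs , s≢r) with noncut (FModel.X? M) (FModel.cX M) xr xs s≢r
  -- Rooting the second search at l makes the second non-cut vertex different from the first.
  ... | l , xl , l≢r , c with noncut (FModel.X? M) (FModel.cX M) xl xr (≢-sym l≢r)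
  ... | l′ , xl′ , l′≢l , c′ with analyse M xl xl′ l′≢l c | analyse M xl′ xl (≢-sym l′≢l) c′
  ... | inj₁ s′  | _         = inj₁ s′
  ... | inj₂ _   | inj₁ s′   = inj₁ s′
  ... | inj₂ tWl | inj₂ tWl′ = progress M xl xl′ (≢-sym l′≢l) c c′ tWl tWl′

  shrink : ∀ k M → size (FModel.X? M) ≤ k → Shrunk M
  shrink k M le = continue k le (reduce M)
    where
    continue : ∀ k → size (FModel.X? M) ≤ k → Reduction M → Shrunk M
    continue k       le (inj₂ s) = s
    continue zero    le (inj₁ s) = ⊥-elim (n≮0 (<-≤-trans (Smaller.shorter s) le))
    continue (suc k) le (inj₁ s) =
      shrunk-by (Smaller.keepsY s) (shrink k (Smaller.model s) (s≤s⁻¹ (<-≤-trans (Smaller.shorter s) le)))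

  record SmallModel : Set₁ where
    field
      model  : FModel
      smallX : Small (FModel.X model)
      smallY : Small (FModel.Y model)

  shrink-both : FModel → SmallModel
  shrink-both M =
    let s = shrink _ M ≤-refl
        s′ = shrink _ (swapXY (Shrunk.model s)) ≤-refl in
    record { model = Shrunk.model s′ ; smallX = Shrunk.smallX s′ ; smallY = Shrunk.keepsY s′ (Shrunk.smallX s) }

-- From small models to certificates: shortening an induced path

module Paths {n} (G : Graph n) (simple : IsSimple G) where

  open Sets G simple
  open Bags G simple
  open DecPropositional (Finₚ._≟_ {n}) using (_∈?_)

  -- IPath Y p qs: p ∷ qs is an induced path of which only the last vertex has a neighbour in Y.
  data IPath (Y : V → Set) : V → List V → Set where
    end  : ∀ {p} → AdjTo Y p → IPath Y p []
    link : ∀ {p q qs} → ¬ AdjTo Y p → E p q → All (λ r → p ≢ r × ¬ E p r) qs → IPath Y q qs → IPath Y p (q ∷ qs)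

  Suffix : (V → Set) → (V → Set) → List V → Set
  Suffix Y Q ps = ∃ λ r → ∃ λ rs → IPath Y r rs × Q r × All (¬_ ∘ Q) rs × (∀ {u} → u ∈ r ∷ rs → u ∈ ps)

  find-last : ∀ {Y Q p qs} → Decidable Q → IPath Y p qs → Suffix Y Q (p ∷ qs) ⊎ All (¬_ ∘ Q) (p ∷ qs)
  find-last {p = p} Q? I@(end a) with Q? p
  ... | yes q = inj₁ (p , [] , I , q , [] , id)
  ... | no ¬q = inj₂ (¬q ∷ [])
  find-last {p = p} Q? I@(link ¬a e h I′) with find-last Q? I′
  ... | inj₁ (r , rs , J , q , nq , sub) = inj₁ (r , rs , J , q , nq , there ∘ sub)
  ... | inj₂ none with Q? p
  ...   | yes q = inj₁ (p , _ , I , q , none , id)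
  ...   | no ¬q = inj₂ (¬q ∷ none)

  -- The walk is shortcut while the path is built from its end: a is attached to the last vertex of
  -- the path that is a neighbour of a, a later return to a discards everything before it, and the
  -- path stops at once if a sees Y.
  path-from : ∀ {P Y a b} → Decidable Y → Conn G P a b → AdjTo Y b →
              ∃ λ qs → IPath Y a qs × (∀ {u} → u ∈ a ∷ qs → P u)
  path-from Y? (stop p) y = [] , end y , λ { (here refl) → p }
  path-from {P} {Y} {a} Y? (go p e c) y with adjTo? Y? a
  ... | yes ya = [] , end ya , λ { (here refl) → p }
  ... | no ¬ya with path-from Y? c y
  ... | qs , I , sub with find-last {Q = λ r → r ≡ a ⊎ E a r} (λ r → r Finₚ.≟ a ⊎-dec E? a r) I
  ... | inj₂ (nq ∷ _) = ⊥-elim (nq (inj₂ e))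
  ... | inj₁ (r , rs , J , inj₁ refl , _ , sub′) = rs , J , sub ∘ sub′
  ... | inj₁ (r , rs , J , inj₂ ar , nq , sub′) =
    r ∷ rs , link ¬ya ar (All.map (λ ¬q → (λ e → ¬q (inj₁ (sym e))) , ¬q ∘ inj₂) nq) J ,
    λ { (here refl) → p ; (there u∈) → sub (sub′ u∈) }

  path-conn : ∀ {Y p qs} → IPath Y p qs → Connected (_∈ p ∷ qs)
  path-conn {p = p} I = λ u∈ v∈ → conn-trans (conn-sym (proj₁ simple) (from-head I u∈)) (from-head I v∈)
    where
    from-head : ∀ {Y p qs} → IPath Y p qs → ∀ {u} → u ∈ p ∷ qs → Conn G (_∈ p ∷ qs) p u
    from-head _ (here refl) = stop (here refl)
    from-head (link _ e _ I) (there u∈) = go (here refl) e (conn-map there (from-head I u∈))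

  path-touch : ∀ {Y p qs} → IPath Y p qs → Touch (_∈ p ∷ qs) Y
  path-touch (end (y , yy , e)) = _ , y , here refl , yy , e
  path-touch (link _ _ _ I) = touch-mono there id (path-touch I)

  rest-conn : ∀ {Y p qs} → Connected Y → IPath Y p qs →
              Connected ((_∈ qs) ∪ Y) × Touch ((_∈ qs) ∪ Y) ⟨ p ⟩
  rest-conn cY (end (y , yy , e)) =
    (λ { (inj₂ y) (inj₂ y′) → conn-map inj₂ (cY y y′) }) , y , _ , inj₂ yy , refl , E-sym e
  rest-conn cY (link {q = q} _ e _ I) =
    conn-∪ (path-conn I) cY (path-touch I) , q , _ , inj₁ (here refl) , refl , E-sym e

  -- The path is cut at its first vertex q with property Q. The part before q is again an `IPath`
  -- with q in the place of Y, since an induced path has only one vertex before q that is adjacent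
  -- to q.
  record Split (Y Q : V → Set) (p : V) (qs : List V) : Set where
    field
      as bs   : List V
      q       : V
      prefix  : IPath ⟨ q ⟩ p as
      suffix  : IPath Y q bs
      shorter : length as < length qs
      bs-shorter : length bs < length qs
      Qq      : Q q
      none    : ∀ {t} → t ∈ p ∷ as → ¬ Q t
      as⊆     : ∀ {t} → t ∈ as → t ∈ qs
      q∈      : q ∈ qs
      bs⊆     : ∀ {t} → t ∈ bs → t ∈ qs
      apart   : ∀ {t r} → t ∈ p ∷ as → r ∈ bs → t ≢ r × ¬ E t r
      t≢q     : ∀ {t} → t ∈ p ∷ as → t ≢ q
      ¬Y      : ∀ {t} → t ∈ p ∷ as → ¬ AdjTo Y t
      q∉      : ¬ q ∈ bs

  head-∉ : ∀ {Y q bs} → IPath Y q bs → ¬ q ∈ bs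
  head-∉ (link _ e h I) (here refl) = E-irrefl e
  head-∉ (link _ e h I) (there q∈)  = proj₁ (All.lookup h q∈) refl

  split-first : ∀ {Y Q p qs} → Decidable Q → IPath Y p qs → ¬ Q p → ∀ {r} → r ∈ qs → Q r → Split Y Q p qs
  split-first {p = p} {qs = q₀ ∷ qs₀} Q? (link ¬y e h I) ¬qp r∈ qr with Q? q₀
  ... | yes q = record
    { as = [] ; bs = qs₀ ; q = q₀ ; prefix = end (q₀ , refl , e) ; suffix = I ; shorter = s≤s z≤n ; bs-shorter = ≤-refl ; Qq = q
    ; none = λ { (here refl) → ¬qp } ; as⊆ = λ () ; q∈ = here refl ; bs⊆ = there
    ; apart = λ { (here refl) r∈ → All.lookup h r∈ }
    ; t≢q = λ { (here refl) refl → E-irrefl e } ; ¬Y = λ { (here refl) → ¬y } ; q∉ = head-∉ I }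
  ... | no ¬q with r∈
  ...   | here refl = ⊥-elim (¬q qr)
  ...   | there r∈′ = record
    { as = q₀ ∷ as ; bs = bs ; q = q
    ; prefix = link (λ { (_ , refl , e′) → proj₂ (All.lookup h q∈) e′ }) e (All.tabulate (λ t∈ → All.lookup h (as⊆ t∈))) prefix
    ; suffix = suffix ; shorter = s≤s shorter ; bs-shorter = m≤n⇒m≤1+n bs-shorter ; Qq = Qq
    ; none = λ { (here refl) → ¬qp ; (there t∈) → none t∈ }
    ; as⊆ = λ { (here refl) → here refl ; (there t∈) → there (as⊆ t∈) } ; q∈ = there q∈ ; bs⊆ = there ∘ bs⊆
    ; apart = λ { (here refl) r∈ → All.lookup h (bs⊆ r∈) ; (there t∈) r∈ → apart t∈ r∈ }
    ; t≢q = λ { (here refl) → proj₁ (All.lookup h q∈) ; (there t∈) → t≢q t∈ }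
    ; ¬Y = λ { (here refl) → ¬y ; (there t∈) → ¬Y t∈ } ; q∉ = q∉ }
    where open Split (split-first Q? I ¬q r∈′ qr)

  -- The hypothesis of Menger's theorem for two disjoint connections. As z ranges over all vertices,
  -- also those outside K, it includes that K contains a connection at all.
  Linked : (V → Set) → (V → Set) → (V → Set) → Set
  Linked X Y K = ∀ z → ∃ λ s → ∃ λ t → AdjTo X s × AdjTo Y t × Conn G (K ∖ z) s t

  -- W is reduced to an induced path of which only the head p sees X, and B ∪ C is reduced to a
  -- connected K of which only `linked` is remembered. In this form K can absorb further vertices.
  record PathConfig : Set₁ where
    field
      {X Y K} : V → Set
      X?     : Decidable X
      Y?     : Decidable Y
      K?     : Decidable K
      smallX : Small X
      smallY : Small Y
      cX     : Connected X
      cY     : Connected Y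
      cK     : Connected K
      XY     : Far X Y
      XK     : Disj X K
      YK     : Disj Y K
      p      : V
      qs     : List V
      path   : IPath Y p qs
      p~X    : AdjTo X p
      qs≁X   : All (¬_ ∘ AdjTo X) qs
      path∉X : ∀ {t} → t ∈ p ∷ qs → ¬ X t
      path∉Y : ∀ {t} → t ∈ p ∷ qs → ¬ Y t
      farK   : Far (_∈ p ∷ qs) K
      linked : Linked X Y K

  Outside : (V → Set) → (V → Set) → V → V → Set
  Outside X Y v u = (¬ X u × ¬ Y u) × (u ≢ v × ¬ E u v)

  -- `within` and `closed` say that K is the component of w in G - X - Y - N[v]. They are phrased by
  -- walks from w to match the closure in the formula.
  record Certificate : Set₁ where
    field
      {X Y K} : V → Set
      smallX  : Small X
      smallY  : Small Y
      XY      : Far X Y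
      v w b   : V
      v∉      : ¬ X v × ¬ Y v
      v~X     : AdjTo X v
      b~Y     : AdjTo Y b
      w∈K     : K w
      within  : ∀ {u} → K u → Conn G (Outside X Y v) w u
      closed  : ∀ {u} → Conn G (Outside X Y v) w u → K u
      route   : Conn G (λ u → (¬ X u × ¬ Y u) × (¬ K u × ¬ AdjTo K u)) v b
      linked  : Linked X Y K

  module Advance (c : PathConfig) where
    open PathConfig c

    Free : V → Set
    Free u = (¬ X u × ¬ Y u) × (¬ u ∈ p ∷ qs × ¬ AdjTo (_∈ p ∷ qs) u)

    Free? : Decidable Free
    Free? u = (¬? (X? u) ×-dec ¬? (Y? u)) ×-dec (¬? (u ∈? (p ∷ qs)) ×-dec ¬? (adjTo? (λ t → t ∈? (p ∷ qs)) u))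

    K⊆Free : ∀ {u} → K u → Free u
    K⊆Free k = ((λ x → XK x k) , λ y → YK y k) , (λ t∈ → proj₁ farK t∈ k) , λ (t , t∈ , e) → proj₂ farK t∈ k (E-sym e)

    w : V
    -- Any argument of `linked` would show that K is inhabited; p is at hand.
    w = let s , _ , _ , _ , c = linked p in s

    w∈K : K w
    w∈K = let _ , _ , _ , _ , c = linked p in proj₁ (conn-source c)

    open Component (component Free? (K⊆Free w∈K)) renaming (set to K′; set? to K′?; conn to cK′)

    K⊆K′ : ∀ {u} → K u → K′ u
    K⊆K′ k = complete root (conn-map K⊆Free (cK w∈K k))

    linked′ : Linked X Y K′
    linked′ z = let s , t , x , y , c = linked z in s , t , x , y , conn-map (λ (k , ne) → K⊆K′ k , ne) c

    path-far : Far (_∈ p ∷ qs) K′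
    path-far = (λ t∈ k → proj₁ (proj₂ (within k)) t∈) , λ t∈ k e → proj₂ (proj₂ (within k)) (_ , t∈ , E-sym e)

    -- These vertices are what prevents K′, a component far from the whole path, from being a
    -- component of the larger graph G - X - Y - N[p].
    Exit : V → Set
    Exit u = Outside X Y p u × (AdjTo K′ u × ¬ K′ u)

    exit? : Decidable Exit
    exit? u = ((¬? (X? u) ×-dec ¬? (Y? u)) ×-dec (¬? (u Finₚ.≟ p) ×-dec ¬? (E? u p))) ×-dec (adjTo? K′? u ×-dec ¬? (K′? u))

    -- With v = p, the route to Y is the path itself, which is far from K′.
    certify : ¬ ∃ Exit → Certificate
    certify none = record
      { smallX = smallX ; smallY = smallY ; XY = XY ; v = p ; w = w ; b = proj₁ touching
      ; v∉ = path∉X (here refl) , path∉Y (here refl) ; v~X = p~X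
      ; b~Y = let _ , y , _ , yy , e = touching in y , yy , e
      ; w∈K = root ; within = λ k → conn-map outside (cK′ root k) ; closed = stays root
      ; route = conn-map (λ t∈ → (path∉X t∈ , path∉Y t∈) , (λ k → proj₁ path-far t∈ k) , λ (k , kk , e) → proj₂ path-far t∈ kk e)
          (path-conn path (here refl) (let _ , _ , t∈ , _ = touching in t∈))
      ; linked = linked′ }
      where
      touching = path-touch path
      outside : ∀ {u} → K′ u → Outside X Y p u
      outside k = proj₁ (within k) , (λ { refl → proj₁ path-far (here refl) k }) ,
                  λ e → proj₂ path-far (here refl) k (E-sym e)
      stays : ∀ {u x} → K′ u → Conn G (Outside X Y p) u x → K′ x
      stays k (stop _) = k
      stays k (go {v = y} _ e c) with K′? y
      ... | yes k′ = stays k′ c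
      ... | no ¬k′ = ⊥-elim (none (y , conn-source c , (_ , k , E-sym e) , ¬k′))

    -- Outside K′ but adjacent to it, u must see the path, and it does so beyond p. Its first
    -- neighbour q on the path becomes the new Y, while u, the path behind q and the old Y join K.
    -- Being the first neighbour, q leaves the path before it far from the new K.
    module Detour (u : V) (esc : Exit u) where

      private
        u∉X = proj₁ (proj₁ (proj₁ esc))
        u∉Y = proj₂ (proj₁ (proj₁ esc))
        u≁p = proj₂ (proj₂ (proj₁ esc))
        u~K′ = proj₁ (proj₂ esc)
        u∉K′ = proj₂ (proj₂ esc)

        u∉path : ¬ u ∈ p ∷ qs
        u∉path t∈ = let _ , k , e = u~K′ in proj₂ path-far t∈ k e

        u~path : AdjTo (_∈ p ∷ qs) u
        u~path with adjTo? (λ t → t ∈? (p ∷ qs)) u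
        ... | yes a = a
        ... | no ¬a = let _ , k , e = u~K′ in ⊥-elim (u∉K′ (Component.closed (component Free? (K⊆Free w∈K)) k
                        ((u∉X , u∉Y) , u∉path , ¬a) (E-sym e)))

        attach : ∃ λ r → r ∈ qs × E u r
        attach with u~path
        ... | _ , here refl , e = ⊥-elim (u≁p e)
        ... | r , there r∈ , e  = r , r∈ , e

      open Split (split-first {Q = E u} (E? u) path u≁p (proj₁ (proj₂ attach)) (proj₂ (proj₂ attach))) public

      private
        Z : V → Set
        Z = (_∈ bs) ∪ Y

        K″ : V → Set
        K″ = (K′ ∪ ⟨ u ⟩) ∪ Z

        Z-conn = rest-conn cY suffix

        K′~u : Touch K′ ⟨ u ⟩
        K′~u = let k , kk , e = u~K′ in k , u , kk , refl , E-sym e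

        K′~Y : Touch K′ Y
        K′~Y = let _ , t , _ , (y , yy , e) , c = linked′ u in t , y , proj₁ (conn-target c) , yy , e

        Z∌K′ : Disj K′ Z
        Z∌K′ k (inj₁ t∈) = proj₁ path-far (there (bs⊆ t∈)) k
        Z∌K′ k (inj₂ y)  = proj₂ (proj₁ (within k)) y

        u∉Z : ¬ Z u
        u∉Z (inj₁ t∈) = u∉path (there (bs⊆ t∈))
        u∉Z (inj₂ y)  = u∉Y y

        q∈path : q ∈ p ∷ qs
        q∈path = there q∈

        ∈path : ∀ {t} → t ∈ p ∷ as → t ∈ p ∷ qs
        ∈path (here refl) = here refl
        ∈path (there t∈)  = there (as⊆ t∈)

        Z-end : V
        Z-end = proj₁ (proj₂ Z-conn)

        Z-end∈ : Z Z-end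
        Z-end∈ = let _ , _ , z , _ = proj₂ Z-conn in z

        Z-end~q : E Z-end q
        Z-end~q = let _ , _ , _ , e , g = proj₂ Z-conn in subst (E Z-end) e g

        linked″ : Linked X ⟨ q ⟩ K″
        linked″ z with K′? z ⊎-dec z Finₚ.≟ u
        -- The old linkage avoids z inside K′ and reaches the old Y, from where the rest of the path
        -- leads to a neighbour of q; z is not met there.
        ... | yes z∈ =
          let s , t , x , (y , yy , e) , c = linked′ z in
          s , Z-end , x , (q , refl , Z-end~q) ,
          conn-trans (conn-map (λ (k , ne) → inj₁ (inj₁ k) , ne) c)
            (go (inj₁ (inj₁ (proj₁ (conn-target c))) , proj₂ (conn-target c)) e
              (conn-map (λ z′ → inj₂ z′ , avoid z∈ z′) (proj₁ Z-conn (inj₂ yy) Z-end∈)))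
          where
          avoid : K′ z ⊎ z ≡ u → ∀ {t} → Z t → t ≢ z
          avoid (inj₁ k) z′ refl = Z∌K′ k z′
          avoid (inj₂ refl) z′ refl = u∉Z z′
        -- All of K′ and u are available, and u is adjacent to q.
        ... | no z∉ =
          let s , _ , x , _ , c = linked′ u
              k , kk , e = u~K′ in
          s , u , x , (q , refl , Qq) ,
          conn-trans (conn-map (λ k → inj₁ (inj₁ k) , λ { refl → z∉ (inj₁ k) }) (cK′ (proj₁ (conn-source c)) kk))
            (go (inj₁ (inj₁ kk) , λ { refl → z∉ (inj₁ kk) }) (E-sym e)
              (stop (inj₁ (inj₂ refl) , λ { refl → z∉ (inj₂ refl) })))

      config : PathConfig
      config = record
        { X? = X? ; Y? = ⟨ q ⟩? ; K? = (K′? ∪? ⟨ u ⟩?) ∪? ((λ t → t ∈? bs) ∪? Y?)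
        ; smallX = smallX ; smallY = small-⟨⟩ ; cX = cX ; cY = conn-⟨⟩
        ; cK = conn-∪ (conn-∪ cK′ conn-⟨⟩ K′~u) (proj₁ Z-conn) (touch-mono inj₁ inj₂ K′~Y)
        -- The vertex q lies beyond p on the path, so it has no neighbour in X.
        ; XY = (λ { x refl → path∉X q∈path x }) , λ { x refl e → All.lookup qs≁X q∈ (_ , x , E-sym e) }
        ; XK = λ { x (inj₁ (inj₁ k)) → proj₁ (proj₁ (within k)) x ; x (inj₁ (inj₂ refl)) → u∉X x
                 ; x (inj₂ (inj₁ t∈)) → path∉X (there (bs⊆ t∈)) x ; x (inj₂ (inj₂ y)) → proj₁ XY x y }
        ; YK = λ { refl (inj₁ (inj₁ k)) → proj₁ path-far q∈path k ; refl (inj₁ (inj₂ e)) → u∉path (subst (_∈ p ∷ qs) e q∈path)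
                 ; refl (inj₂ (inj₁ t∈)) → q∉ t∈ ; refl (inj₂ (inj₂ y)) → path∉Y q∈path y }
        ; p = p ; qs = as ; path = prefix ; p~X = p~X ; qs≁X = All.tabulate (λ t∈ → All.lookup qs≁X (as⊆ t∈))
        ; path∉X = path∉X ∘ ∈path ; path∉Y = t≢q
        ; farK = (λ { t∈ (inj₁ (inj₁ k)) → proj₁ path-far (∈path t∈) k ; t∈ (inj₁ (inj₂ refl)) → u∉path (∈path t∈)
                    ; t∈ (inj₂ (inj₁ r∈)) → proj₁ (apart t∈ r∈) refl ; t∈ (inj₂ (inj₂ y)) → path∉Y (∈path t∈) y }) ,
                 (λ { t∈ (inj₁ (inj₁ k)) e → proj₂ path-far (∈path t∈) k e ; t∈ (inj₁ (inj₂ refl)) e → none t∈ (E-sym e)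
                    ; t∈ (inj₂ (inj₁ r∈)) e → proj₂ (apart t∈ r∈) e ; t∈ (inj₂ (inj₂ y)) e → ¬Y t∈ (_ , y , e) })
        ; linked = linked″ }

  certificate : ∀ k c → length (PathConfig.qs c) ≤ k → Certificate
  certificate k c le with Finₚ.any? (Advance.exit? c)
  certificate k       c le | no none = Advance.certify c none
  certificate zero    c le | yes (u , esc) = ⊥-elim (n≮0 (<-≤-trans (Advance.Detour.shorter c u esc) le))
  certificate (suc k) c le | yes (u , esc) =
    certificate k (Advance.Detour.config c u esc) (s≤s⁻¹ (<-≤-trans (Advance.Detour.shorter c u esc) le))

  SmallModel⇒PathConfig : SmallModel → PathConfig
  SmallModel⇒PathConfig S′ with proj₂ (FModel.WX (SmallModel.model S′)) | proj₂ (FModel.WY (SmallModel.model S′))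
  ... | a , x , wa , xx , ax | b , y , wb , yy , by
    with path-from (FModel.Y? (SmallModel.model S′)) (FModel.cW (SmallModel.model S′) wa wb) (y , yy , by)
  -- Starting at the last neighbour of X makes the head the only vertex of the path that sees X.
  ... | qs₀ , I₀ , sub with find-last (adjTo? (FModel.X? (SmallModel.model S′))) I₀
  ... | inj₂ (none ∷ _) = ⊥-elim (none (x , xx , ax))
  ... | inj₁ (p , qs , I , p~X , qs≁X , sub′) = record
    { X? = X? ; Y? = Y? ; K? = B? ∪? C? ; smallX = SmallModel.smallX S′ ; smallY = SmallModel.smallY S′
    ; cX = cX ; cY = cY ; cK = conn-∪ cB cC (proj₂ BC) ; XY = XY
    ; XK = λ { x (inj₁ b) → proj₁ XB x b ; x (inj₂ c) → proj₁ XC x c }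
    ; YK = λ { y (inj₁ b) → proj₁ YB y b ; y (inj₂ c) → proj₁ YC y c }
    ; p = p ; qs = qs ; path = I ; p~X = p~X ; qs≁X = qs≁X
    ; path∉X = λ t∈ x → proj₁ WX (inW t∈) x ; path∉Y = λ t∈ y → proj₁ WY (inW t∈) y
    ; farK = far-mono inW id (far-sym (far-∪ (far-sym WB) (far-sym WC)))
    ; linked = linked }
    where
    open FModel (SmallModel.model S′)
    inW : ∀ {t} → t ∈ p ∷ qs → W t
    inW = sub ∘ sub′
    through : ∀ {P : V → Set} → Connected P → Touch X P → Touch Y P →
              ∃ λ s → ∃ λ t → AdjTo X s × AdjTo Y t × P s × Conn G P s t
    through c (x , s , xx , ps , e) (y , t , yy , pt , e′) = s , t , (x , xx , E-sym e) , (y , yy , E-sym e′) , ps , c ps pt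
    linked : Linked X Y (B ∪ C)
    -- A single vertex meets at most one of B and C, and the other one still joins X to Y.
    linked z with B? z
    ... | yes bz = let s , t , x , y , _ , c = through cC (proj₂ XC) (proj₂ YC) in
                   s , t , x , y , conn-map (λ c → inj₂ c , λ { refl → proj₁ BC bz c }) c
    ... | no ¬bz = let s , t , x , y , _ , c = through cB (proj₂ XB) (proj₂ YB) in
                   s , t , x , y , conn-map (λ b → inj₁ b , λ { refl → ¬bz b }) c

  FModel⇒Certificate : FModel → Certificate
  FModel⇒Certificate M = certificate _ (SmallModel⇒PathConfig (shrink-both M)) ≤-refl

-- Menger's theorem for two connections

-- Two disjoint connected sets linking X to Y inside K, by augmenting along an induced path.
module Linking {n} (G : Graph n) (simple : IsSimple G) where

  open Sets G simple
  open Bags G simple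
  open Paths G simple
  open DecPropositional (Finₚ._≟_ {n}) using (_∈?_)

  conn-overlap : ∀ {P Q u} → Connected P → Connected Q → P u → Q u → Connected (P ∪ Q)
  conn-overlap cP cQ pu qu = λ where
    (inj₁ p) (inj₁ p′) → conn-map inj₁ (cP p p′)
    (inj₂ q) (inj₂ q′) → conn-map inj₂ (cQ q q′)
    (inj₁ p) (inj₂ q)  → conn-trans (conn-map inj₁ (cP p pu)) (conn-map inj₂ (cQ qu q))
    (inj₂ q) (inj₁ p)  → conn-trans (conn-map inj₂ (cQ q qu)) (conn-map inj₁ (cP pu p))

  module _ {X Y K : V → Set} (X? : Decidable X) (Y? : Decidable Y) (K? : Decidable K)
           (cK : Connected K) (linked : Linked X Y K) where

    -- A walk avoiding q is read from its end at Y, starting afresh whenever it meets cs. Thus the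
    -- stretch after its last vertex in A ∪ B, cut off where it first reaches cs or Y, is free and
    -- can be attached to the set it leaves from.
    module Scan {A B : V → Set} (A? : Decidable A) (B? : Decidable B) (cA : Connected A) (cB : Connected B)
                (q : V) (cs : List V) (A∌cs : ∀ {u} → A u → ¬ u ∈ cs) (B∌cs : ∀ {u} → B u → ¬ u ∈ cs) where

      Free : V → Set
      Free u = K u × u ≢ q × ¬ A u × ¬ B u × ¬ u ∈ cs

      Ends : (V → Set) → Set
      Ends P = Touch P Y ⊎ Touch P (_∈ cs)

      ends-mono : ∀ {P Q : V → Set} → (∀ {u} → P u → Q u) → Ends P → Ends Q
      ends-mono f (inj₁ t) = inj₁ (touch-mono f id t)
      ends-mono f (inj₂ t) = inj₂ (touch-mono f id t)

      record Grown (P : V → Set) : Set₁ where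
        field
          set  : V → Set
          set? : Decidable set
          conn : Connected set
          ⊇P   : ∀ {u} → P u → set u
          ⊆P   : ∀ {u} → set u → P u ⊎ Free u
          ends : Ends set

      Seg : V → Set₁
      Seg s = Free s × Grown ⟨ s ⟩

      data Cont (s : V) : Set₁ where
        to-Y   : AdjTo Y s → Cont s
        to-cs  : ∀ {s′} → E s s′ → s′ ∈ cs → Cont s
        to-seg : ∀ {s′} → E s s′ → Seg s′ → Cont s

      grow : ∀ {P s} → Decidable P → Connected P → P s → Cont s → Grown P
      grow P? cP ps (to-Y (y , yy , e)) = record
        { set? = P? ; conn = cP ; ⊇P = id ; ⊆P = inj₁ ; ends = inj₁ (_ , y , ps , yy , e) }
      grow P? cP ps (to-cs e s′∈) = record
        { set? = P? ; conn = cP ; ⊇P = id ; ⊆P = inj₁ ; ends = inj₂ (_ , _ , ps , s′∈ , e) }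
      grow P? cP ps (to-seg e (free , g)) = record
        { set? = P? ∪? Grown.set? g ; conn = conn-∪ cP (Grown.conn g) (_ , _ , ps , Grown.⊇P g refl , e)
        ; ⊇P = inj₁
        ; ⊆P = λ { (inj₁ p) → inj₁ p ; (inj₂ t) → inj₂ ([ (λ { refl → free }) , id ]′ (Grown.⊆P g t)) }
        ; ends = ends-mono inj₂ (Grown.ends g) }

      data Result (s : V) : Set₁ where
        via-A  : ∃ A → Grown A → Result s
        via-B  : ∃ B → Grown B → Result s
        in-cs  : s ∈ cs → Result s
        in-seg : Seg s → Result s

      place : ∀ {s} → K s → s ≢ q → Cont s → Result s
      place {s} k ne c with A? s
      ... | yes a = via-A (s , a) (grow A? cA a c)
      ... | no ¬a with B? s
      ...   | yes b = via-B (s , b) (grow B? cB b c)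
      ...   | no ¬b with s ∈? cs
      ...     | yes s∈ = in-cs s∈
      ...     | no s∉  = in-seg ((k , ne , ¬a , ¬b , s∉) , grow ⟨ s ⟩? conn-⟨⟩ refl c)

      scan : ∀ {s t} → Conn G (K ∖ q) s t → AdjTo Y t → Result s
      scan (stop (k , ne)) y = place k ne (to-Y y)
      scan (go (k , ne) e c) y with scan c y
      ... | via-A a g = via-A a g
      ... | via-B b g = via-B b g
      ... | in-cs s∈  = place k ne (to-cs e s∈)
      ... | in-seg g  = place k ne (to-seg e g)

    -- Both sets start at X. A holds the head p of the induced path that is still to be followed to
    -- Y, and B has either reached Y or touches this path further on.
    record State (p : V) (bs : List V) : Set₁ where
      field
        {A B} : V → Set
        A?    : Decidable A
        B?    : Decidable B
        cA    : Connected A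
        cB    : Connected B
        A⊆K   : ∀ {u} → A u → K u
        B⊆K   : ∀ {u} → B u → K u
        AB    : Disj A B
        A~X   : Touch A X
        B~X   : Touch B X
        path  : IPath Y p bs
        p∈A   : A p
        A∌bs  : ∀ {u} → A u → ¬ u ∈ bs
        B∌bs  : ∀ {u} → B u → ¬ u ∈ bs
        bs⊆K  : ∀ {u} → u ∈ bs → K u
        bs≁X  : ∀ {u} → u ∈ bs → ¬ AdjTo X u
        ends  : Touch B Y ⊎ Touch B (_∈ bs)

    record TwoSets : Set₁ where
      field
        {A B} : V → Set
        A?    : Decidable A
        B?    : Decidable B
        cA    : Connected A
        cB    : Connected B
        A⊆K   : ∀ {u} → A u → K u
        B⊆K   : ∀ {u} → B u → K u
        AB    : Disj A B
        A~X   : Touch A X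
        B~X   : Touch B X
        A~Y   : Touch A Y
        B~Y   : Touch B Y

    -- If B has not reached Y, let q be the vertex where it touches the path; A can be prolonged up
    -- to q as well. A connection avoiding q gives one of the two sets another way on, and the other
    -- set takes q and the rest of the path. If the connection meets neither set, part of it
    -- replaces B. In all cases the path gets shorter.
    augment : ∀ k {p bs} → State p bs → length bs ≤ k → TwoSets
    augment k {p} {bs} St le with State.ends St
    ... | inj₁ B~Y = record
      { A? = A? ∪? (λ u → u ∈? (p ∷ bs)) ; B? = B? ; cA = conn-overlap cA (path-conn path) p∈A (here refl) ; cB = cB
      ; A⊆K = λ { (inj₁ a) → A⊆K a ; (inj₂ (here refl)) → A⊆K p∈A ; (inj₂ (there u∈)) → bs⊆K u∈ } ; B⊆K = B⊆K
      ; AB = λ { (inj₁ a) b → AB a b ; (inj₂ (here refl)) b → AB p∈A b ; (inj₂ (there u∈)) b → B∌bs b u∈ }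
      ; A~X = touch-mono inj₁ id A~X ; B~X = B~X ; A~Y = touch-mono inj₂ id (path-touch path) ; B~Y = B~Y }
      where open State St
    augment zero {p} {[]} St le | inj₂ (_ , _ , _ , () , _)
    augment zero {p} {_ ∷ _} St () | inj₂ _
    augment (suc k) {p} {bs} St le | inj₂ (b₀ , r , bb , r∈ , e) = conclude (linked q)
      where
      open State St
      p≢r : p ≢ r
      p≢r refl = A∌bs p∈A r∈
      open Split (split-first {Q = ⟨ r ⟩} ⟨ r ⟩? path p≢r r∈ refl)
        renaming (bs to cs; bs⊆ to cs⊆; as to as′)

      A₁ : V → Set
      A₁ = A ∪ (_∈ p ∷ as′)

      A₁? : Decidable A₁
      A₁? = A? ∪? (λ u → u ∈? (p ∷ as′))

      cA₁ : Connected A₁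
      cA₁ = conn-overlap cA (path-conn prefix) p∈A (here refl)

      A₁⊆K : ∀ {u} → A₁ u → K u
      A₁⊆K (inj₁ a)           = A⊆K a
      A₁⊆K (inj₂ (here refl)) = A⊆K p∈A
      A₁⊆K (inj₂ (there u∈))  = bs⊆K (as⊆ u∈)

      A₁B : Disj A₁ B
      A₁B (inj₁ a) b           = AB a b
      A₁B (inj₂ (here refl)) b = AB p∈A b
      A₁B (inj₂ (there u∈)) b  = B∌bs b (as⊆ u∈)

      A₁∌cs : ∀ {u} → A₁ u → ¬ u ∈ cs
      A₁∌cs (inj₁ a) u∈ = A∌bs a (cs⊆ u∈)
      A₁∌cs (inj₂ t) u∈ = proj₁ (apart t u∈) refl

      q∉A₁ : ¬ A₁ q
      q∉A₁ (inj₁ a) = A∌bs a q∈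
      q∉A₁ (inj₂ t) = t≢q t refl

      q∉B : ¬ B q
      q∉B b = B∌bs b q∈

      B~q : Touch B ⟨ q ⟩
      B~q = b₀ , r , bb , sym Qq , e

      open Scan A₁? B? cA₁ cB q cs A₁∌cs (λ b u∈ → B∌bs b (cs⊆ u∈)) hiding (Ends)

      next : State q cs → TwoSets
      next St′ = augment k St′ (s≤s⁻¹ (<-≤-trans bs-shorter le))

      with-A₁ : ∀ {P : V → Set} → Decidable P → Connected P → (∀ {u} → P u → B u ⊎ Free u) → Touch P X →
                Touch P Y ⊎ Touch P (_∈ cs) → State q cs
      with-A₁ P? cP ⊆B P~X ends = record
        { A? = A₁? ∪? ⟨ q ⟩? ; B? = P? ; cA = conn-∪ cA₁ conn-⟨⟩ (touch-mono inj₂ id (path-touch prefix)) ; cB = cP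
        ; A⊆K = λ { (inj₁ a) → A₁⊆K a ; (inj₂ refl) → bs⊆K q∈ }
        ; B⊆K = λ p → [ B⊆K , proj₁ ]′ (⊆B p)
        ; AB = λ { (inj₁ a) p → [ A₁B a , (λ (_ , _ , ¬a , _) → ¬a a) ]′ (⊆B p)
                 ; (inj₂ refl) p → [ q∉B , (λ (_ , ne , _) → ne refl) ]′ (⊆B p) }
        ; A~X = touch-mono (inj₁ ∘ inj₁) id A~X ; B~X = P~X ; path = suffix ; p∈A = inj₂ refl
        ; A∌bs = λ { (inj₁ a) u∈ → A₁∌cs a u∈ ; (inj₂ refl) u∈ → q∉ u∈ }
        ; B∌bs = λ p u∈ → [ (λ b → B∌bs b (cs⊆ u∈)) , (λ (_ , _ , _ , _ , u∉) → u∉ u∈) ]′ (⊆B p)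
        ; bs⊆K = bs⊆K ∘ cs⊆ ; bs≁X = bs≁X ∘ cs⊆ ; ends = ends }

      with-B : Grown A₁ → State q cs
      with-B g = record
        { A? = B? ∪? ⟨ q ⟩? ; B? = Grown.set? g ; cA = conn-∪ cB conn-⟨⟩ B~q ; cB = Grown.conn g
        ; A⊆K = λ { (inj₁ b) → B⊆K b ; (inj₂ refl) → bs⊆K q∈ }
        ; B⊆K = λ p → [ A₁⊆K , proj₁ ]′ (Grown.⊆P g p)
        ; AB = λ { (inj₁ b) p → [ (λ a → A₁B a b) , (λ (_ , _ , _ , ¬b , _) → ¬b b) ]′ (Grown.⊆P g p)
                 ; (inj₂ refl) p → [ q∉A₁ , (λ (_ , ne , _) → ne refl) ]′ (Grown.⊆P g p) }
        ; A~X = touch-mono inj₁ id B~X ; B~X = touch-mono (Grown.⊇P g ∘ inj₁) id A~X ; path = suffix ; p∈A = inj₂ refl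
        ; A∌bs = λ { (inj₁ b) u∈ → B∌bs b (cs⊆ u∈) ; (inj₂ refl) u∈ → q∉ u∈ }
        ; B∌bs = λ p u∈ → [ (λ a → A₁∌cs a u∈) , (λ (_ , _ , _ , _ , u∉) → u∉ u∈) ]′ (Grown.⊆P g p)
        ; bs⊆K = bs⊆K ∘ cs⊆ ; bs≁X = bs≁X ∘ cs⊆ ; ends = Grown.ends g }

      conclude : (∃ λ s → ∃ λ t → AdjTo X s × AdjTo Y t × Conn G (K ∖ q) s t) → TwoSets
      conclude (s , t , (x , xx , e) , y , c) with scan c y
      ... | via-A _ g = next (with-B g)
      ... | via-B _ g = next (with-A₁ (Grown.set? g) (Grown.conn g) (Grown.⊆P g) (touch-mono (Grown.⊇P g) id B~X) (Grown.ends g))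
      -- The connection starts next to X, whereas the path beyond p has no neighbours in X.
      ... | in-cs s∈  = ⊥-elim (bs≁X (cs⊆ s∈) (x , xx , e))
      ... | in-seg (free , g) = next (with-A₁ (Grown.set? g) (Grown.conn g)
              (λ p → inj₂ ([ (λ { refl → free }) , id ]′ (Grown.⊆P g p))) (s , x , Grown.⊇P g refl , xx , e) (Grown.ends g))

    two-sets : ∃ K → TwoSets
    two-sets (k₀ , _) = start (linked k₀)
      where
      start : (∃ λ s → ∃ λ t → AdjTo X s × AdjTo Y t × Conn G (K ∖ k₀) s t) → TwoSets
      start (s , t , x , y , c) with path-from Y? c y
      ... | qs₀ , I₀ , sub with find-last (adjTo? X?) I₀
      ... | inj₂ (none ∷ _) = ⊥-elim (none x)
      ... | inj₁ (p , qs , I , (x₀ , xx₀ , e₀) , qs≁X , sub′) = second (linked p)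
        where
        inK : ∀ {u} → u ∈ p ∷ qs → K u
        inK = proj₁ ∘ sub ∘ sub′
        -- With both sets empty, a connection avoiding p can only yield a free segment, which is the
        -- initial B.
        open Scan {A = λ _ → ⊥} {B = λ _ → ⊥} (λ _ → no id) (λ _ → no id) (λ ()) (λ ()) p qs (λ ()) (λ ())
        second : (∃ λ s → ∃ λ t → AdjTo X s × AdjTo Y t × Conn G (K ∖ p) s t) → TwoSets
        second (s , t , (x , xx , e) , y , c) with scan c y
        ... | via-A () _
        ... | via-B () _
        ... | in-cs s∈ = ⊥-elim (All.lookup qs≁X s∈ (x , xx , e))
        ... | in-seg (free , g) = augment _ (record
          { A? = ⟨ p ⟩? ; B? = Grown.set? g ; cA = conn-⟨⟩ ; cB = Grown.conn g
          ; A⊆K = λ { refl → inK (here refl) } ; B⊆K = proj₁ ∘ in-free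
          ; AB = λ { refl b → proj₁ (proj₂ (in-free b)) refl }
          ; A~X = p , x₀ , refl , xx₀ , e₀ ; B~X = s , x , Grown.⊇P g refl , xx , e ; path = I ; p∈A = refl
          ; A∌bs = λ { refl → head-∉ I } ; B∌bs = λ b → proj₂ (proj₂ (proj₂ (proj₂ (in-free b))))
          ; bs⊆K = inK ∘ there ; bs≁X = All.lookup qs≁X ; ends = Grown.ends g }) ≤-refl
          where
          in-free : ∀ {u} → Grown.set g u → Free u
          in-free u∈ = [ (λ { refl → free }) , id ]′ (Grown.⊆P g u∈)

    record Enlarged (A B : V → Set) : Set₁ where
      field
        set  : V → Set
        set? : Decidable set
        conn : Connected set
        ⊆K   : ∀ {u} → set u → K u
        ⊇B   : ∀ {u} → B u → set u
        disj : Disj A set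

    -- The bags of 3 and 4 must touch, which Menger's theorem does not provide. A walk in K from A
    -- to B is read from its end, and B swallows its vertices until A is met.
    approach : ∀ {A B : V → Set} → Decidable A → Enlarged A B → ∀ {s b} → Conn G K s b → B b →
               (Σ (Enlarged A B) λ x → Enlarged.set x s) ⊎ (Σ (Enlarged A B) λ x → Touch A (Enlarged.set x))
    approach A? x₀ (stop _) bb = inj₁ (x₀ , Enlarged.⊇B x₀ bb)
    approach A? x₀ {s} (go k e c) bb with approach A? x₀ c bb
    ... | inj₂ r = inj₂ r
    ... | inj₁ (x , s′∈) with A? s
    ...   | yes a = inj₂ (x , s , _ , a , s′∈ , e)
    ...   | no ¬a = inj₁ (record
      { set = set ∪ ⟨ s ⟩ ; set? = set? ∪? ⟨ s ⟩? ; conn = conn-∪ conn conn-⟨⟩ (_ , s , s′∈ , refl , E-sym e)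
      ; ⊆K = λ { (inj₁ t) → ⊆K t ; (inj₂ refl) → k } ; ⊇B = inj₁ ∘ ⊇B
      ; disj = λ { a (inj₁ t) → disj a t ; a (inj₂ refl) → ¬a a } } , inj₂ refl)
      where open Enlarged x

    linked-model : ∀ {W} → Decidable W → Connected W → Connected X → Connected Y →
                   Far X Y → Far W K → Near W X → Near W Y → Disj X K → Disj Y K → FModel
    linked-model {W} W? cW cX cY XY WK WX WY XK YK = build (two-sets (let s , _ , _ , _ , c = linked w in s , proj₁ (conn-source c)))
      where
      w = proj₁ (proj₂ WX)
      build : TwoSets → FModel
      build T₀ with TwoSets.A~X T₀ | TwoSets.B~X T₀
      ... | a , _ , aa , _ | b , _ , bb , _
        with approach (TwoSets.A? T₀)
               (record { set? = TwoSets.B? T₀ ; conn = TwoSets.cB T₀ ; ⊆K = TwoSets.B⊆K T₀ ; ⊇B = id ; disj = TwoSets.AB T₀ })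
               (cK (TwoSets.A⊆K T₀ aa) (TwoSets.B⊆K T₀ bb)) bb
      ... | inj₁ (x , a∈) = ⊥-elim (Enlarged.disj x aa a∈)
      ... | inj₂ (x , A~B) = record
        { W? = W? ; X? = X? ; Y? = Y? ; B? = A? ; C? = set? ; cW = cW ; cX = cX ; cY = cY ; cB = cA ; cC = conn
        ; WX = WX ; WY = WY
        ; XB = (λ x a → XK x (A⊆K a)) , touch-sym A~X ; XC = (λ x b → XK x (⊆K b)) , touch-mono id ⊇B (touch-sym B~X)
        ; YB = (λ y a → YK y (A⊆K a)) , touch-sym A~Y ; YC = (λ y b → YK y (⊆K b)) , touch-mono id ⊇B (touch-sym B~Y)
        ; BC = disj , A~B ; XY = XY ; WB = far-mono id A⊆K WK ; WC = far-mono id ⊆K WK }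
        where
        open TwoSets T₀
        open Enlarged x

-- Semantics of formulas and inflationary closures

-- A propositional reading, in which witnesses can be given and taken apart directly. Set variables
-- remain Boolean, so closures are literally those of `eval`.
⟦_⟧ : Fm → ∀ {n} → Graph n → ℕ → ℕ → (ℕ → Fin n) → (ℕ → Fin n → Bool) → Set
⟦ edge x y ⟧  G d e ρ σ = G (ρ x) (ρ y) ≡ true
⟦ equal x y ⟧ G d e ρ σ = ρ x ≡ ρ y
⟦ mem y x ⟧   G d e ρ σ = σ y (ρ x) ≡ true
⟦ not′ φ ⟧    G d e ρ σ = ¬ ⟦ φ ⟧ G d e ρ σ
⟦ φ and ψ ⟧   G d e ρ σ = ⟦ φ ⟧ G d e ρ σ × ⟦ ψ ⟧ G d e ρ σ
⟦ φ or ψ ⟧    G d e ρ σ = ⟦ φ ⟧ G d e ρ σ ⊎ ⟦ ψ ⟧ G d e ρ σ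
⟦ ex φ ⟧      G d e ρ σ = ∃ λ a → ⟦ φ ⟧ G (suc d) e (ρ [ d ↦ a ]) σ
⟦ letc φ ψ ⟧ {n} G d e ρ σ =
  ⟦ ψ ⟧ G d (suc e) ρ
    (σ [ e ↦ closure (λ X a → eval G (suc d) (suc e) φ (ρ [ d ↦ a ]) (σ [ e ↦ X ])) (n * n) ])

∨-left : ∀ {a} b → a ≡ true → a ∨ b ≡ true
∨-left b refl = refl

eval⇒⟦⟧ : ∀ {n} (G : Graph n) φ {d e ρ σ} → eval G d e φ ρ σ ≡ true → ⟦ φ ⟧ G d e ρ σ
⟦⟧⇒eval : ∀ {n} (G : Graph n) φ {d e ρ σ} → ⟦ φ ⟧ G d e ρ σ → eval G d e φ ρ σ ≡ true

eval⇒⟦⟧ G (edge x y)  t = t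
eval⇒⟦⟧ G (equal x y) {ρ = ρ} t = Finₚ.toℕ-injective (≡ᵇ⇒≡ (toℕ (ρ x)) (toℕ (ρ y)) (subst T (sym t) tt))
eval⇒⟦⟧ G (mem y x)   t = t
eval⇒⟦⟧ G (not′ φ) {d} {e} {ρ} {σ} t s with eval G d e φ ρ σ in eq
... | false = true≢false (⟦⟧⇒eval G φ s) eq
eval⇒⟦⟧ G (φ and ψ) {d} {e} {ρ} {σ} t =
  let p , q = ∧-split (eval G d e φ ρ σ) t in eval⇒⟦⟧ G φ p , eval⇒⟦⟧ G ψ q
eval⇒⟦⟧ G (φ or ψ) {d} {e} {ρ} {σ} t with ∨-cases (eval G d e φ ρ σ) t
... | inj₁ p = inj₁ (eval⇒⟦⟧ G φ p)
... | inj₂ q = inj₂ (eval⇒⟦⟧ G ψ q)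
eval⇒⟦⟧ G (ex φ) t = let a , p = anyFin-witness _ t in a , eval⇒⟦⟧ G φ p
eval⇒⟦⟧ G (letc φ ψ) t = eval⇒⟦⟧ G ψ t

⟦⟧⇒eval G (edge x y)  s = s
⟦⟧⇒eval G (equal x y) {ρ = ρ} s = trans (cong (λ u → toℕ (ρ x) ≡ᵇ toℕ u) (sym s)) (≡ᵇ-refl (toℕ (ρ x)))
⟦⟧⇒eval G (mem y x)   s = s
⟦⟧⇒eval G (not′ φ) {d} {e} {ρ} {σ} s with eval G d e φ ρ σ in eq
... | true  = ⊥-elim (s (eval⇒⟦⟧ G φ eq))
... | false = refl
⟦⟧⇒eval G (φ and ψ) (p , q) = cong₂ _∧_ (⟦⟧⇒eval G φ p) (⟦⟧⇒eval G ψ q)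
⟦⟧⇒eval G (φ or ψ) (inj₁ p) = ∨-left _ (⟦⟧⇒eval G φ p)
⟦⟧⇒eval G (φ or ψ) {d} {e} {ρ} {σ} (inj₂ q) =
  trans (cong (eval G d e φ ρ σ ∨_) (⟦⟧⇒eval G ψ q)) (Boolₚ.∨-zeroʳ _)
⟦⟧⇒eval G (ex φ) (a , p) = anyFin-true _ a (⟦⟧⇒eval G φ p)
⟦⟧⇒eval G (letc φ ψ) s = ⟦⟧⇒eval G ψ s

⟦⟧-stable : ∀ {n} (G : Graph n) φ {d e ρ σ} → ¬ ¬ ⟦ φ ⟧ G d e ρ σ → ⟦ φ ⟧ G d e ρ σ
⟦⟧-stable G φ {d} {e} {ρ} {σ} nn with eval G d e φ ρ σ in eq
... | true  = eval⇒⟦⟧ G φ eq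
... | false = ⊥-elim (nn λ s → true≢false (⟦⟧⇒eval G φ s) eq)

module Inflation {n} (G : Graph n) (simple : IsSimple G) (F : (Fin n → Bool) → Fin n → Bool)
                 (mono : ∀ {X Y} → (∀ a → X a ≡ true → Y a ≡ true) → ∀ a → F X a ≡ true → F Y a ≡ true)
                 (N : ℕ) (n≤N : n ≤ N) where

  open Sets G simple using (size; size-strict; count)

  _⊑_ : (Fin n → Bool) → (Fin n → Bool) → Set
  X ⊑ Y = ∀ a → X a ≡ true → Y a ≡ true

  absorb-⊒ : ∀ i {X} → X ⊑ absorb F i X
  absorb-⊒ zero    a t = t
  absorb-⊒ (suc i) a t = ∨-left _ (absorb-⊒ i a t)

  absorb-step : ∀ {i k X} → i ≤ k → absorb F i X ⊑ absorb F k X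
  absorb-step {k = k} i≤k a t with m≤n⇒m<n∨m≡n i≤k
  ... | inj₂ refl = t
  absorb-step {k = suc k} i≤k a t | inj₁ (s≤s i≤k′) = ∨-left _ (absorb-step i≤k′ a t)

  -- The vertex a is tested at stage `toℕ a` against a superset of X, and F is monotone.
  absorb-F : ∀ {X} a → F X a ≡ true → absorb F N X a ≡ true
  absorb-F {X} a t = absorb-step {suc (toℕ a)} {N} (≤-trans (Finₚ.toℕ<n a) n≤N) a
    (trans (cong (absorb F (toℕ a) X a ∨_) (cong₂ _∧_ (≡ᵇ-refl (toℕ a)) (mono (absorb-⊒ (toℕ a)) a t)))
           (Boolₚ.∨-zeroʳ _))

  absorb-mono : ∀ i {X Y} → X ⊑ Y → absorb F i X ⊑ absorb F i Y
  absorb-mono zero    le a t = le a t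
  absorb-mono (suc i) {X} {Y} le a t with ∨-cases (absorb F i X a) t
  ... | inj₁ t′ = ∨-left _ (absorb-mono i le a t′)
  ... | inj₂ t′ = let p , q = ∧-split (i ≡ᵇ toℕ a) t′ in
    trans (cong (absorb F i Y a ∨_) (cong₂ _∧_ p (mono (absorb-mono i le) a q))) (Boolₚ.∨-zeroʳ _)

  absorb-sound : ∀ {P : Fin n → Set} → (∀ {X} → (∀ a → X a ≡ true → P a) → ∀ a → F X a ≡ true → P a) →
                 ∀ i {X} → (∀ a → X a ≡ true → P a) → ∀ a → absorb F i X a ≡ true → P a
  absorb-sound h zero    hX a t = hX a t
  absorb-sound h (suc i) {X} hX a t with ∨-cases (absorb F i X a) t
  ... | inj₁ t′ = absorb-sound h i hX a t′
  ... | inj₂ t′ = h (absorb-sound h i hX) a (proj₂ (∧-split (i ≡ᵇ toℕ a) t′))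

  rounds-sound : ∀ {P : Fin n → Set} → (∀ {X} → (∀ a → X a ≡ true → P a) → ∀ a → F X a ≡ true → P a) →
                 ∀ r a → rounds F N r a ≡ true → P a
  rounds-sound h (suc r) = absorb-sound h N (rounds-sound h r)

  private
    In : ℕ → Fin n → Set
    In r a = rounds F N r a ≡ true
    In? : ∀ r a → Dec (In r a)
    In? r a = rounds F N r a Boolₚ.≟ true

  -- An unstable round adds a vertex, and stability persists by monotonicity.
  stable-or-large : ∀ r → (rounds F N (suc r) ⊑ rounds F N r) ⊎ r ≤ size (In? r)
  stable-or-large zero = inj₂ z≤n
  stable-or-large (suc r) with stable-or-large r
  ... | inj₁ st = inj₁ (absorb-mono N st)
  ... | inj₂ le with Finₚ.any? (λ a → In? (suc r) a ×-dec ¬? (In? r a))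
  ...   | yes (a , t , ¬t) = inj₂ (≤-<-trans le (size-strict (In? r) (In? (suc r)) (absorb-⊒ N _) t ¬t))
  ...   | no none = inj₁ (absorb-mono N sub)
    where
    sub : rounds F N (suc r) ⊑ rounds F N r
    sub a t with In? r a
    ... | yes t′ = t′
    ... | no ¬t  = ⊥-elim (none (a , t , ¬t))

  rounds-closed : ∀ a → F (rounds F N N) a ≡ true → rounds F N N a ≡ true
  rounds-closed a t with stable-or-large N
  ... | inj₁ st = st a (absorb-F a t)
  ... | inj₂ le with In? N a
  ...   | yes t′ = t′
  -- A set with at least N ≥ n elements cannot miss a vertex.
  ...   | no ¬t  = ⊥-elim (<-irrefl refl (<-≤-trans (size-strict (In? N) (λ _ → yes tt) (λ _ → tt) tt ¬t)
                     (≤-trans (≤-trans (≤-reflexive size-all) n≤N) le)))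
    where
    count-all : ∀ xs → count (λ _ → yes tt) xs ≡ length xs
    count-all []       = refl
    count-all (x ∷ xs) = cong suc (count-all xs)
    size-all : size (λ _ → yes tt) ≡ n
    size-all = trans (count-all (allFin n)) (Listₚ.length-tabulate id)

  closure-sound : ∀ {P : Fin n → Set} → (∀ {X} → (∀ a → X a ≡ true → P a) → ∀ a → F X a ≡ true → P a) →
                  ∀ a → closure F N a ≡ true → P a
  closure-sound h a t = rounds-sound h N a (trans (sym (closure-rounds F N a)) t)

  closure-closed : ∀ a → F (closure F N) a ≡ true → closure F N a ≡ true
  closure-closed a t = trans (closure-rounds F N a)
    (rounds-closed a (mono (λ b t′ → trans (sym (closure-rounds F N b)) t′) a t))

-- The certificate formula. Variables 0,1 span X; 2,3 span Y; 4 is v and 5 is w.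
-- Set variable 0 is the component K of w, 1 is the component of v away from K, and
-- 2 is the part of K minus z that X reaches, where z is variable 6.

inX inY adjX adjY outside : ℕ → Fm
inX u = equal u 0 or equal u 1
inY u = equal u 2 or equal u 3
adjX u = edge u 0 or edge u 1
adjY u = edge u 2 or edge u 3
outside u = (not′ (inX u) and not′ (inY u)) and (not′ (equal u 4) and not′ (edge u 4))

stepK stepW stepR endpoints choice certificate-fm : Fm
stepK = equal 6 5 or (outside 6 and ex (mem 0 7 and edge 7 6))
stepW = equal 6 4 or (((not′ (inX 6) and not′ (inY 6)) and (not′ (mem 0 6) and not′ (ex (mem 0 7 and edge 6 7))))
                      and ex (mem 1 7 and edge 7 6))
stepR = (mem 0 7 and not′ (equal 7 6)) and (adjX 7 or ex (mem 2 8 and edge 8 7))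
endpoints = ex (mem 1 6 and adjY 6)
            and not′ (ex (mem 0 6 and letc stepR (not′ (ex (mem 2 7 and adjY 7)))))
choice = (equal 0 1 or edge 0 1) and (equal 2 3 or edge 2 3)
         and (not′ (inY 0 or adjY 0) and not′ (inY 1 or adjY 1))
         and (not′ (inX 4) and not′ (inY 4)) and adjX 4 and outside 5
certificate-fm = ex (ex (ex (ex (ex (choice and letc stepK (letc stepW endpoints))))))

-- The formula expresses the induced minor relation

module Correctness {n′} (G : Graph (suc n′)) (simple : IsSimple G) where

  private
    n = suc n′
    N = n * n
    n≤N : n ≤ N
    n≤N = m≤m*n n n

  open Sets G simple
  open Bags G simple
  open Paths G simple
  open Linking G simple

  conn-snoc : ∀ {P : V → Set} {u v w} → Conn G P u v → E v w → P w → Conn G P u w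
  conn-snoc c e p = conn-trans c (go (conn-target c) e (stop p))

  -- Every vertex on a walk from u is itself reached from u, so the walk stays in the set of reached
  -- vertices.
  component-conn : ∀ {P : V → Set} {u} → Connected (Conn G P u)
  component-conn {P} {u} c c′ = conn-trans (conn-sym (proj₁ simple) (along c)) (along c′)
    where
    along-from : ∀ {x y} → Conn G P u x → Conn G P x y → Conn G (Conn G P u) x y
    along-from c (stop p)   = stop c
    along-from c (go p e d) = go c e (along-from (conn-snoc c e (conn-source d)) d)
    along : ∀ {y} → Conn G P u y → Conn G (Conn G P u) u y
    along d = along-from (stop (conn-source d)) d

  -- All three closures have this shape: start, or lie in P next to a vertex already present. Since
  -- the set occurs only positively, monotonicity and the agreement of closure and reachability are
  -- proved once.
  module Spread (F : (V → Bool) → V → Bool) (Start P : V → Set)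
                (F⇒ : ∀ Z a → F Z a ≡ true → Start a ⊎ (P a × ∃ λ b → Z b ≡ true × E b a))
                (⇒F : ∀ Z a → Start a ⊎ (P a × ∃ λ b → Z b ≡ true × E b a) → F Z a ≡ true) where

    F-mono : ∀ {Z Z′ : V → Bool} → (∀ a → Z a ≡ true → Z′ a ≡ true) → ∀ a → F Z a ≡ true → F Z′ a ≡ true
    F-mono {Z} {Z′} le a t with F⇒ Z a t
    ... | inj₁ s               = ⇒F Z′ a (inj₁ s)
    ... | inj₂ (p , b , z , e) = ⇒F Z′ a (inj₂ (p , b , le b z , e))

    open Inflation G simple F F-mono N n≤N

    closure⇒conn : (∀ {s} → Start s → P s) → ∀ {a} → closure F N a ≡ true → ∃ λ s → Start s × Conn G P s a
    closure⇒conn start {a} = closure-sound from-next a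
      where
      from-next : ∀ {Z} → (∀ a → Z a ≡ true → ∃ λ s → Start s × Conn G P s a) →
                  ∀ a → F Z a ≡ true → ∃ λ s → Start s × Conn G P s a
      from-next {Z} hZ a t with F⇒ Z a t
      ... | inj₁ s               = a , s , stop (start s)
      ... | inj₂ (p , b , z , e) = let s , st , c = hZ b z in s , st , conn-snoc c e p

    conn⇒closure : ∀ {s a} → Start s → Conn G P s a → closure F N a ≡ true
    conn⇒closure {s} st c = along (closure-closed s (⇒F _ s (inj₁ st))) c
      where
      along : ∀ {x a} → closure F N x ≡ true → Conn G P x a → closure F N a ≡ true
      along k (stop _)           = k
      along k (go {v = y} _ e c) = along (closure-closed y (⇒F _ y (inj₂ (conn-source c , _ , k , e)))) c

  module Choice (x₁ x₂ y₁ y₂ v w : V) where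

    ρ : ℕ → V
    ρ = ((((((λ _ → zero) [ 0 ↦ x₁ ]) [ 1 ↦ x₂ ]) [ 2 ↦ y₁ ]) [ 3 ↦ y₂ ]) [ 4 ↦ v ]) [ 5 ↦ w ]

    X Y : V → Set
    X u = u ≡ x₁ ⊎ u ≡ x₂
    Y u = u ≡ y₁ ⊎ u ≡ y₂

    adjX→ : ∀ {u} → E u x₁ ⊎ E u x₂ → AdjTo X u
    adjX→ (inj₁ e) = x₁ , inj₁ refl , e
    adjX→ (inj₂ e) = x₂ , inj₂ refl , e

    →adjX : ∀ {u} → AdjTo X u → E u x₁ ⊎ E u x₂
    →adjX (_ , inj₁ refl , e) = inj₁ e
    →adjX (_ , inj₂ refl , e) = inj₂ e

    adjY→ : ∀ {u} → E u y₁ ⊎ E u y₂ → AdjTo Y u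
    adjY→ (inj₁ e) = y₁ , inj₁ refl , e
    adjY→ (inj₂ e) = y₂ , inj₂ refl , e

    →adjY : ∀ {u} → AdjTo Y u → E u y₁ ⊎ E u y₂
    →adjY (_ , inj₁ refl , e) = inj₁ e
    →adjY (_ , inj₂ refl , e) = inj₂ e

    σ₀ : ℕ → V → Bool
    σ₀ _ _ = false

    FK : (V → Bool) → V → Bool
    FK Z a = eval G 7 1 stepK (ρ [ 6 ↦ a ]) (σ₀ [ 0 ↦ Z ])

    Kb : V → Bool
    Kb = closure FK N

    K : V → Set
    K u = Kb u ≡ true

    σ₁ : ℕ → V → Bool
    σ₁ = σ₀ [ 0 ↦ Kb ]

    module SK = Spread FK ⟨ w ⟩ (Outside X Y v)
      (λ Z a → eval⇒⟦⟧ G stepK {7} {1} {ρ [ 6 ↦ a ]} {σ₀ [ 0 ↦ Z ]})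
      (λ Z a → ⟦⟧⇒eval G stepK {7} {1} {ρ [ 6 ↦ a ]} {σ₀ [ 0 ↦ Z ]})

    K⇒Conn : Outside X Y v w → ∀ {a} → K a → Conn G (Outside X Y v) w a
    K⇒Conn ow k with SK.closure⇒conn (λ { refl → ow }) k
    ... | _ , refl , c = c

    Conn⇒K : ∀ {a} → Conn G (Outside X Y v) w a → K a
    Conn⇒K = SK.conn⇒closure refl

    Away : V → Set
    Away u = (¬ X u × ¬ Y u) × (¬ K u × ¬ AdjTo K u)

    FW : (V → Bool) → V → Bool
    FW Z a = eval G 7 2 stepW (ρ [ 6 ↦ a ]) (σ₁ [ 1 ↦ Z ])

    Wb : V → Bool
    Wb = closure FW N

    W : V → Set
    W u = Wb u ≡ true

    σ₂ : ℕ → V → Bool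
    σ₂ = σ₁ [ 1 ↦ Wb ]

    module SW = Spread FW ⟨ v ⟩ Away
      (λ Z a → eval⇒⟦⟧ G stepW {7} {2} {ρ [ 6 ↦ a ]} {σ₁ [ 1 ↦ Z ]})
      (λ Z a → ⟦⟧⇒eval G stepW {7} {2} {ρ [ 6 ↦ a ]} {σ₁ [ 1 ↦ Z ]})

    W⇒Conn : Away v → ∀ {a} → W a → Conn G Away v a
    W⇒Conn av w∈ with SW.closure⇒conn (λ { refl → av }) w∈
    ... | _ , refl , c = c

    Conn⇒W : ∀ {a} → Conn G Away v a → W a
    Conn⇒W = SW.conn⇒closure refl

    module Reached (z : V) where

      FR : (V → Bool) → V → Bool
      FR Z a = eval G 8 3 stepR ((ρ [ 6 ↦ z ]) [ 7 ↦ a ]) (σ₂ [ 2 ↦ Z ])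

      Rb : V → Bool
      Rb = closure FR N

      -- `stepR` states membership in K minus z once for both alternatives, and `Spread` expects it
      -- in each of them.
      split : ∀ {P Q R′ : Set} → P × (Q ⊎ R′) → (P × Q) ⊎ (P × R′)
      split (p , inj₁ q) = inj₁ (p , q)
      split (p , inj₂ r) = inj₂ (p , r)

      unsplit : ∀ {P Q R′ : Set} → (P × Q) ⊎ (P × R′) → P × (Q ⊎ R′)
      unsplit (inj₁ (p , q)) = p , inj₁ q
      unsplit (inj₂ (p , r)) = p , inj₂ r

      module SR = Spread FR (λ a → (K ∖ z) a × (E a x₁ ⊎ E a x₂)) (K ∖ z)
        (λ Z a t → split (eval⇒⟦⟧ G stepR {8} {3} {(ρ [ 6 ↦ z ]) [ 7 ↦ a ]} {σ₂ [ 2 ↦ Z ]} t))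
        (λ Z a h → ⟦⟧⇒eval G stepR {8} {3} {(ρ [ 6 ↦ z ]) [ 7 ↦ a ]} {σ₂ [ 2 ↦ Z ]} (unsplit h))

      R⇒Conn : ∀ {a} → Rb a ≡ true → ∃ λ s → AdjTo X s × Conn G (K ∖ z) s a
      R⇒Conn r = let s , (_ , x) , c = SR.closure⇒conn proj₁ r in s , adjX→ x , c

      Conn⇒R : ∀ {s a} → AdjTo X s → Conn G (K ∖ z) s a → Rb a ≡ true
      Conn⇒R x c = SR.conn⇒closure (conn-source c , →adjX x) c

    Chosen : Set
    Chosen = ⟦ choice ⟧ G 6 0 ρ σ₀

    Ended : Set
    Ended = ⟦ endpoints ⟧ G 6 2 ρ σ₂

    pair-conn : ∀ {a b} → a ≡ b ⊎ E a b → Connected (λ u → u ≡ a ⊎ u ≡ b)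
    pair-conn (inj₁ refl) (inj₁ refl) (inj₁ refl) = stop (inj₁ refl)
    pair-conn (inj₁ refl) (inj₁ refl) (inj₂ refl) = stop (inj₁ refl)
    pair-conn (inj₁ refl) (inj₂ refl) (inj₁ refl) = stop (inj₁ refl)
    pair-conn (inj₁ refl) (inj₂ refl) (inj₂ refl) = stop (inj₁ refl)
    pair-conn {a} {b} (inj₂ e) = conn-∪ {⟨ a ⟩} {⟨ b ⟩} conn-⟨⟩ conn-⟨⟩ (a , b , refl , refl , e)

    sound : Chosen → Ended → FModel
    sound (xx , yy , (far₁ , far₂) , v∉ , v~X , ow) ((b , wb , b~Y) , no-cut) =
      linked-model (⟨ x₁ ⟩? ∪? ⟨ x₂ ⟩?) (⟨ y₁ ⟩? ∪? ⟨ y₂ ⟩?) (λ u → Kb u Boolₚ.≟ true) cK linked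
        (λ u → Wb u Boolₚ.≟ true) cW (pair-conn xx) (pair-conn yy) XY WK
        ((λ w x → proj₁ (proj₁ (away w)) x) , let x , xx , e = adjX→ v~X in v , x , Conn⇒W (stop av) , xx , e)
        ((λ w y → proj₂ (proj₁ (away w)) y) , let y , yy , e = adjY→ b~Y in b , y , wb , yy , e)
        (λ x k → proj₁ (proj₁ (out k)) x) (λ y k → proj₂ (proj₁ (out k)) y)
      where
      out : ∀ {u} → K u → Outside X Y v u
      out k = conn-target (K⇒Conn ow k)
      av : Away v
      av = v∉ , (λ k → proj₁ (proj₂ (out k)) refl) , λ (_ , k , e) → proj₂ (proj₂ (out k)) (E-sym e)
      away : ∀ {u} → W u → Away u
      away w = conn-target (W⇒Conn av w)
      cK : Connected K
      cK k k′ = conn-map Conn⇒K (component-conn (K⇒Conn ow k) (K⇒Conn ow k′))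
      cW : Connected W
      cW w w′ = conn-map Conn⇒W (component-conn (W⇒Conn av w) (W⇒Conn av w′))
      WK : Far W K
      WK = (λ w k → proj₁ (proj₂ (away w)) k) , λ w k e → proj₂ (proj₂ (away w)) (_ , k , e)
      XY : Far X Y
      XY = (λ { (inj₁ refl) y → far₁ (inj₁ y) ; (inj₂ refl) y → far₂ (inj₁ y) }) ,
           λ { (inj₁ refl) y e → far₁ (inj₂ (→adjY (_ , y , e))) ; (inj₂ refl) y e → far₂ (inj₂ (→adjY (_ , y , e))) }
      at-K : ∀ z → K z → ∃ λ s → ∃ λ t → AdjTo X s × AdjTo Y t × Conn G (K ∖ z) s t
      at-K z k =
        -- That no z in K is a cut gives existence only under a double negation, which is removed
        -- because formulas are decidable.
        let t , r , y = ⟦⟧-stable G (ex (mem 2 7 and adjY 7)) {7} {3} {ρ [ 6 ↦ z ]} {σ₂ [ 2 ↦ Reached.Rb z ]}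
                          (λ none → no-cut (z , k , none))
            s , x , c = Reached.R⇒Conn z r in
        s , t , x , adjY→ y , c
      linked : Linked X Y K
      linked z with Kb z Boolₚ.≟ true
      ... | yes k = at-K z k
      -- A vertex outside K blocks nothing in K, so the connection obtained for w serves.
      ... | no ¬k = let s , t , x , y , c = at-K w (Conn⇒K (stop ow)) in
                    s , t , x , y , conn-map (λ (k , _) → k , λ { refl → ¬k k }) c

  to-model : ⟦ ex certificate-fm ⟧ G 0 0 (λ _ → zero) (λ _ _ → false) → FModel
  to-model (x₁ , x₂ , y₁ , y₂ , v , w , ch , en) = Choice.sound x₁ x₂ y₁ y₂ v w ch en

  sound-fm : eval G 0 0 (ex certificate-fm) (λ _ → zero) (λ _ _ → false) ≡ true → F₂ ≼ G
  sound-fm t = Model⇒≼ F₂-simple simple (proj₂ (FModel⇒Model (to-model (eval⇒⟦⟧ G (ex certificate-fm) {0} {0} {λ _ → zero} {λ _ _ → false} t))))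

  complete-fm : F₂ ≼ G → eval G 0 0 (ex certificate-fm) (λ _ → zero) (λ _ _ → false) ≡ true
  complete-fm le = ⟦⟧⇒eval G (ex certificate-fm) {0} {0} {λ _ → zero} {λ _ _ → false}
    (from-certificate (FModel⇒Certificate (Model⇒FModel (proj₂ (≼⇒Model simple le)))))
    where
    from-certificate : Certificate → ⟦ ex certificate-fm ⟧ G 0 0 (λ _ → zero) (λ _ _ → false)
    from-certificate c = x₁ , x₂ , y₁ , y₂ , v , w , chosen , ended
      where
      open Certificate c renaming (X to X₀; Y to Y₀; K to K₀)
      x₁ = proj₁ smallX
      x₂ = proj₁ (proj₂ smallX)
      y₁ = proj₁ smallY
      y₂ = proj₁ (proj₂ smallY)
      open Choice x₁ x₂ y₁ y₂ v w
      X₀⇒X : ∀ {u} → X₀ u → X u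
      X₀⇒X = proj₁ (proj₂ (proj₂ (proj₂ (proj₂ smallX))))
      X⇒X₀ : ∀ {u} → X u → X₀ u
      X⇒X₀ (inj₁ refl) = proj₁ (proj₂ (proj₂ smallX))
      X⇒X₀ (inj₂ refl) = proj₁ (proj₂ (proj₂ (proj₂ smallX)))
      Y₀⇒Y : ∀ {u} → Y₀ u → Y u
      Y₀⇒Y = proj₁ (proj₂ (proj₂ (proj₂ (proj₂ smallY))))
      Y⇒Y₀ : ∀ {u} → Y u → Y₀ u
      Y⇒Y₀ (inj₁ refl) = proj₁ (proj₂ (proj₂ smallY))
      Y⇒Y₀ (inj₂ refl) = proj₁ (proj₂ (proj₂ (proj₂ smallY)))
      adj-mono : ∀ {P Q : V → Set} → (∀ {u} → P u → Q u) → ∀ {u} → AdjTo P u → AdjTo Q u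
      adj-mono f (p , pp , e) = p , f pp , e
      out⇒ : ∀ {u} → Outside X₀ Y₀ v u → Outside X Y v u
      out⇒ ((x , y) , o) = (x ∘ X⇒X₀ , y ∘ Y⇒Y₀) , o
      out⇐ : ∀ {u} → Outside X Y v u → Outside X₀ Y₀ v u
      out⇐ ((x , y) , o) = (x ∘ X₀⇒X , y ∘ Y₀⇒Y) , o
      ow : Outside X Y v w
      ow = out⇒ (conn-source (within w∈K))
      K₀⇒K : ∀ {u} → K₀ u → K u
      K₀⇒K k = Conn⇒K (conn-map out⇒ (within k))
      K⇒K₀ : ∀ {u} → K u → K₀ u
      K⇒K₀ k = closed (conn-map out⇐ (K⇒Conn ow k))
      far : ∀ {x} → X x → ¬ ((x ≡ y₁ ⊎ x ≡ y₂) ⊎ (E x y₁ ⊎ E x y₂))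
      far x (inj₁ y) = proj₁ XY (X⇒X₀ x) (Y⇒Y₀ y)
      far x (inj₂ e) = let _ , y , e′ = adjY→ e in proj₂ XY (X⇒X₀ x) (Y⇒Y₀ y) e′
      chosen : Chosen
      chosen = proj₂ (proj₂ (proj₂ (proj₂ (proj₂ smallX)))) , proj₂ (proj₂ (proj₂ (proj₂ (proj₂ smallY)))) ,
        (far (inj₁ refl) , far (inj₂ refl)) , (proj₁ v∉ ∘ X⇒X₀ , proj₂ v∉ ∘ Y⇒Y₀) , →adjX (adj-mono X₀⇒X v~X) , ow
      ended : Ended
      ended = (b , Conn⇒W (conn-map (λ ((x , y) , k , a) → (x ∘ X⇒X₀ , y ∘ Y⇒Y₀) , k ∘ K⇒K₀ , a ∘ adj-mono K⇒K₀) route) ,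
               →adjY (adj-mono Y₀⇒Y b~Y)) ,
        λ (z , k , none) → let s , t , x , y , c = linked z in
          none (t , Reached.Conn⇒R z (adj-mono X₀⇒X x) (conn-map (λ (k , ne) → K₀⇒K k , ne) c) , →adjY (adj-mono Y₀⇒Y y))

private
  -- The formula nests nine element variables, 0 to 8, and three set variables, so 10 is large
  -- enough as a bound. With the 6 fixed registers this makes 16 tracks in each family.
  open Compilation 10 using (init; exponent; answers; answers-empty)

  decider : TM
  decider = Machine.Compile.machine (Tracks.Cell 16) (Tracks.finite-Cell 16) init
              (Programs.setup 10 ⨾ Programs.comp 10 0 0 (ex certificate-fm))

theorem11 : DecidesInPolyTime (λ G → F₂ ≼ G)
theorem11 = decider , c , decide
  where
  c = exponent certificate-fm tt
  decide : ∀ {n} (G : Graph n) → IsSimple G → Σ Bool λ b →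
    (run decider (c * length (encode G) ^ c + c) (initConf decider (encode G)) ≡ just b)
    × ((b ≡ true → F₂ ≼ G) × (F₂ ≼ G → b ≡ true))
  -- The empty graph is treated apart, as an assignment of variables needs a vertex; it contains no
  -- bag and hence no F₂.
  decide {zero} G simple = false , answers-empty certificate-fm tt G , (λ ()) ,
    λ le → case proj₁ (Model.surj (proj₂ (≼⇒Model simple le)) zero) of λ ()
  decide {suc n} G simple =
    eval G 0 0 (ex certificate-fm) (λ _ → zero) (λ _ _ → false) ,
    answers certificate-fm tt G (λ _ → zero) (λ _ _ → false) ,
    Correctness.sound-fm G simple , Correctness.complete-fm G simple
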